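{- For all integers $n\ge 4$, \[ p(n,3)=b(n,3)=4E(n-1,3)-\left(\binom{n}{3}-\binom{n}{2}+4\right)2^{n-2}-22\binom{n}{5}+16\binom{n}{4}-4\binom{n}{3}+2n. \]
   Context: For a permutation $\pi=\pi_1\cdots\pi_n\in S_n$, a position $i\in\{1,\dots,n-1\}$ is an ascent if $\pi_i<\pi_{i+1}$ and a descent if $\pi_i>\pi_{i+1}$. The permutation $\pi$ is called ballot if for every $1\le k\le n-1$, the number of ascents among positions $1,\dots,k$ is at least the number of descents among positions $1,\dots,k$. Let $b(n,d)$ be the number of ballot permutations in $S_n$ with exactly $d$ descents. For a cycle $\mathfrak c=(c_1,\dots,c_k)$ of a permutation (fixed points are cycles of length 1), let $\mathrm{cA}(\mathfrak c)$ be the number of $i\in\{1,\dots,k\}$ with $c_i\le c_{i+1}$ and $\mathrm{cD}(\mathfrak c)$ the number with $c_i>c_{i+1}$, where $c_{k+1}=c_1$; let $M(\mathfrak c)=\min(\mathrm{cA}(\mathfrak c),\mathrm{cD}(\mathfrak c))$, and for a permutation $\pi$ let $M(\pi)$ be the sum of $M$ over its cycles. Let $p(n,d)$ be the number of permutations in $S_n$ all of whose cycles have odd length and with $M(\pi)=d$. $E(n,d)$ denotes the Eulerian number: the number of permutations of $[n]$ with exactly $d$ descents, with $E(0,0)=1$ and $E(0,d)=0$ for $d\ge1$. -}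

module Defs where

open import Data.Bool using (Bool; true; false; _∧_; if_then_else_; not)
open import Data.Nat using (ℕ; zero; suc; _+_; _*_; _∸_; _≤ᵇ_; _<ᵇ_; _≡ᵇ_; _⊓_)
open import Data.Fin using (Fin; toℕ)
open import Data.List using (List; []; _∷_; map; concatMap; length; filter; allFin; sum; all; any; upTo)
open import Data.Vec using (Vec; []; _∷_; toList; lookup)
open import Function using (_∘_)
open import Relation.Nullary.Decidable using (does)
open import Data.Bool.Properties using (T?)

-- The symmetric group S_n, enumerated explicitly.
-- A permutation of [n] is represented in one-line notation as a vector
-- v : Vec (Fin n) n with pairwise distinct entries; position i (0-based)
-- holds π(i+1) - 1.  The set S_n is the list of all such vectors.

vecsOver : {A : Set} → List A → (k : ℕ) → List (Vec A k)
vecsOver xs zero    = [] ∷ []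
vecsOver xs (suc k) = concatMap (λ x → map (x ∷_) (vecsOver xs k)) xs

elemᵇ : ℕ → List ℕ → Bool
elemᵇ x []       = false
elemᵇ x (y ∷ ys) = if x ≡ᵇ y then true else elemᵇ x ys

distinctᵇ : List ℕ → Bool
distinctᵇ []       = true
distinctᵇ (x ∷ xs) = not (elemᵇ x xs) ∧ distinctᵇ xs

oneLine : {n : ℕ} → Vec (Fin n) n → List ℕ
oneLine v = map toℕ (toList v)

isPermᵇ : {n : ℕ} → Vec (Fin n) n → Bool
isPermᵇ v = distinctᵇ (oneLine v)

Sym : (n : ℕ) → List (Vec (Fin n) n)
Sym n = filter (λ v → T? (isPermᵇ v)) (vecsOver (allFin n) n)

des : List ℕ → ℕ
des []           = 0
des (x ∷ [])     = 0
des (x ∷ y ∷ ys) = (if y <ᵇ x then 1 else 0) + des (y ∷ ys)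

ballotAux : ℕ → ℕ → List ℕ → Bool
ballotAux a d []           = true
ballotAux a d (x ∷ [])     = true
ballotAux a d (x ∷ y ∷ ys) =
  let a' = a + (if x <ᵇ y then 1 else 0)
      d' = d + (if y <ᵇ x then 1 else 0)
  in (d' ≤ᵇ a') ∧ ballotAux a' d' (y ∷ ys)

isBallot : List ℕ → Bool
isBallot = ballotAux 0 0

b : ℕ → ℕ → ℕ
b n d = length (filter (λ v → T? (isBallot (oneLine v) ∧ (des (oneLine v) ≡ᵇ d))) (Sym n))

E : ℕ → ℕ → ℕ
E n d = length (filter (λ v → T? (des (oneLine v) ≡ᵇ d)) (Sym n))

iter : {n : ℕ} → Vec (Fin n) n → ℕ → Fin n → Fin n
iter v zero    i = i
iter v (suc k) i = lookup v (iter v k i)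

-- the cycle of i listed as (c_1, ..., c_n') with c_1 = i, c_{j+1} = π(c_j),
-- where its length is the least k ≥ 1 with π^k(i) = i (searched in 1..n)
cycLenAux : {n : ℕ} → Vec (Fin n) n → Fin n → ℕ → List ℕ → ℕ
cycLenAux v i dflt []       = dflt
cycLenAux v i dflt (k ∷ ks) =
  if toℕ (iter v (suc k) i) ≡ᵇ toℕ i then suc k else cycLenAux v i dflt ks

cycLen : {n : ℕ} → Vec (Fin n) n → Fin n → ℕ
cycLen {n} v i = cycLenAux v i n (upTo n)

isLeader : {n : ℕ} → Vec (Fin n) n → Fin n → Bool
isLeader {n} v i = all (λ j → toℕ i ≤ᵇ toℕ (iter v j i)) (upTo n)

cA : {n : ℕ} → Vec (Fin n) n → Fin n → ℕ
cA v i = length (filter (λ j → T? (toℕ (iter v j i) ≤ᵇ toℕ (iter v (suc j) i))) (upTo (cycLen v i)))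

cD : {n : ℕ} → Vec (Fin n) n → Fin n → ℕ
cD v i = length (filter (λ j → T? (toℕ (iter v (suc j) i) <ᵇ toℕ (iter v j i))) (upTo (cycLen v i)))

Mcyc : {n : ℕ} → Vec (Fin n) n → Fin n → ℕ
Mcyc v i = cA v i ⊓ cD v i

-- M(π): sum of M over the cycles (each cycle counted once, via its leader)
Mperm : {n : ℕ} → Vec (Fin n) n → ℕ
Mperm {n} v = sum (map (λ i → if isLeader v i then Mcyc v i else 0) (allFin n))

oddᵇ : ℕ → Bool
oddᵇ zero          = false
oddᵇ (suc zero)    = true
oddᵇ (suc (suc k)) = oddᵇ k

allCyclesOdd : {n : ℕ} → Vec (Fin n) n → Bool
allCyclesOdd {n} v = all (λ i → oddᵇ (cycLen v i)) (allFin n)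

p : ℕ → ℕ → ℕ
p n d = length (filter (λ v → T? (allCyclesOdd v ∧ (Mperm v ≡ᵇ d))) (Sym n))

{-# OPTIONS --safe #-}

-- Both sides are computed by inserting the largest element.
--
-- Inserting it into a one-line word replaces a letter of the ascent-descent word by UD, puts a D in
-- front or a U at the end. A word with three descents fails to be ballot exactly when it begins with
-- D, UDD, UUDDD or UDUDD, and the numbers of permutations with these beginnings satisfy linear
-- recurrences which are solved explicitly.
--
-- Inserting it into a cycle replaces a letter of the cyclic ascent-descent word by UD. Hence the
-- exponential generating function P of the odd order permutations, weighted by t^M, satisfies
-- P′ = (Σ γ_j t^j) P, where γ_j counts the single cycles of odd length with M = j and is, up to
-- small terms, twice the even part of an Eulerian number sequence. So P = exp (∫ Σ γ_j t^j); with
-- u = e^x and v = e^(-x) all negative powers of u cancel in the coefficient of t^3.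

module Submission where

open import Defs
open import Algebra.Bundles using (CommutativeRing)
import Algebra.Solver.Ring as RingSolver
open import Algebra.Solver.Ring.AlmostCommutativeRing using (AlmostCommutativeRing; fromCommutativeRing; _-Raw-AlmostCommutative⟶_)
open import Data.Bool using (Bool; true; false; _∧_; if_then_else_; T)
open import Data.Bool.ListAction using (all)
open import Data.Bool.Properties using (T?; ∧-assoc; ∧-comm; ∧-idem; ∧-identityʳ; ∧-zeroʳ)
open import Data.Empty using (⊥; ⊥-elim)
open import Data.Fin as F using (Fin; toℕ)
import Data.Fin.Properties as FP
open import Data.Integer as Z using (ℤ; +_; _+_; _-_; _*_; -_; _^_)
import Data.Integer.Properties as ZP
open import Data.Integer.Tactic.RingSolver using (solve-∀)
open import Data.List using (List; []; _∷_; map; concatMap; concat; length; filter; foldr; allFin; tabulate; upTo; applyUpTo; _++_; _∷ʳ_; lookup; initLast; _∷ʳ′_)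
open import Data.List.Membership.Propositional using (_∈_; _∉_; find)
open import Data.List.Membership.Propositional.Properties using (∈-map⁺; ∈-map⁻; ∈-∃++; ∈-++⁻; ∈-filter⁺; ∈-filter⁻; ∈-concatMap⁺; ∈-concatMap⁻; ∈-allFin; ∈-lookup)
open import Data.List.Membership.Propositional.Properties.WithK using (unique∧set⇒bag)
import Data.List.Properties as LP
open import Data.List.Relation.Binary.BagAndSetEquality using (∼bag⇒↭)
open import Data.List.Relation.Binary.Disjoint.Propositional using (Disjoint)
open import Data.List.Relation.Binary.Permutation.Propositional using (_↭_; ↭-refl; ↭-sym; ↭-trans; ↭-reflexive; prep; swap; refl; trans)
import Data.List.Relation.Binary.Permutation.Propositional.Properties as PermP
open import Data.List.Relation.Unary.All as All using (All; []; _∷_)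
import Data.List.Relation.Unary.All.Properties as AllP
open import Data.List.Relation.Unary.AllPairs using ([]; _∷_)
open import Data.List.Relation.Unary.Any as Any using (here; there)
open import Data.List.Relation.Unary.Unique.Propositional using (Unique)
import Data.List.Relation.Unary.Unique.Propositional.Properties as UP
open import Data.Maybe using (Maybe; just; nothing)
open import Data.Nat as N using (ℕ; zero; suc; _≤_; _∸_)
open import Data.Nat.Combinatorics using (_C_; nCk+nC[k+1]≡[n+1]C[k+1])
open import Data.Nat.ListAction using (sum)
open import Data.Nat.ListAction.Properties using (sum-↭; sum-++)
import Data.Nat.Properties as NP
open import Data.List.Membership.DecPropositional N._≟_ using (_∈?_)
open import Data.Product using (_×_; _,_; proj₁; proj₂; ∃)
open import Data.Sum using (inj₁; inj₂)
open import Data.Unit using (tt)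
open import Data.Vec as V using (Vec; []; _∷_; toList)
open import Function using (_∘_; id)
open import Function.Bundles using (mk⇔)
open import Level using (0ℓ)
open import Relation.Binary.Definitions using (tri<; tri≈; tri>)
open import Relation.Binary.PropositionalEquality as ≡ using (_≡_; _≢_; refl; sym; cong; cong₂; subst; module ≡-Reasoning)
import Relation.Binary.Reasoning.Setoid as SetoidReasoning
open import Relation.Nullary using (yes; no; contradiction)

-- Sums over permutations and insertion of the largest entry

-- Insertion is used in dual form: it acts on functions of words or of cycle states, so a sum over
-- `S_n` becomes an iterated operator evaluated at one point. For cycles the operator `growAll`
-- obeys a Leibniz rule with respect to the product over the cycles. This is what turns the count
-- into a product of exponential generating functions and gives the differential equation.
--
-- All series are integer sequences, so denominators are cleared: by j! in the coefficient of t^j,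
-- and by 120 where closed forms are compared.
--
-- The small terms in γ_j come from the minimum. An odd cycle with j descents has M = j only if 2j
-- is less than its length, but the Eulerian numbers also count shorter cycles with j descents. For
-- j = 3 these are the 11 cycles of length 5 with 3 descents. Taken once by descents and once by
-- ascents, and multiplied by 3!, they give 132; divided by 6 this is the coefficient 22 of the
-- binomial coefficient n over 5 in the theorem.

private variable
  A B : Set

ind : Bool → ℤ
ind true  = + 1
ind false = + 0

∑ : (A → ℤ) → List A → ℤ
∑ f []       = + 0
∑ f (x ∷ xs) = f x + ∑ f xs

∑-cong : {f g : A → ℤ} (xs : List A) → (∀ x → x ∈ xs → f x ≡ g x) → ∑ f xs ≡ ∑ g xs
∑-cong []       h = refl
∑-cong (x ∷ xs) h = cong₂ _+_ (h x (here refl)) (∑-cong xs (λ y → h y ∘ there))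

∑-++ : (f : A → ℤ) (xs ys : List A) → ∑ f (xs ++ ys) ≡ ∑ f xs + ∑ f ys
∑-++ f []       ys = sym (ZP.+-identityˡ _)
∑-++ f (x ∷ xs) ys = ≡.trans (cong (_+_ (f x)) (∑-++ f xs ys)) (sym (ZP.+-assoc (f x) _ _))

∑-map : (f : B → ℤ) (g : A → B) (xs : List A) → ∑ f (map g xs) ≡ ∑ (f ∘ g) xs
∑-map f g []       = refl
∑-map f g (x ∷ xs) = cong (_+_ (f (g x))) (∑-map f g xs)

∑-concatMap : (f : B → ℤ) (g : A → List B) (xs : List A) → ∑ f (concatMap g xs) ≡ ∑ (∑ f ∘ g) xs
∑-concatMap f g []       = refl
∑-concatMap f g (x ∷ xs) = ≡.trans (∑-++ f (g x) _) (cong (_+_ (∑ f (g x))) (∑-concatMap f g xs))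

∑-↭ : (f : A → ℤ) {xs ys : List A} → xs ↭ ys → ∑ f xs ≡ ∑ f ys
∑-↭ f refl                  = refl
∑-↭ f (prep x r)            = cong (_+_ (f x)) (∑-↭ f r)
∑-↭ f (swap {xs} {ys} x y r) = begin
  f x + (f y + ∑ f xs)  ≡⟨ ZP.+-assoc (f x) _ _ ⟨
  f x + f y + ∑ f xs    ≡⟨ cong₂ _+_ (ZP.+-comm (f x) (f y)) (∑-↭ f r) ⟩
  f y + f x + ∑ f ys    ≡⟨ ZP.+-assoc (f y) _ _ ⟩
  f y + (f x + ∑ f ys)  ∎
  where open ≡-Reasoning
∑-↭ f (trans r s)           = ≡.trans (∑-↭ f r) (∑-↭ f s)

length-filter : (q : A → Bool) (xs : List A) → + length (filter (T? ∘ q) xs) ≡ ∑ (ind ∘ q) xs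
length-filter q []       = refl
length-filter q (x ∷ xs) with q x
... | true  = cong (_+_ (+ 1)) (length-filter q xs)
... | false = ≡.trans (length-filter q xs) (sym (ZP.+-identityˡ _))

Unique-resp-↭ : {xs ys : List A} → xs ↭ ys → Unique xs → Unique ys
Unique-resp-↭ refl         u                     = u
Unique-resp-↭ (prep x r)   (x∉ ∷ u)              = PermP.All-resp-↭ r x∉ ∷ Unique-resp-↭ r u
Unique-resp-↭ (swap x y r) ((x≢y ∷ x∉) ∷ y∉ ∷ u) =
  ((x≢y ∘ sym) ∷ PermP.All-resp-↭ r y∉) ∷ PermP.All-resp-↭ r x∉ ∷ Unique-resp-↭ r u
Unique-resp-↭ (trans r s)  u                     = Unique-resp-↭ s (Unique-resp-↭ r u)

-- `g` recovers the block from each of its elements, which makes different blocks disjoint.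
Unique-concatMap : (f : A → List B) (g : B → A) (xs : List A) → Unique xs →
  (∀ x → x ∈ xs → Unique (f x)) → (∀ x → x ∈ xs → ∀ y → y ∈ f x → g y ≡ x) →
  Unique (concatMap f xs)
Unique-concatMap f g []       u        uf inv = []
Unique-concatMap f g (x ∷ xs) (x∉ ∷ u) uf inv = UP.++⁺ (uf x (here refl))
  (Unique-concatMap f g xs u (λ y → uf y ∘ there) (λ y → inv y ∘ there)) disjoint
  where
  disjoint : Disjoint (f x) (concatMap f xs)
  disjoint {y} (y∈fx , y∈rest) with find (∈-concatMap⁻ f {xs = xs} y∈rest)
  ... | z , z∈xs , y∈fz = All.lookup x∉ z∈xs
    (≡.trans (sym (inv x (here refl) y y∈fx)) (inv z (there z∈xs) y y∈fz))

same-elements⇒↭ : {xs ys : List A} → Unique xs → Unique ys →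
  (∀ {x} → x ∈ xs → x ∈ ys) → (∀ {x} → x ∈ ys → x ∈ xs) → xs ↭ ys
same-elements⇒↭ u v f g = ∼bag⇒↭ (unique∧set⇒bag u v (mk⇔ f g))

elemᵇ⇒∈ : ∀ x ys → T (elemᵇ x ys) → x ∈ ys
elemᵇ⇒∈ x (y ∷ ys) t with x N.≡ᵇ y in eq
... | true  = here (NP.≡ᵇ⇒≡ x y (subst T (sym eq) tt))
... | false = there (elemᵇ⇒∈ x ys t)

∈⇒elemᵇ : ∀ x ys → x ∈ ys → elemᵇ x ys ≡ true
∈⇒elemᵇ x (y ∷ ys) x∈ with x N.≡ᵇ y in eq
... | true  = refl
∈⇒elemᵇ x (y ∷ ys) (here x≡y) | false = ⊥-elim (subst T eq (NP.≡⇒≡ᵇ x y x≡y))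
∈⇒elemᵇ x (y ∷ ys) (there x∈) | false = ∈⇒elemᵇ x ys x∈

distinctᵇ⇒Unique : ∀ xs → T (distinctᵇ xs) → Unique xs
distinctᵇ⇒Unique []       t = []
distinctᵇ⇒Unique (x ∷ xs) t with elemᵇ x xs in eq
... | false = AllP.¬Any⇒All¬ xs (λ x∈ → false≢true (≡.trans (sym eq) (∈⇒elemᵇ x xs x∈))) ∷ distinctᵇ⇒Unique xs t
  where
  false≢true : false ≢ true
  false≢true ()

Unique⇒distinctᵇ : ∀ xs → Unique xs → T (distinctᵇ xs)
Unique⇒distinctᵇ []       u        = tt
Unique⇒distinctᵇ (x ∷ xs) (x∉ ∷ u) with elemᵇ x xs in eq
... | true  = AllP.All¬⇒¬Any x∉ (elemᵇ⇒∈ x xs (subst T (sym eq) tt))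
... | false = Unique⇒distinctᵇ xs u

Unique-vecsOver : {xs : List A} → Unique xs → ∀ k → Unique (vecsOver xs k)
Unique-vecsOver u zero    = [] ∷ []
Unique-vecsOver {xs = xs} u (suc k) = Unique-concatMap _ V.head xs u
  (λ x _ → UP.map⁺ (λ { refl → refl }) (Unique-vecsOver u k))
  (λ x _ y y∈ → cong V.head (proj₂ (proj₂ (∈-map⁻ (x ∷_) y∈))))

∈-vecsOver : (xs : List A) → (∀ x → x ∈ xs) → ∀ {k} (v : Vec A k) → v ∈ vecsOver xs k
∈-vecsOver xs h []      = here refl
∈-vecsOver xs h (x ∷ v) = ∈-concatMap⁺ _ (Any.map (λ { refl → ∈-map⁺ (x ∷_) (∈-vecsOver xs h v) }) (h x))

IsPerm : ℕ → List ℕ → Set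
IsPerm n l = length l ≡ n × All (N._< n) l × Unique l

IsPerm-resp-↭ : ∀ {n l l′} → l ↭ l′ → IsPerm n l → IsPerm n l′
IsPerm-resp-↭ r (len , bd , u) =
  ≡.trans (sym (PermP.↭-length r)) len , PermP.All-resp-↭ r bd , Unique-resp-↭ r u

-- Plain words of numbers, because inserting a letter changes the alphabet `Fin n` of the vectors;
-- `toℕs-injective` ensures that the passage creates no repetitions.
perms : ℕ → List (List ℕ)
perms n = map oneLine (Sym n)

toℕs : ∀ {n k} → Vec (Fin n) k → List ℕ
toℕs v = map toℕ (toList v)

toℕs-injective : ∀ {n k} (v w : Vec (Fin n) k) → toℕs v ≡ toℕs w → v ≡ w
toℕs-injective []      []      eq = refl
toℕs-injective (x ∷ v) (y ∷ w) eq =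
  cong₂ _∷_ (FP.toℕ-injective (LP.∷-injectiveˡ eq)) (toℕs-injective v w (LP.∷-injectiveʳ eq))

length-toℕs : ∀ {n k} (v : Vec (Fin n) k) → length (toℕs v) ≡ k
length-toℕs []      = refl
length-toℕs (x ∷ v) = cong suc (length-toℕs v)

toℕs-bounded : ∀ {n k} (v : Vec (Fin n) k) → All (N._< n) (toℕs v)
toℕs-bounded []      = []
toℕs-bounded (x ∷ v) = FP.toℕ<n x ∷ toℕs-bounded v

toℕs-surjective : ∀ {n} l → All (N._< n) l → ∃ λ (v : Vec (Fin n) (length l)) → toℕs v ≡ l
toℕs-surjective []      []         = [] , refl
toℕs-surjective (x ∷ l) (x<n ∷ bd) with toℕs-surjective l bd
... | v , eq = F.fromℕ< x<n ∷ v , cong₂ _∷_ (FP.toℕ-fromℕ< x<n) eq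

∈perms⇒IsPerm : ∀ {n l} → l ∈ perms n → IsPerm n l
∈perms⇒IsPerm {n} l∈ with ∈-map⁻ oneLine l∈
... | v , v∈ , refl = length-toℕs v , toℕs-bounded v ,
  distinctᵇ⇒Unique _ (proj₂ (∈-filter⁻ (λ w → T? (isPermᵇ w)) {xs = vecsOver (allFin n) n} v∈))

IsPerm⇒∈perms : ∀ {n l} → IsPerm n l → l ∈ perms n
IsPerm⇒∈perms {l = l} (refl , bd , u) with toℕs-surjective l bd
... | v , eq = subst (_∈ perms (length l)) eq (∈-map⁺ oneLine
  (∈-filter⁺ (λ w → T? (isPermᵇ w)) (∈-vecsOver _ ∈-allFin v)
    (Unique⇒distinctᵇ _ (subst Unique (sym eq) u))))

Unique-perms : ∀ n → Unique (perms n)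
Unique-perms n = UP.map⁺ (λ {v} {w} → toℕs-injective v w)
  (UP.filter⁺ (λ w → T? (isPermᵇ w)) (Unique-vecsOver (UP.allFin⁺ n) n))

Unique-lookup : {xs : List A} → Unique xs → ∀ {i j} → i F.< j → lookup xs i ≢ lookup xs j
Unique-lookup {xs = x ∷ xs} (x∉ ∷ u) {F.zero}  {F.suc j} _   = All.lookup x∉ (∈-lookup j)
Unique-lookup {xs = x ∷ xs} (x∉ ∷ u) {F.suc i} {F.suc j} i<j = Unique-lookup u (N.s<s⁻¹ i<j)

Unique-bounded⇒length≤ : ∀ {n l} → Unique l → All (N._< n) l → length l N.≤ n
Unique-bounded⇒length≤ {n} {l} u bd with length l N.≤? n
... | yes p = p
... | no ¬p with FP.pigeonhole (NP.≰⇒> ¬p) (λ i → F.fromℕ< (All.lookup bd (∈-lookup i)))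
...   | i , j , i<j , eq = ⊥-elim (Unique-lookup u i<j
  (≡.trans (sym (FP.toℕ-fromℕ< (All.lookup bd (∈-lookup i)))) (≡.trans (cong toℕ eq) (FP.toℕ-fromℕ< (All.lookup bd (∈-lookup j))))))

<∧≢⇒< : ∀ {n l} → All (N._< suc n) l → n ∉ l → All (N._< n) l
<∧≢⇒< {n} bd n∉ = All.zipWith (λ (x<1+n , n≢x) → NP.≤∧≢⇒< (N.s≤s⁻¹ x<1+n) (n≢x ∘ sym)) (bd , AllP.¬Any⇒All¬ _ n∉)

max∈ : ∀ {n l} → IsPerm (suc n) l → n ∈ l
max∈ {n} {l} (len , bd , u) with n ∈? l
... | yes n∈ = n∈
... | no n∉  = ⊥-elim (NP.1+n≰n (subst (N._≤ n) len (Unique-bounded⇒length≤ u (<∧≢⇒< bd n∉))))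

max∉ : ∀ {n l} → IsPerm n l → n ∉ l
max∉ (_ , bd , _) n∈ = NP.<-irrefl refl (All.lookup bd n∈)

ins : ℕ → List ℕ → List (List ℕ)
ins m []       = (m ∷ []) ∷ []
ins m (x ∷ xs) = (m ∷ x ∷ xs) ∷ map (x ∷_) (ins m xs)

ins-↭ : ∀ m xs {ys} → ys ∈ ins m xs → ys ↭ m ∷ xs
ins-↭ m []       (here refl) = ↭-refl
ins-↭ m (x ∷ xs) (here refl) = ↭-refl
ins-↭ m (x ∷ xs) (there ys∈) with ∈-map⁻ (x ∷_) ys∈
... | zs , zs∈ , refl = ↭-trans (prep x (ins-↭ m xs zs∈)) (swap x m ↭-refl)

∈-ins : ∀ m xs ys → xs ++ m ∷ ys ∈ ins m (xs ++ ys)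
∈-ins m []       []       = here refl
∈-ins m []       (y ∷ ys) = here refl
∈-ins m (x ∷ xs) ys       = there (∈-map⁺ (x ∷_) (∈-ins m xs ys))

Unique-ins : ∀ m xs → m ∉ xs → Unique (ins m xs)
Unique-ins m []       m∉ = [] ∷ []
Unique-ins m (x ∷ xs) m∉ = AllP.map⁺ (All.universal (λ _ eq → m∉ (here (LP.∷-injectiveˡ eq))) _)
  ∷ UP.map⁺ LP.∷-injectiveʳ (Unique-ins m xs (m∉ ∘ there))

remove : ℕ → List ℕ → List ℕ
remove m []       = []
remove m (x ∷ xs) with x N.≟ m
... | yes _ = xs
... | no _  = x ∷ remove m xs

remove-ins : ∀ m xs → m ∉ xs → ∀ ys → ys ∈ ins m xs → remove m ys ≡ xs
remove-ins m []       m∉ ys (here refl) with m N.≟ m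
... | yes _ = refl
... | no ¬p = contradiction refl ¬p
remove-ins m (x ∷ xs) m∉ ys (here refl) with m N.≟ m
... | yes _ = refl
... | no ¬p = contradiction refl ¬p
remove-ins m (x ∷ xs) m∉ ys (there ys∈) with ∈-map⁻ (x ∷_) ys∈
... | zs , zs∈ , refl with x N.≟ m
...   | yes refl = contradiction (here refl) m∉
...   | no _     = cong (x ∷_) (remove-ins m xs (m∉ ∘ there) zs zs∈)

IsPerm-extend : ∀ {n l} → IsPerm n l → IsPerm (suc n) (n ∷ l)
IsPerm-extend q@(len , bd , u) =
  cong suc len , (NP.n<1+n _ ∷ All.map NP.m<n⇒m<1+n bd) , AllP.¬Any⇒All¬ _ (max∉ q) ∷ u

IsPerm-restrict : ∀ {n l} → IsPerm (suc n) (n ∷ l) → IsPerm n l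
IsPerm-restrict (len , _ ∷ bd , n∉ ∷ u) = NP.suc-injective len , <∧≢⇒< bd (AllP.All¬⇒¬Any n∉) , u

-- Splitting at the letter `n` shows that every larger word is an insertion. `remove n` recovers the
-- smaller word and `Unique-ins` separates the places, so nothing is produced twice.
perms-ins : ∀ n → perms (suc n) ↭ concatMap (ins n) (perms n)
perms-ins n = same-elements⇒↭ (Unique-perms (suc n)) unique to from
  where
  unique : Unique (concatMap (ins n) (perms n))
  unique = Unique-concatMap (ins n) (remove n) (perms n) (Unique-perms n)
    (λ l l∈ → Unique-ins n l (max∉ (∈perms⇒IsPerm l∈)))
    (λ l l∈ → remove-ins n l (max∉ (∈perms⇒IsPerm l∈)))
  to : ∀ {l} → l ∈ perms (suc n) → l ∈ concatMap (ins n) (perms n)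
  to l∈ with ∈-∃++ (max∈ (∈perms⇒IsPerm l∈))
  ... | xs , ys , refl = ∈-concatMap⁺ (ins n) (Any.map (λ { refl → ∈-ins n xs ys })
    (IsPerm⇒∈perms (IsPerm-restrict (IsPerm-resp-↭ (PermP.shift n xs ys) (∈perms⇒IsPerm l∈)))))
  from : ∀ {l} → l ∈ concatMap (ins n) (perms n) → l ∈ perms (suc n)
  from l∈ with find (∈-concatMap⁻ (ins n) {xs = perms n} l∈)
  ... | xs , xs∈ , l∈ins = IsPerm⇒∈perms
    (IsPerm-resp-↭ (↭-sym (ins-↭ n xs l∈ins)) (IsPerm-extend (∈perms⇒IsPerm xs∈)))

rotate : List ℕ → List ℕ
rotate []       = []
rotate (x ∷ xs) = xs ∷ʳ x

-- Turns the insertions of m into a one-line word into its insertions into a cycle.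
rotateAfter : ℕ → List ℕ → List ℕ
rotateAfter m []       = []
rotateAfter m (x ∷ xs) with x N.≟ m
... | yes _ = x ∷ rotate xs
... | no _  = x ∷ rotateAfter m xs

rotate-injective : ∀ xs ys → rotate xs ≡ rotate ys → xs ≡ ys
rotate-injective []           []           eq = refl
rotate-injective []           (y ∷ [])     ()
rotate-injective []           (y ∷ _ ∷ _)  ()
rotate-injective (x ∷ [])     []           ()
rotate-injective (x ∷ _ ∷ _)  []           ()
rotate-injective (x ∷ xs)     (y ∷ ys)     eq with LP.∷ʳ-injective xs ys eq
... | refl , refl = refl

rotateAfter-injective : ∀ m xs ys → rotateAfter m xs ≡ rotateAfter m ys → xs ≡ ys
rotateAfter-injective m []       []       eq = refl
rotateAfter-injective m []       (y ∷ ys) eq with y N.≟ m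
rotateAfter-injective m []       (y ∷ ys) () | yes _
rotateAfter-injective m []       (y ∷ ys) () | no _
rotateAfter-injective m (x ∷ xs) []       eq with x N.≟ m
rotateAfter-injective m (x ∷ xs) []       () | yes _
rotateAfter-injective m (x ∷ xs) []       () | no _
rotateAfter-injective m (x ∷ xs) (y ∷ ys) eq with x N.≟ m | y N.≟ m
... | yes p | yes q = cong₂ _∷_ (LP.∷-injectiveˡ eq) (rotate-injective xs ys (LP.∷-injectiveʳ eq))
... | yes p | no q  = contradiction (≡.trans (sym (LP.∷-injectiveˡ eq)) p) q
... | no p  | yes q = contradiction (≡.trans (LP.∷-injectiveˡ eq) q) p
... | no p  | no q  = cong₂ _∷_ (LP.∷-injectiveˡ eq) (rotateAfter-injective m xs ys (LP.∷-injectiveʳ eq))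

rotate-↭ : ∀ xs → rotate xs ↭ xs
rotate-↭ []       = ↭-refl
rotate-↭ (x ∷ xs) = ↭-sym (PermP.∷↭∷ʳ x xs)

rotateAfter-↭ : ∀ m xs → rotateAfter m xs ↭ xs
rotateAfter-↭ m []       = ↭-refl
rotateAfter-↭ m (x ∷ xs) with x N.≟ m
... | yes _ = prep x (rotate-↭ xs)
... | no _  = prep x (rotateAfter-↭ m xs)

rotate-surjective : ∀ ys → ∃ λ xs → rotate xs ≡ ys
rotate-surjective ys with initLast ys
... | []      = [] , refl
... | xs ∷ʳ′ x = x ∷ xs , refl

rotateAfter-surjective : ∀ m ys → ∃ λ xs → rotateAfter m xs ≡ ys
rotateAfter-surjective m []       = [] , refl
rotateAfter-surjective m (y ∷ ys) with y N.≟ m in eq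
... | yes p = y ∷ proj₁ (rotate-surjective ys) , head≡
  where
  head≡ : rotateAfter m (y ∷ proj₁ (rotate-surjective ys)) ≡ y ∷ ys
  head≡ rewrite eq = cong (y ∷_) (proj₂ (rotate-surjective ys))
... | no p  = y ∷ proj₁ (rotateAfter-surjective m ys) , head≡
  where
  head≡ : rotateAfter m (y ∷ proj₁ (rotateAfter-surjective m ys)) ≡ y ∷ ys
  head≡ rewrite eq = cong (y ∷_) (proj₂ (rotateAfter-surjective m ys))

-- The letters up to and including `m` stay in place, so the rotated part can be located and rotated
-- back; the letters themselves are only rearranged.
perms-rotateAfter : ∀ m n → map (rotateAfter m) (perms n) ↭ perms n
perms-rotateAfter m n = same-elements⇒↭ (UP.map⁺ (λ {x} {y} → rotateAfter-injective m x y) (Unique-perms n)) (Unique-perms n) to from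
  where
  to : ∀ {l} → l ∈ map (rotateAfter m) (perms n) → l ∈ perms n
  to l∈ with ∈-map⁻ (rotateAfter m) l∈
  ... | xs , xs∈ , refl = IsPerm⇒∈perms (IsPerm-resp-↭ (↭-sym (rotateAfter-↭ m xs)) (∈perms⇒IsPerm xs∈))
  from : ∀ {l} → l ∈ perms n → l ∈ map (rotateAfter m) (perms n)
  from {l} l∈ with rotateAfter-surjective m l
  ... | xs , refl = ∈-map⁺ (rotateAfter m) (IsPerm⇒∈perms (IsPerm-resp-↭ (rotateAfter-↭ m xs) (∈perms⇒IsPerm l∈)))

-- The one-line word in which m is inserted after i in its cycle, i ↦ m ↦ l ! i;
-- for i = length l it becomes a fixed point.
graft : ℕ → List ℕ → ℕ → List ℕ
graft m []       i       = m ∷ []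
graft m (x ∷ xs) zero    = m ∷ xs ∷ʳ x
graft m (x ∷ xs) (suc i) = x ∷ graft m xs i

-- If `m` stands in front of the letter x at place i, the rotation moves x to the end. When m =
-- `length xs` the end is place m, so the result maps i to m and m to x.
rotateAfter-ins : ∀ m xs → m ∉ xs → map (rotateAfter m) (ins m xs) ≡ applyUpTo (graft m xs) (suc (length xs))
rotateAfter-ins m []       m∉ with m N.≟ m
... | yes _ = refl
... | no ¬p = contradiction refl ¬p
rotateAfter-ins m (x ∷ xs) m∉ = cong₂ _∷_ first rest
  where
  first : rotateAfter m (m ∷ x ∷ xs) ≡ graft m (x ∷ xs) 0
  first with m N.≟ m
  ... | yes _ = refl
  ... | no ¬p = contradiction refl ¬p
  skip : ∀ ys → rotateAfter m (x ∷ ys) ≡ x ∷ rotateAfter m ys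
  skip ys with x N.≟ m
  ... | yes refl = contradiction (here refl) m∉
  ... | no _     = refl
  open ≡-Reasoning
  rest : map (rotateAfter m) (map (x ∷_) (ins m xs)) ≡ applyUpTo (graft m (x ∷ xs) ∘ suc) (suc (length xs))
  rest = begin
    map (rotateAfter m) (map (x ∷_) (ins m xs))      ≡⟨ LP.map-∘ (ins m xs) ⟨
    map (rotateAfter m ∘ (x ∷_)) (ins m xs)          ≡⟨ LP.map-cong skip (ins m xs) ⟩
    map ((x ∷_) ∘ rotateAfter m) (ins m xs)          ≡⟨ LP.map-∘ (ins m xs) ⟩
    map (x ∷_) (map (rotateAfter m) (ins m xs))      ≡⟨ cong (map (x ∷_)) (rotateAfter-ins m xs (m∉ ∘ there)) ⟩
    map (x ∷_) (applyUpTo (graft m xs) (suc (length xs))) ≡⟨ LP.map-applyUpTo (graft m xs) (x ∷_) (suc (length xs)) ⟩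
    applyUpTo (graft m (x ∷ xs) ∘ suc) (suc (length xs)) ∎

concatMap-cong-∈ : (f g : A → List B) (xs : List A) → (∀ x → x ∈ xs → f x ≡ g x) → concatMap f xs ≡ concatMap g xs
concatMap-cong-∈ f g []       h = refl
concatMap-cong-∈ f g (x ∷ xs) h = cong₂ _++_ (h x (here refl)) (concatMap-cong-∈ f g xs (λ y → h y ∘ there))

perms-graft : ∀ n → perms (suc n) ↭ concatMap (λ l → map (graft n l) (upTo (suc n))) (perms n)
perms-graft n = ↭-trans (↭-sym (perms-rotateAfter n (suc n)))
  (↭-trans (PermP.map⁺ (rotateAfter n) (perms-ins n)) (↭-reflexive eq))
  where
  open ≡-Reasoning
  eq : map (rotateAfter n) (concatMap (ins n) (perms n)) ≡ concatMap (λ l → map (graft n l) (upTo (suc n))) (perms n)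
  eq = begin
    map (rotateAfter n) (concatMap (ins n) (perms n))          ≡⟨ LP.map-concatMap (rotateAfter n) (ins n) (perms n) ⟩
    concatMap (map (rotateAfter n) ∘ ins n) (perms n)          ≡⟨ concatMap-cong-∈ _ _ (perms n) (λ l l∈ → let q = ∈perms⇒IsPerm l∈ in
        ≡.trans (rotateAfter-ins n l (max∉ q)) (≡.trans (cong (applyUpTo (graft n l) ∘ suc) (proj₁ q)) (sym (LP.map-upTo (graft n l) (suc n))))) ⟩
    concatMap (λ l → map (graft n l) (upTo (suc n))) (perms n) ∎

-- Descent words

data Step : Set where
  U D : Step

Word : Set
Word = List Step

step : ℕ → ℕ → Step
step x y = if y N.<ᵇ x then D else U

steps : ℕ → List ℕ → Word
steps x []       = []
steps x (y ∷ ys) = step x y ∷ steps y ys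

word : List ℕ → Word
word []       = []
word (x ∷ xs) = steps x xs

downs : Word → ℕ
downs []      = 0
downs (U ∷ w) = downs w
downs (D ∷ w) = suc (downs w)

des≡downs : ∀ l → des l ≡ downs (word l)
des≡downs []       = refl
des≡downs (x ∷ xs) = go x xs
  where
  go : ∀ x xs → des (x ∷ xs) ≡ downs (steps x xs)
  go x []       = refl
  go x (y ∷ ys) with y N.<ᵇ x
  ... | true  = cong suc (go y ys)
  ... | false = go y ys

ballotWord : ℕ → ℕ → Word → Bool
ballotWord a d []      = true
ballotWord a d (U ∷ w) = (d N.≤ᵇ suc a) ∧ ballotWord (suc a) d w
ballotWord a d (D ∷ w) = (suc d N.≤ᵇ a) ∧ ballotWord a (suc d) w

-- Distinct letters exclude ties between neighbours, for which `ballotAux` would count neither an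
-- ascent nor a descent while `step` always gives a letter.
ballotAux≡ballotWord : ∀ a d l → Unique l → ballotAux a d l ≡ ballotWord a d (word l)
ballotAux≡ballotWord a d []           u = refl
ballotAux≡ballotWord a d (x ∷ [])     u = refl
ballotAux≡ballotWord a d (x ∷ y ∷ ys) ((x≢y ∷ _) ∷ u) with y N.<ᵇ x in y<x | x N.<ᵇ y in x<y
... | true  | true  = ⊥-elim (NP.<-asym (NP.<ᵇ⇒< y x (subst T (sym y<x) tt)) (NP.<ᵇ⇒< x y (subst T (sym x<y) tt)))
... | true  | false rewrite NP.+-identityʳ a | NP.+-comm d 1 = cong (_ ∧_) (ballotAux≡ballotWord a (suc d) (y ∷ ys) u)
... | false | true  rewrite NP.+-identityʳ d | NP.+-comm a 1 = cong (_ ∧_) (ballotAux≡ballotWord (suc a) d (y ∷ ys) u)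
... | false | false = ⊥-elim (x≢y (NP.≤-antisym
  (NP.≮⇒≥ (λ p → subst T y<x (NP.<⇒<ᵇ p))) (NP.≮⇒≥ (λ p → subst T x<y (NP.<⇒<ᵇ p)))))

inserts : (Word → ℤ) → Word → ℤ
inserts F []      = F (U ∷ [])
inserts F (s ∷ w) = F (U ∷ D ∷ w) + inserts (F ∘ (s ∷_)) w

insertsMax : (Word → ℤ) → Word → ℤ
insertsMax F w = F (D ∷ w) + inserts F w

step-U : ∀ {x m} → x N.< m → step x m ≡ U
step-U {x} {m} x<m with m N.<ᵇ x in eq
... | true  = ⊥-elim (NP.<-asym x<m (NP.<ᵇ⇒< m x (subst T (sym eq) tt)))
... | false = refl

step-D : ∀ {x m} → x N.< m → step m x ≡ D
step-D {x} {m} x<m with x N.<ᵇ m in eq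
... | true  = refl
... | false = ⊥-elim (subst T eq (NP.<⇒<ᵇ x<m))

∑-ins-steps : ∀ F m x xs → All (N._< m) (x ∷ xs) →
  ∑ (F ∘ steps x) (ins m xs) ≡ inserts F (steps x xs)
∑-ins-steps F m x []       (x<m ∷ _) = ≡.trans (ZP.+-identityʳ _) (cong (λ s → F (s ∷ [])) (step-U x<m))
∑-ins-steps F m x (y ∷ ys) (x<m ∷ y<m ∷ bd) = cong₂ _+_
  (cong₂ (λ s t → F (s ∷ t ∷ steps y ys)) (step-U x<m) (step-D y<m))
  (≡.trans (∑-map (F ∘ steps x) (y ∷_) (ins m ys)) (∑-ins-steps (F ∘ (step x y ∷_)) m y ys (y<m ∷ bd)))

∑-ins-word : ∀ F m x xs → All (N._< m) (x ∷ xs) →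
  ∑ (F ∘ word) (ins m (x ∷ xs)) ≡ insertsMax F (word (x ∷ xs))
∑-ins-word F m x xs bd@(x<m ∷ _) = cong₂ _+_ (cong (λ s → F (s ∷ steps x xs)) (step-D x<m))
  (≡.trans (∑-map (F ∘ word) (x ∷_) (ins m xs)) (∑-ins-steps F m x xs bd))

-- The `n` insertions are moved from the permutations to the function; what remains is an evaluation
-- at the empty word of the single permutation of one element.
wordSum : ℕ → (Word → ℤ) → ℤ
wordSum zero    F = F []
wordSum (suc n) F = wordSum n (insertsMax F)

∑-perms≡wordSum : ∀ n F → ∑ (F ∘ word) (perms (suc n)) ≡ wordSum n F
∑-perms≡wordSum zero    F = ZP.+-identityʳ _
∑-perms≡wordSum (suc n) F = begin
  ∑ (F ∘ word) (perms (suc (suc n)))  ≡⟨ ∑-↭ (F ∘ word) (perms-ins (suc n)) ⟩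
  ∑ (F ∘ word) (concatMap (ins (suc n)) (perms (suc n)))    ≡⟨ ∑-concatMap (F ∘ word) (ins (suc n)) (perms (suc n)) ⟩
  ∑ (∑ (F ∘ word) ∘ ins (suc n)) (perms (suc n))  ≡⟨ ∑-cong (perms (suc n)) (λ l l∈ → nonempty l (∈perms⇒IsPerm l∈)) ⟩
  ∑ (insertsMax F ∘ word) (perms (suc n))  ≡⟨ ∑-perms≡wordSum n (insertsMax F) ⟩
  wordSum n (insertsMax F)  ∎
  where
  open ≡-Reasoning
  nonempty : ∀ l → IsPerm (suc n) l → ∑ (F ∘ word) (ins (suc n) l) ≡ insertsMax F (word l)
  nonempty (x ∷ xs) (_ , bd , _) = ∑-ins-word F (suc n) x xs bd

inserts-cong : ∀ {F G} w → (∀ z → length z ≡ suc (length w) → F z ≡ G z) → inserts F w ≡ inserts G w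
inserts-cong []      h = h _ refl
inserts-cong (s ∷ w) h = cong₂ _+_ (h _ refl) (inserts-cong w (λ z eq → h (s ∷ z) (cong suc eq)))

-- Only words of length `n` matter, which later lets `length w` in the coefficients of a recurrence
-- be replaced by `n`.
wordSum-cong : ∀ n {F G} → (∀ w → length w ≡ n → F w ≡ G w) → wordSum n F ≡ wordSum n G
wordSum-cong zero    h = h [] refl
wordSum-cong (suc n) h = wordSum-cong n λ w eq → cong₂ _+_ (h (D ∷ w) (cong suc eq))
  (inserts-cong w (λ z eq′ → h z (≡.trans eq′ (cong suc eq))))

lin-interchange : ∀ c x y x′ y′ → c * x + y + (c * x′ + y′) ≡ c * (x + x′) + (y + y′)
lin-interchange = solve-∀

inserts-lin : ∀ c F G w → inserts (λ z → c * F z + G z) w ≡ c * inserts F w + inserts G w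
inserts-lin c F G []      = refl
inserts-lin c F G (s ∷ w) = ≡.trans (cong (_+_ (c * F (U ∷ D ∷ w) + G (U ∷ D ∷ w))) (inserts-lin c (F ∘ (s ∷_)) (G ∘ (s ∷_)) w))
  (lin-interchange c (F (U ∷ D ∷ w)) (G (U ∷ D ∷ w)) _ _)

wordSum-lin : ∀ n c F G → wordSum n (λ z → c * F z + G z) ≡ c * wordSum n F + wordSum n G
wordSum-lin zero    c F G = refl
wordSum-lin (suc n) c F G = ≡.trans
  (wordSum-cong n (λ w _ → ≡.trans (cong (_+_ (c * F (D ∷ w) + G (D ∷ w))) (inserts-lin c F G w)) (lin-interchange c (F (D ∷ w)) (G (D ∷ w)) _ _)))
  (wordSum-lin n c (insertsMax F) (insertsMax G))

inserts-0 : ∀ w → inserts (λ _ → + 0) w ≡ + 0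
inserts-0 []      = refl
inserts-0 (s ∷ w) = ≡.trans (ZP.+-identityˡ _) (inserts-0 w)

wordSum-0 : ∀ n → wordSum n (λ _ → + 0) ≡ + 0
wordSum-0 zero    = refl
wordSum-0 (suc n) = ≡.trans
  (wordSum-cong n {G = λ _ → + 0} (λ w _ → ≡.trans (ZP.+-identityˡ _) (inserts-0 w))) (wordSum-0 n)

after : Step → (Word → ℤ) → Word → ℤ
after s F []      = + 0
after U F (U ∷ w) = F w
after U F (D ∷ w) = + 0
after D F (U ∷ w) = + 0
after D F (D ∷ w) = F w

prefixed : Word → (Word → ℤ) → Word → ℤ
prefixed []      F = F
prefixed (s ∷ u) F = after s (prefixed u F)

after-cong : ∀ s {F G} → (∀ w → F w ≡ G w) → ∀ w → after s F w ≡ after s G w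
after-cong U h []      = refl
after-cong U h (U ∷ w) = h w
after-cong U h (D ∷ w) = refl
after-cong D h []      = refl
after-cong D h (U ∷ w) = refl
after-cong D h (D ∷ w) = h w

after-+ : ∀ s F G w → after s (λ z → F z + G z) w ≡ after s F w + after s G w
after-+ U F G []      = refl
after-+ U F G (U ∷ w) = refl
after-+ U F G (D ∷ w) = refl
after-+ D F G []      = refl
after-+ D F G (U ∷ w) = refl
after-+ D F G (D ∷ w) = refl

after-∑ : ∀ s F us w → after s (λ z → ∑ (λ u → prefixed u F z) us) w ≡ ∑ (λ u → prefixed u F w) (map (s ∷_) us)
after-∑ s F []       w = after-0 s w
  where
  after-0 : ∀ s w → after s (λ _ → + 0) w ≡ + 0
  after-0 s []      = refl
  after-0 U (U ∷ w) = refl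
  after-0 U (D ∷ w) = refl
  after-0 D (U ∷ w) = refl
  after-0 D (D ∷ w) = refl
after-∑ s F (u ∷ us) w = ≡.trans (after-+ s (prefixed u F) _ w) (cong (_+_ (after s (prefixed u F) w)) (after-∑ s F us w))

-- An inserted UD or a final U never creates a leading D, so the insertion takes place behind it.
inserts-after-D : ∀ F w → inserts (after D F) w ≡ after D (inserts F) w
inserts-after-D F []      = refl
inserts-after-D F (U ∷ w) = ≡.trans (ZP.+-identityˡ _) (inserts-0 w)
inserts-after-D F (D ∷ w) = ZP.+-identityˡ _

inserts-after-UU : ∀ F w → inserts (after U (after U F)) w ≡ after U (inserts (after U F)) w
inserts-after-UU F []      = refl
inserts-after-UU F (U ∷ w) = ZP.+-identityˡ _
inserts-after-UU F (D ∷ w) = ≡.trans (ZP.+-identityˡ _) (inserts-0 w)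

-- A beginning UD either is the inserted pair, in place of a first letter U or D, or keeps its U and
-- has the insertion behind it.
inserts-after-UD : ∀ F w → inserts (after U (after D F)) w ≡ after U F w + (after D F w + after U (inserts (after D F)) w)
inserts-after-UD F []      = refl
inserts-after-UD F (U ∷ w) = cong (_+_ (F w)) (sym (ZP.+-identityˡ _))
inserts-after-UD F (D ∷ w) = ≡.trans (cong (_+_ (F w)) (inserts-0 w)) (sym (ZP.+-identityˡ _))

-- A prefix ending in U also arises by appending U or from an inserted UD overlapping its end.
data EndsInD : Word → Set where
  []   : EndsInD []
  last : EndsInD (D ∷ [])
  _∷_  : ∀ s {t u} → EndsInD (t ∷ u) → EndsInD (s ∷ t ∷ u)

-- The words from which u arises by replacing one letter by UD.
contractions : Word → List Word
contractions []          = []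
contractions (D ∷ u)     = map (D ∷_) (contractions u)
contractions (U ∷ [])    = []
contractions (U ∷ U ∷ u) = map (U ∷_) (contractions (U ∷ u))
contractions (U ∷ D ∷ u) = (U ∷ u) ∷ (D ∷ u) ∷ map (U ∷_) (contractions (D ∷ u))

-- The insertion either forms a UD inside the prefix, which a contraction undoes, or takes place
-- entirely behind the prefix. In the induction only a UD at the front contributes new terms.
inserts-prefixed : ∀ {u} → EndsInD u → ∀ F w →
  inserts (prefixed u F) w ≡ ∑ (λ v → prefixed v F w) (contractions u) + prefixed u (inserts F) w
inserts-prefixed []   F w = sym (ZP.+-identityˡ _)
inserts-prefixed last F w = ≡.trans (inserts-after-D F w) (sym (ZP.+-identityˡ _))
inserts-prefixed (_∷_ D {t} {u} e) F w = begin
  inserts (after D (prefixed (t ∷ u) F)) w  ≡⟨ inserts-after-D (prefixed (t ∷ u) F) w ⟩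
  after D (inserts (prefixed (t ∷ u) F)) w  ≡⟨ after-cong D (inserts-prefixed e F) w ⟩
  after D (λ z → ∑ (λ v → prefixed v F z) (contractions (t ∷ u)) + prefixed (t ∷ u) (inserts F) z) w
                                                      ≡⟨ after-+ D _ (prefixed (t ∷ u) (inserts F)) w ⟩
  after D (λ z → ∑ (λ v → prefixed v F z) (contractions (t ∷ u))) w + prefixed (D ∷ t ∷ u) (inserts F) w
                                                      ≡⟨ cong (_+ prefixed (D ∷ t ∷ u) (inserts F) w) (after-∑ D F (contractions (t ∷ u)) w) ⟩
  ∑ (λ v → prefixed v F w) (map (D ∷_) (contractions (t ∷ u))) + prefixed (D ∷ t ∷ u) (inserts F) w ∎
  where open ≡-Reasoning
inserts-prefixed (_∷_ U {U} {u} e) F w = begin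
  inserts (after U (prefixed (U ∷ u) F)) w  ≡⟨ inserts-after-UU (prefixed u F) w ⟩
  after U (inserts (prefixed (U ∷ u) F)) w  ≡⟨ after-cong U (inserts-prefixed e F) w ⟩
  after U (λ z → ∑ (λ v → prefixed v F z) (contractions (U ∷ u)) + prefixed (U ∷ u) (inserts F) z) w
                                                      ≡⟨ after-+ U _ (prefixed (U ∷ u) (inserts F)) w ⟩
  after U (λ z → ∑ (λ v → prefixed v F z) (contractions (U ∷ u))) w + prefixed (U ∷ U ∷ u) (inserts F) w
                                                      ≡⟨ cong (_+ prefixed (U ∷ U ∷ u) (inserts F) w) (after-∑ U F (contractions (U ∷ u)) w) ⟩
  ∑ (λ v → prefixed v F w) (map (U ∷_) (contractions (U ∷ u))) + prefixed (U ∷ U ∷ u) (inserts F) w ∎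
  where open ≡-Reasoning
inserts-prefixed (_∷_ U {D} {u} e) F w = begin
  inserts (after U (prefixed (D ∷ u) F)) w  ≡⟨ inserts-after-UD (prefixed u F) w ⟩
  x + (y + after U (inserts (prefixed (D ∷ u) F)) w)  ≡⟨ cong (λ z → x + (y + z)) (after-cong U (inserts-prefixed e F) w) ⟩
  x + (y + after U (λ z → ∑ (λ v → prefixed v F z) (contractions (D ∷ u)) + prefixed (D ∷ u) (inserts F) z) w)
                                                      ≡⟨ cong (λ z → x + (y + z)) (after-+ U _ (prefixed (D ∷ u) (inserts F)) w) ⟩
  x + (y + (after U (λ z → ∑ (λ v → prefixed v F z) (contractions (D ∷ u))) w + r))
                                                      ≡⟨ cong (λ z → x + (y + (z + r))) (after-∑ U F (contractions (D ∷ u)) w) ⟩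
  x + (y + (∑ (λ v → prefixed v F w) (map (U ∷_) (contractions (D ∷ u))) + r)) ≡⟨ reassoc x y _ r ⟩
  x + (y + ∑ (λ v → prefixed v F w) (map (U ∷_) (contractions (D ∷ u)))) + r ∎
  where
  open ≡-Reasoning
  x y r : ℤ
  x = prefixed (U ∷ u) F w
  y = prefixed (D ∷ u) F w
  r = prefixed (U ∷ D ∷ u) (inserts F) w
  reassoc : ∀ a b c d → a + (b + (c + d)) ≡ a + (b + c) + d
  reassoc = solve-∀

-- A leading D may be due to the maximum standing first, so deleting it is one more way back.
maxContractions : Word → List Word
maxContractions (D ∷ u) = u ∷ contractions (D ∷ u)
maxContractions u       = contractions u

insertsMax-prefixed : ∀ {s u} → EndsInD (s ∷ u) → ∀ F w →
  insertsMax (prefixed (s ∷ u) F) w ≡ ∑ (λ v → prefixed v F w) (maxContractions (s ∷ u)) + prefixed (s ∷ u) (inserts F) w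
insertsMax-prefixed {U} {u} e F w = ≡.trans (ZP.+-identityˡ _) (inserts-prefixed e F w)
insertsMax-prefixed {D} {u} e F w = ≡.trans (cong (_+_ (prefixed u F w)) (inserts-prefixed e F w)) (sym (ZP.+-assoc (prefixed u F w) _ _))

count : ℕ → Word → ℤ
count k w = ind (downs w N.≡ᵇ k)

inserts-count-0 : ∀ w → inserts (count 0) w ≡ count 0 w
inserts-count-0 []      = refl
inserts-count-0 (U ∷ w) = ≡.trans (ZP.+-identityˡ _) (inserts-count-0 w)
inserts-count-0 (D ∷ w) = ≡.trans (ZP.+-identityˡ _) (inserts-0 w)

-- The number of descents is kept by putting UD in place of one of the k + 1 letters D or by
-- appending U, which makes k + 2 ways. It grows by one when UD replaces one of the `length w` - k
-- letters U of a word with k descents.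
inserts-count : ∀ k w → inserts (count (suc k)) w ≡
  (+ 2 + + k) * count (suc k) w + (+ length w - + k) * count k w
inserts-count zero    []      = refl
inserts-count (suc k) []      = sym (zeros (+ suc k))
  where
  zeros : ∀ k → (+ 2 + k) * + 0 + (+ 0 - k) * + 0 ≡ + 0
  zeros = solve-∀
inserts-count k (U ∷ w) = ≡.trans (cong (_+_ (count k w)) (inserts-count k w)) (ring (+ k) (+ length w) (count k w) (count (suc k) w))
  where
  ring : ∀ k l x y → x + ((+ 2 + k) * y + (l - k) * x) ≡ (+ 2 + k) * y + (+ 1 + l - k) * x
  ring = solve-∀
inserts-count zero    (D ∷ w) = ≡.trans (cong (_+_ (count 0 w)) (inserts-count-0 w)) (ring (+ length w) (count 0 w))
  where
  ring : ∀ l x → x + x ≡ (+ 2 + + 0) * x + (+ 1 + l - + 0) * + 0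
  ring = solve-∀
inserts-count (suc k) (D ∷ w) = ≡.trans (cong (_+_ (count (suc k) w)) (inserts-count k w)) (ring (+ k) (+ length w) (count k w) (count (suc k) w))
  where
  ring : ∀ k l x y → y + ((+ 2 + k) * y + (l - k) * x) ≡ (+ 2 + (+ 1 + k)) * y + (+ 1 + l - (+ 1 + k)) * x
  ring = solve-∀

prefixed-cong : ∀ u {F G} → (∀ w → F w ≡ G w) → ∀ w → prefixed u F w ≡ prefixed u G w
prefixed-cong []      h = h
prefixed-cong (s ∷ u) h = after-cong s (prefixed-cong u h)

-- The recurrence of `inserts-count` for the remainder behind `u`. The integer difference of lengths
-- needs no assumption: for words that do not begin with `u` both sides vanish.
prefixed-inserts-count : ∀ u k w → prefixed u (inserts (count (suc k))) w ≡
  (+ 2 + + k) * prefixed u (count (suc k)) w + (+ length w - + length u - + k) * prefixed u (count k) w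
prefixed-inserts-count []      k w       = ≡.trans (inserts-count k w) (cong (λ z → (+ 2 + + k) * count (suc k) w + z * count k w) (ring (+ length w) (+ k)))
  where
  ring : ∀ l k → l - k ≡ l - + 0 - k
  ring = solve-∀
prefixed-inserts-count (s ∷ u) k w       = after-step s w
  where
  shift : ∀ e l m k x y → e * x + (l - m - k) * y ≡ e * x + (+ 1 + l - (+ 1 + m) - k) * y
  shift = solve-∀
  zeros : ∀ x y → + 0 ≡ x * + 0 + y * + 0
  zeros = solve-∀
  match : ∀ w → prefixed u (inserts (count (suc k))) w ≡ (+ 2 + + k) * prefixed u (count (suc k)) w
    + (+ suc (length w) - + suc (length u) - + k) * prefixed u (count k) w
  match w = ≡.trans (prefixed-inserts-count u k w)
    (shift (+ 2 + + k) (+ length w) (+ length u) (+ k) (prefixed u (count (suc k)) w) (prefixed u (count k) w))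
  after-step : ∀ s w → prefixed (s ∷ u) (inserts (count (suc k))) w ≡ (+ 2 + + k) * prefixed (s ∷ u) (count (suc k)) w
    + (+ length w - + suc (length u) - + k) * prefixed (s ∷ u) (count k) w
  after-step s []      = zeros (+ 2 + + k) (+ 0 - + suc (length u) - + k)
  after-step U (U ∷ w) = match w
  after-step U (D ∷ w) = zeros (+ 2 + + k) (+ suc (length w) - + suc (length u) - + k)
  after-step D (U ∷ w) = zeros (+ 2 + + k) (+ suc (length w) - + suc (length u) - + k)
  after-step D (D ∷ w) = match w

-- Counts permutations of n + 1 elements whose descent word begins with `u`; `k` is the number of
-- descents behind `u`, those of `u` itself not included.
prefixSum : Word → ℕ → ℕ → ℤ
prefixSum u k n = wordSum n (prefixed u (count k))

wordSum-+ : ∀ n F G → wordSum n (λ w → F w + G w) ≡ wordSum n F + wordSum n G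
wordSum-+ n F G = begin
  wordSum n (λ w → F w + G w)        ≡⟨ wordSum-cong n (λ w _ → cong (_+ G w) (sym (ZP.*-identityˡ (F w)))) ⟩
  wordSum n (λ w → + 1 * F w + G w)  ≡⟨ wordSum-lin n (+ 1) F G ⟩
  + 1 * wordSum n F + wordSum n G    ≡⟨ cong (_+ wordSum n G) (ZP.*-identityˡ (wordSum n F)) ⟩
  wordSum n F + wordSum n G          ∎
  where open ≡-Reasoning

wordSum-* : ∀ n c F → wordSum n (λ w → c * F w) ≡ c * wordSum n F
wordSum-* n c F = begin
  wordSum n (λ w → c * F w)  ≡⟨ wordSum-cong n (λ w _ → sym (ZP.+-identityʳ (c * F w))) ⟩
  wordSum n (λ w → c * F w + + 0)  ≡⟨ wordSum-lin n c F (λ _ → + 0) ⟩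
  c * wordSum n F + wordSum n (λ _ → + 0)     ≡⟨ cong (_+_ (c * wordSum n F)) (wordSum-0 n) ⟩
  c * wordSum n F + + 0  ≡⟨ ZP.+-identityʳ (c * wordSum n F) ⟩
  c * wordSum n F  ∎
  where open ≡-Reasoning

wordSum-∑ : ∀ n k us → wordSum n (λ w → ∑ (λ u → prefixed u (count k) w) us) ≡ ∑ (λ u → prefixSum u k n) us
wordSum-∑ n k []       = wordSum-0 n
wordSum-∑ n k (u ∷ us) = ≡.trans (wordSum-+ n (prefixed u (count k)) _) (cong (_+_ (prefixSum u k n)) (wordSum-∑ n k us))

prefixSum-rec-0 : ∀ {s u} → EndsInD (s ∷ u) → ∀ n → prefixSum (s ∷ u) 0 (suc n) ≡
  ∑ (λ v → prefixSum v 0 n) (maxContractions (s ∷ u)) + prefixSum (s ∷ u) 0 n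
prefixSum-rec-0 {s} {u} e n = begin
  wordSum n (insertsMax (prefixed (s ∷ u) (count 0)))
    ≡⟨ wordSum-cong n (λ w _ → ≡.trans (insertsMax-prefixed e (count 0) w)
         (cong (_+_ (∑ (λ v → prefixed v (count 0) w) (maxContractions (s ∷ u)))) (prefixed-cong (s ∷ u) inserts-count-0 w))) ⟩
  wordSum n (λ w → ∑ (λ v → prefixed v (count 0) w) (maxContractions (s ∷ u)) + prefixed (s ∷ u) (count 0) w)
    ≡⟨ wordSum-+ n _ (prefixed (s ∷ u) (count 0)) ⟩
  wordSum n (λ w → ∑ (λ v → prefixed v (count 0) w) (maxContractions (s ∷ u))) + prefixSum (s ∷ u) 0 n
    ≡⟨ cong (_+ prefixSum (s ∷ u) 0 n) (wordSum-∑ n 0 (maxContractions (s ∷ u))) ⟩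
  ∑ (λ v → prefixSum v 0 n) (maxContractions (s ∷ u)) + prefixSum (s ∷ u) 0 n ∎
  where open ≡-Reasoning

-- All words in `maxContractions` are one letter shorter than the prefix, so the recurrences can be
-- solved one after another by number of descents and length of the prefix.
prefixSum-rec : ∀ {s u} → EndsInD (s ∷ u) → ∀ k n → prefixSum (s ∷ u) (suc k) (suc n) ≡
  ∑ (λ v → prefixSum v (suc k) n) (maxContractions (s ∷ u)) +
  ((+ 2 + + k) * prefixSum (s ∷ u) (suc k) n + (+ n - + length (s ∷ u) - + k) * prefixSum (s ∷ u) k n)
prefixSum-rec {s} {u} e k n = begin
  wordSum n (insertsMax (prefixed (s ∷ u) (count (suc k))))
    ≡⟨ wordSum-cong n (λ w eq → ≡.trans (insertsMax-prefixed e (count (suc k)) w)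
         (cong (_+_ (lower w)) (≡.trans (prefixed-inserts-count (s ∷ u) k w)
           (cong (λ l → (+ 2 + + k) * prefixed (s ∷ u) (count (suc k)) w + (+ l - + length (s ∷ u) - + k) * prefixed (s ∷ u) (count k) w) eq)))) ⟩
  wordSum n (λ w → lower w + ((+ 2 + + k) * prefixed (s ∷ u) (count (suc k)) w + c * prefixed (s ∷ u) (count k) w))
    ≡⟨ wordSum-+ n lower _ ⟩
  wordSum n lower + wordSum n (λ w → (+ 2 + + k) * prefixed (s ∷ u) (count (suc k)) w + c * prefixed (s ∷ u) (count k) w)
    ≡⟨ cong₂ _+_ (wordSum-∑ n (suc k) (maxContractions (s ∷ u)))
         (≡.trans (wordSum-lin n (+ 2 + + k) (prefixed (s ∷ u) (count (suc k))) _)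
           (cong (_+_ ((+ 2 + + k) * prefixSum (s ∷ u) (suc k) n)) (wordSum-* n c (prefixed (s ∷ u) (count k))))) ⟩
  _ ∎
  where
  open ≡-Reasoning
  lower : Word → ℤ
  lower w = ∑ (λ v → prefixed v (count (suc k)) w) (maxContractions (s ∷ u))
  c : ℤ
  c = + n - + length (s ∷ u) - + k

eulerian-rec-0 : ∀ n → prefixSum [] 0 (suc n) ≡ prefixSum [] 0 n
eulerian-rec-0 n = wordSum-cong n (λ w _ → ≡.trans (ZP.+-identityˡ _) (inserts-count-0 w))

-- A D in front of the word is one more way to gain a descent, hence 1 + n - k in place of the n - k
-- of `inserts-count`. This is the recurrence of the Eulerian numbers E(n + 1, k).
eulerian-rec : ∀ k n → prefixSum [] (suc k) (suc n) ≡
  (+ 2 + + k) * prefixSum [] (suc k) n + (+ 1 + + n - + k) * prefixSum [] k n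
eulerian-rec k n = begin
  wordSum n (insertsMax (count (suc k)))
    ≡⟨ wordSum-cong n (λ w eq → ≡.trans (cong (_+_ (count k w)) (≡.trans (inserts-count k w)
         (cong (λ l → (+ 2 + + k) * count (suc k) w + (+ l - + k) * count k w) eq)))
         (ring (+ k) (+ n) (count k w) (count (suc k) w))) ⟩
  wordSum n (λ w → (+ 2 + + k) * count (suc k) w + (+ 1 + + n - + k) * count k w)
    ≡⟨ wordSum-lin n (+ 2 + + k) (count (suc k)) _ ⟩
  (+ 2 + + k) * wordSum n (count (suc k)) + wordSum n (λ w → (+ 1 + + n - + k) * count k w)
    ≡⟨ cong (_+_ ((+ 2 + + k) * wordSum n (count (suc k)))) (wordSum-* n (+ 1 + + n - + k) (count k)) ⟩
  _ ∎
  where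
  open ≡-Reasoning
  ring : ∀ k l x y → x + ((+ 2 + k) * y + (l - k) * x) ≡ (+ 2 + k) * y + (+ 1 + l - k) * x
  ring = solve-∀

-- Without further descents the letter behind the prefix can only be U. So a contraction ending in
-- U, to which the recurrence does not apply, may be shortened to one that is already known.
prefixed-∷ʳU : ∀ u w → length u N.< length w → prefixed (u ∷ʳ U) (count 0) w ≡ prefixed u (count 0) w
prefixed-∷ʳU []      (U ∷ w) _ = refl
prefixed-∷ʳU []      (D ∷ w) _ = refl
prefixed-∷ʳU (U ∷ u) (U ∷ w) h = prefixed-∷ʳU u w (N.s<s⁻¹ h)
prefixed-∷ʳU (U ∷ u) (D ∷ w) h = refl
prefixed-∷ʳU (D ∷ u) (U ∷ w) h = refl
prefixed-∷ʳU (D ∷ u) (D ∷ w) h = prefixed-∷ʳU u w (N.s<s⁻¹ h)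

prefixSum-∷ʳU : ∀ u n → length u N.< n → prefixSum (u ∷ʳ U) 0 n ≡ prefixSum u 0 n
prefixSum-∷ʳU u n h = wordSum-cong n (λ w eq → prefixed-∷ʳU u w (subst (length u N.<_) (sym eq) h))

-- Gives access to the prefix U, which does not end in D and hence has no recurrence of its own, as
-- the complement of the prefix D.
prefixSum-split : ∀ k n → prefixSum [] (suc k) n ≡ prefixSum (U ∷ []) (suc k) n + prefixSum (D ∷ []) k n
prefixSum-split k n = ≡.trans (wordSum-cong n (λ w _ → split w)) (wordSum-+ n (prefixed (U ∷ []) (count (suc k))) (prefixed (D ∷ []) (count k)))
  where
  split : ∀ w → count (suc k) w ≡ prefixed (U ∷ []) (count (suc k)) w + prefixed (D ∷ []) (count k) w
  split []      = refl
  split (U ∷ w) = sym (ZP.+-identityʳ _)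
  split (D ∷ w) = sym (ZP.+-identityˡ _)

-- Once the surplus of ascents is at least the number `k` of descents still to come, the ballot
-- condition cannot fail any more.
unconstrained : ∀ a d k w → d N.+ k N.≤ a → ind (ballotWord a d w ∧ (downs w N.≡ᵇ k)) ≡ count k w
unconstrained a d k []      h = refl
unconstrained a d k (U ∷ w) h with d N.≤ᵇ suc a in eq
... | true  = unconstrained (suc a) d k w (NP.m≤n⇒m≤1+n h)
... | false = ⊥-elim (subst T eq (NP.≤⇒≤ᵇ (NP.m≤n⇒m≤1+n (NP.m+n≤o⇒m≤o d h))))
unconstrained a d zero    (D ∷ w) h = cong ind (∧-zeroʳ (ballotWord a d (D ∷ w)))
unconstrained a d (suc k) (D ∷ w) h with suc d N.≤ᵇ a in eq
... | true  = unconstrained a (suc d) k w h′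
  where
  h′ : suc d N.+ k N.≤ a
  h′ = subst (N._≤ a) (NP.+-suc d k) h
... | false = ⊥-elim (subst T eq (NP.≤⇒≤ᵇ (NP.m+n≤o⇒m≤o (suc d) (subst (N._≤ a) (NP.+-suc d k) h))))

-- The four prefixes are the shortest beginnings with at most three descents in which the letters D
-- outnumber the letters U. They exclude each other, and each is counted with the descents that
-- remain of the three.
ballotCount : Word → ℤ
ballotCount w = count 3 w - (prefixed (D ∷ []) (count 2) w + (prefixed (U ∷ D ∷ D ∷ []) (count 1) w
  + (prefixed (U ∷ U ∷ D ∷ D ∷ D ∷ []) (count 0) w + prefixed (U ∷ D ∷ U ∷ D ∷ D ∷ []) (count 0) w)))

-- The case tree reads letters until the word ends, one of the four bad beginnings is complete, or
-- the surplus of ascents covers all descents still allowed and `unconstrained` takes over.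
ballot-3 : ∀ w → ind (ballotWord 0 0 w ∧ (downs w N.≡ᵇ 3)) ≡ ballotCount w
ballot-3 []                      = refl
ballot-3 (D ∷ w)                 = sym (ring (count 2 w))
  where
  ring : ∀ x → x - (x + (+ 0 + (+ 0 + + 0))) ≡ + 0
  ring = solve-∀
ballot-3 (U ∷ [])                = refl
ballot-3 (U ∷ U ∷ [])            = refl
ballot-3 (U ∷ U ∷ U ∷ w)         = ≡.trans (unconstrained 3 0 3 w NP.≤-refl) (sym (ZP.+-identityʳ _))
ballot-3 (U ∷ U ∷ D ∷ [])        = refl
ballot-3 (U ∷ U ∷ D ∷ U ∷ w)     = ≡.trans (unconstrained 3 1 2 w NP.≤-refl) (sym (ZP.+-identityʳ _))
ballot-3 (U ∷ U ∷ D ∷ D ∷ [])    = refl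
ballot-3 (U ∷ U ∷ D ∷ D ∷ U ∷ w) = ≡.trans (unconstrained 3 2 1 w NP.≤-refl) (sym (ZP.+-identityʳ _))
ballot-3 (U ∷ U ∷ D ∷ D ∷ D ∷ w) = sym (ring (count 0 w))
  where
  ring : ∀ x → x - (+ 0 + (+ 0 + (x + + 0))) ≡ + 0
  ring = solve-∀
ballot-3 (U ∷ D ∷ [])            = refl
ballot-3 (U ∷ D ∷ D ∷ w)         = sym (ring (count 1 w))
  where
  ring : ∀ x → x - (+ 0 + (x + (+ 0 + + 0))) ≡ + 0
  ring = solve-∀
ballot-3 (U ∷ D ∷ U ∷ [])        = refl
ballot-3 (U ∷ D ∷ U ∷ U ∷ w)     = ≡.trans (unconstrained 3 1 2 w NP.≤-refl) (sym (ZP.+-identityʳ _))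
ballot-3 (U ∷ D ∷ U ∷ D ∷ [])    = refl
ballot-3 (U ∷ D ∷ U ∷ D ∷ U ∷ w) = ≡.trans (unconstrained 3 2 1 w NP.≤-refl) (sym (ZP.+-identityʳ _))
ballot-3 (U ∷ D ∷ U ∷ D ∷ D ∷ w) = sym (ring (count 0 w))
  where
  ring : ∀ x → x - (+ 0 + (+ 0 + (+ 0 + x))) ≡ + 0
  ring = solve-∀

-- Eulerian numbers and numbers of permutations with a prescribed beginning of the descent word

-- All values are multiplied by 120 = 5! to clear the denominators.
eulerian-value-0 : ∀ n → + 120 * prefixSum [] 0 n ≡ + 120
eulerian-value-0 zero    = refl
eulerian-value-0 (suc n) = ≡.trans (cong (_*_ (+ 120)) (eulerian-rec-0 n)) (eulerian-value-0 n)

eulerian-value-1 : ∀ n → + 120 * prefixSum [] 1 n ≡ + 120 * (+ 2 * (+ 2) ^ n - + n - + 2)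
eulerian-value-1 zero    = refl
eulerian-value-1 (suc n) = begin
  + 120 * prefixSum [] 1 (suc n)  ≡⟨ cong (_*_ (+ 120)) (eulerian-rec 0 n) ⟩
  + 120 * ((+ 2 + + 0) * x + (+ 1 + + n - + 0) * y)  ≡⟨ distribute x y (+ n) ⟩
  + 2 * (+ 120 * x) + (+ 1 + + n) * (+ 120 * y)  ≡⟨ cong₂ _+_ (cong (_*_ (+ 2)) (eulerian-value-1 n)) (cong (_*_ (+ 1 + + n)) (eulerian-value-0 n)) ⟩
  + 2 * (+ 120 * (+ 2 * (+ 2) ^ n - + n - + 2)) + (+ 1 + + n) * + 120   ≡⟨ ring (+ n) ((+ 2) ^ n) ⟩
  + 120 * (+ 2 * (+ 2) ^ suc n - + suc n - + 2)  ∎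
  where
  open ≡-Reasoning
  x y : ℤ
  x = prefixSum [] 1 n
  y = prefixSum [] 0 n
  distribute : ∀ x y i → + 120 * ((+ 2 + + 0) * x + (+ 1 + i - + 0) * y) ≡ + 2 * (+ 120 * x) + (+ 1 + i) * (+ 120 * y)
  distribute = solve-∀
  ring : ∀ i a → + 2 * (+ 120 * (+ 2 * a - i - + 2)) + (+ 1 + i) * + 120 ≡ + 120 * (+ 2 * (+ 2 * a) - (+ 1 + i) - + 2)
  ring = solve-∀

eulerian-value-2 : ∀ n → + 120 * prefixSum [] 2 n ≡
  + 60 * (+ 6 * (+ 3) ^ n - + 4 * (+ n + + 2) * (+ 2) ^ n + (+ n + + 1) * (+ n + + 2))
eulerian-value-2 zero    = refl
eulerian-value-2 (suc n) = begin
  + 120 * prefixSum [] 2 (suc n)  ≡⟨ cong (_*_ (+ 120)) (eulerian-rec 1 n) ⟩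
  + 120 * ((+ 2 + + 1) * x + (+ 1 + + n - + 1) * y)    ≡⟨ distribute x y (+ n) ⟩
  + 3 * (+ 120 * x) + + n * (+ 120 * y)  ≡⟨ cong₂ _+_ (cong (_*_ (+ 3)) (eulerian-value-2 n)) (cong (_*_ (+ n)) (eulerian-value-1 n)) ⟩
  _ ≡⟨ ring (+ n) ((+ 2) ^ n) ((+ 3) ^ n) ⟩
  _ ∎
  where
  open ≡-Reasoning
  x y : ℤ
  x = prefixSum [] 2 n
  y = prefixSum [] 1 n
  distribute : ∀ x y i → + 120 * ((+ 2 + + 1) * x + (+ 1 + i - + 1) * y) ≡ + 3 * (+ 120 * x) + i * (+ 120 * y)
  distribute = solve-∀
  ring : ∀ i a t → + 3 * (+ 60 * (+ 6 * t - + 4 * (i + + 2) * a + (i + + 1) * (i + + 2))) + i * (+ 120 * (+ 2 * a - i - + 2))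
    ≡ + 60 * (+ 6 * (+ 3 * t) - + 4 * (+ 1 + i + + 2) * (+ 2 * a) + (+ 1 + i + + 1) * (+ 1 + i + + 2))
  ring = solve-∀

eulerian-value-3 : ∀ n → + 120 * prefixSum [] 3 n ≡
  + 20 * (+ 24 * (+ 4) ^ n - + 18 * (+ n + + 2) * (+ 3) ^ n + + 6 * (+ n + + 1) * (+ n + + 2) * (+ 2) ^ n - + n * (+ n + + 1) * (+ n + + 2))
eulerian-value-3 zero    = refl
eulerian-value-3 (suc n) = begin
  + 120 * prefixSum [] 3 (suc n)  ≡⟨ cong (_*_ (+ 120)) (eulerian-rec 2 n) ⟩
  + 120 * ((+ 2 + + 2) * x + (+ 1 + + n - + 2) * y)    ≡⟨ distribute x y (+ n) ⟩
  + 4 * (+ 120 * x) + (+ n - + 1) * (+ 120 * y)        ≡⟨ cong₂ _+_ (cong (_*_ (+ 4)) (eulerian-value-3 n)) (cong (_*_ (+ n - + 1)) (eulerian-value-2 n)) ⟩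
  _ ≡⟨ ring (+ n) ((+ 2) ^ n) ((+ 3) ^ n) ((+ 4) ^ n) ⟩
  _ ∎
  where
  open ≡-Reasoning
  x y : ℤ
  x = prefixSum [] 3 n
  y = prefixSum [] 2 n
  distribute : ∀ x y i → + 120 * ((+ 2 + + 2) * x + (+ 1 + i - + 2) * y) ≡ + 4 * (+ 120 * x) + (i - + 1) * (+ 120 * y)
  distribute = solve-∀
  ring : ∀ i a t f → + 4 * (+ 20 * (+ 24 * f - + 18 * (i + + 2) * t + + 6 * (i + + 1) * (i + + 2) * a - i * (i + + 1) * (i + + 2)))
    + (i - + 1) * (+ 60 * (+ 6 * t - + 4 * (i + + 2) * a + (i + + 1) * (i + + 2)))
    ≡ + 20 * (+ 24 * (+ 4 * f) - + 18 * (+ 1 + i + + 2) * (+ 3 * t) + + 6 * (+ 1 + i + + 1) * (+ 1 + i + + 2) * (+ 2 * a) - (+ 1 + i) * (+ 1 + i + + 1) * (+ 1 + i + + 2))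
  ring = solve-∀

distribute-1 : ∀ x₁ y → + 120 * (x₁ + (+ 0) + y) ≡ + 120 * x₁ + + 120 * y
distribute-1 = solve-∀

distribute-2 : ∀ x₁ x₂ y → + 120 * (x₁ + (x₂ + (+ 0)) + y) ≡ + 120 * x₁ + + 120 * x₂ + + 120 * y
distribute-2 = solve-∀

distribute-3 : ∀ x₁ x₂ x₃ y → + 120 * (x₁ + (x₂ + (x₃ + (+ 0))) + y) ≡ + 120 * x₁ + + 120 * x₂ + + 120 * x₃ + + 120 * y
distribute-3 = solve-∀

distribute-4 : ∀ x₁ x₂ x₃ x₄ y → + 120 * (x₁ + (x₂ + (x₃ + (x₄ + (+ 0)))) + y) ≡ + 120 * x₁ + + 120 * x₂ + + 120 * x₃ + + 120 * x₄ + + 120 * y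
distribute-4 = solve-∀

-- From n = 3 on no prefix is affected by the length of the word, hence n = 3 + m.
closed-D-0 : ℤ → ℤ
closed-D-0 i = + 360 + + 120 * i

-- The pattern of the inductions that follow: the start m = 0 is settled by evaluation, and the step
-- puts the closed forms already known into the recurrence. The prefixes treated are those reached
-- from the four bad beginnings by contraction.
value-D-0 : ∀ m → + 120 * prefixSum (D ∷ []) 0 (3 N.+ m) ≡ closed-D-0 (+ m)
value-D-0 zero    = refl
value-D-0 (suc m) = begin
  + 120 * prefixSum (D ∷ []) 0 (4 N.+ m)
    ≡⟨ cong (_*_ (+ 120)) (prefixSum-rec-0 (last) (3 N.+ m)) ⟩
  _ ≡⟨ distribute-1 (prefixSum [] 0 (3 N.+ m)) (prefixSum (D ∷ []) 0 (3 N.+ m)) ⟩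
  _ ≡⟨ cong₂ _+_ (eulerian-value-0 (3 N.+ m)) (value-D-0 m) ⟩
  _ ≡⟨ ring (+ m) ⟩
  closed-D-0 (+ suc m) ∎
  where
  open ≡-Reasoning
  ring : ∀ i → (+ 120) + (+ 360 + + 120 * i) ≡ + 360 + + 120 * (+ 1 + i)
  ring = solve-∀

closed-DD-0 : ℤ → ℤ
closed-DD-0 i = + 360 + + 300 * i + + 60 * i * i

value-DD-0 : ∀ m → + 120 * prefixSum (D ∷ D ∷ []) 0 (3 N.+ m) ≡ closed-DD-0 (+ m)
value-DD-0 zero    = refl
value-DD-0 (suc m) = begin
  + 120 * prefixSum (D ∷ D ∷ []) 0 (4 N.+ m)
    ≡⟨ cong (_*_ (+ 120)) (prefixSum-rec-0 (D ∷ last) (3 N.+ m)) ⟩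
  _ ≡⟨ distribute-1 (prefixSum (D ∷ []) 0 (3 N.+ m)) (prefixSum (D ∷ D ∷ []) 0 (3 N.+ m)) ⟩
  _ ≡⟨ cong₂ _+_ (value-D-0 m) (value-DD-0 m) ⟩
  _ ≡⟨ ring (+ m) ⟩
  closed-DD-0 (+ suc m) ∎
  where
  open ≡-Reasoning
  ring : ∀ i → (+ 360 + + 120 * i) + (+ 360 + + 300 * i + + 60 * i * i) ≡ + 360 + + 300 * (+ 1 + i) + + 60 * (+ 1 + i) * (+ 1 + i)
  ring = solve-∀

closed-UD-0 : ℤ → ℤ
closed-UD-0 i = + 600 + + 420 * i + + 60 * i * i

value-UD-0 : ∀ m → + 120 * prefixSum (U ∷ D ∷ []) 0 (3 N.+ m) ≡ closed-UD-0 (+ m)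
value-UD-0 zero    = refl
value-UD-0 (suc m) = begin
  + 120 * prefixSum (U ∷ D ∷ []) 0 (4 N.+ m)
    ≡⟨ cong (_*_ (+ 120)) (prefixSum-rec-0 (U ∷ last) (3 N.+ m)) ⟩
  _ ≡⟨ distribute-2 (prefixSum (U ∷ []) 0 (3 N.+ m)) (prefixSum (D ∷ []) 0 (3 N.+ m)) (prefixSum (U ∷ D ∷ []) 0 (3 N.+ m)) ⟩
  _ ≡⟨ cong₂ _+_ (cong₂ _+_ (≡.trans (cong (_*_ (+ 120)) (prefixSum-∷ʳU [] (3 N.+ m) N.z<s)) (eulerian-value-0 (3 N.+ m))) (value-D-0 m)) (value-UD-0 m) ⟩
  _ ≡⟨ ring (+ m) ⟩
  closed-UD-0 (+ suc m) ∎
  where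
  open ≡-Reasoning
  ring : ∀ i → (+ 120) + (+ 360 + + 120 * i) + (+ 600 + + 420 * i + + 60 * i * i) ≡ + 600 + + 420 * (+ 1 + i) + + 60 * (+ 1 + i) * (+ 1 + i)
  ring = solve-∀

closed-UDD-0 : ℤ → ℤ
closed-UDD-0 i = + 360 + + 620 * i + + 300 * i * i + + 40 * i * i * i

value-UDD-0 : ∀ m → + 120 * prefixSum (U ∷ D ∷ D ∷ []) 0 (3 N.+ m) ≡ closed-UDD-0 (+ m)
value-UDD-0 zero    = refl
value-UDD-0 (suc m) = begin
  + 120 * prefixSum (U ∷ D ∷ D ∷ []) 0 (4 N.+ m)
    ≡⟨ cong (_*_ (+ 120)) (prefixSum-rec-0 (U ∷ D ∷ last) (3 N.+ m)) ⟩
  _ ≡⟨ distribute-2 (prefixSum (U ∷ D ∷ []) 0 (3 N.+ m)) (prefixSum (D ∷ D ∷ []) 0 (3 N.+ m)) (prefixSum (U ∷ D ∷ D ∷ []) 0 (3 N.+ m)) ⟩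
  _ ≡⟨ cong₂ _+_ (cong₂ _+_ (value-UD-0 m) (value-DD-0 m)) (value-UDD-0 m) ⟩
  _ ≡⟨ ring (+ m) ⟩
  closed-UDD-0 (+ suc m) ∎
  where
  open ≡-Reasoning
  ring : ∀ i → (+ 600 + + 420 * i + + 60 * i * i) + (+ 360 + + 300 * i + + 60 * i * i) + (+ 360 + + 620 * i + + 300 * i * i + + 40 * i * i * i) ≡ + 360 + + 620 * (+ 1 + i) + + 300 * (+ 1 + i) * (+ 1 + i) + + 40 * (+ 1 + i) * (+ 1 + i) * (+ 1 + i)
  ring = solve-∀

closed-DDD-0 : ℤ → ℤ
closed-DDD-0 i = + 120 + + 220 * i + + 120 * i * i + + 20 * i * i * i

value-DDD-0 : ∀ m → + 120 * prefixSum (D ∷ D ∷ D ∷ []) 0 (3 N.+ m) ≡ closed-DDD-0 (+ m)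
value-DDD-0 zero    = refl
value-DDD-0 (suc m) = begin
  + 120 * prefixSum (D ∷ D ∷ D ∷ []) 0 (4 N.+ m)
    ≡⟨ cong (_*_ (+ 120)) (prefixSum-rec-0 (D ∷ D ∷ last) (3 N.+ m)) ⟩
  _ ≡⟨ distribute-1 (prefixSum (D ∷ D ∷ []) 0 (3 N.+ m)) (prefixSum (D ∷ D ∷ D ∷ []) 0 (3 N.+ m)) ⟩
  _ ≡⟨ cong₂ _+_ (value-DD-0 m) (value-DDD-0 m) ⟩
  _ ≡⟨ ring (+ m) ⟩
  closed-DDD-0 (+ suc m) ∎
  where
  open ≡-Reasoning
  ring : ∀ i → (+ 360 + + 300 * i + + 60 * i * i) + (+ 120 + + 220 * i + + 120 * i * i + + 20 * i * i * i) ≡ + 120 + + 220 * (+ 1 + i) + + 120 * (+ 1 + i) * (+ 1 + i) + + 20 * (+ 1 + i) * (+ 1 + i) * (+ 1 + i)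
  ring = solve-∀

closed-UUD-0 : ℤ → ℤ
closed-UUD-0 i = + 360 + + 520 * i + + 180 * i * i + + 20 * i * i * i

value-UUD-0 : ∀ m → + 120 * prefixSum (U ∷ U ∷ D ∷ []) 0 (3 N.+ m) ≡ closed-UUD-0 (+ m)
value-UUD-0 zero    = refl
value-UUD-0 (suc m) = begin
  + 120 * prefixSum (U ∷ U ∷ D ∷ []) 0 (4 N.+ m)
    ≡⟨ cong (_*_ (+ 120)) (prefixSum-rec-0 (U ∷ U ∷ last) (3 N.+ m)) ⟩
  _ ≡⟨ distribute-2 (prefixSum (U ∷ U ∷ []) 0 (3 N.+ m)) (prefixSum (U ∷ D ∷ []) 0 (3 N.+ m)) (prefixSum (U ∷ U ∷ D ∷ []) 0 (3 N.+ m)) ⟩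
  _ ≡⟨ cong₂ _+_ (cong₂ _+_ (≡.trans (cong (_*_ (+ 120)) (≡.trans (prefixSum-∷ʳU (U ∷ []) (3 N.+ m) (N.s<s N.z<s)) (prefixSum-∷ʳU [] (3 N.+ m) N.z<s))) (eulerian-value-0 (3 N.+ m))) (value-UD-0 m)) (value-UUD-0 m) ⟩
  _ ≡⟨ ring (+ m) ⟩
  closed-UUD-0 (+ suc m) ∎
  where
  open ≡-Reasoning
  ring : ∀ i → (+ 120) + (+ 600 + + 420 * i + + 60 * i * i) + (+ 360 + + 520 * i + + 180 * i * i + + 20 * i * i * i) ≡ + 360 + + 520 * (+ 1 + i) + + 180 * (+ 1 + i) * (+ 1 + i) + + 20 * (+ 1 + i) * (+ 1 + i) * (+ 1 + i)
  ring = solve-∀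

closed-UUDD-0 : ℤ → ℤ
closed-UUDD-0 i = + 230 * i + + 345 * i * i + + 130 * i * i * i + + 15 * i * i * i * i

value-UUDD-0 : ∀ m → + 120 * prefixSum (U ∷ U ∷ D ∷ D ∷ []) 0 (3 N.+ m) ≡ closed-UUDD-0 (+ m)
value-UUDD-0 zero    = refl
value-UUDD-0 (suc m) = begin
  + 120 * prefixSum (U ∷ U ∷ D ∷ D ∷ []) 0 (4 N.+ m)
    ≡⟨ cong (_*_ (+ 120)) (prefixSum-rec-0 (U ∷ U ∷ D ∷ last) (3 N.+ m)) ⟩
  _ ≡⟨ distribute-2 (prefixSum (U ∷ U ∷ D ∷ []) 0 (3 N.+ m)) (prefixSum (U ∷ D ∷ D ∷ []) 0 (3 N.+ m)) (prefixSum (U ∷ U ∷ D ∷ D ∷ []) 0 (3 N.+ m)) ⟩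
  _ ≡⟨ cong₂ _+_ (cong₂ _+_ (value-UUD-0 m) (value-UDD-0 m)) (value-UUDD-0 m) ⟩
  _ ≡⟨ ring (+ m) ⟩
  closed-UUDD-0 (+ suc m) ∎
  where
  open ≡-Reasoning
  ring : ∀ i → (+ 360 + + 520 * i + + 180 * i * i + + 20 * i * i * i) + (+ 360 + + 620 * i + + 300 * i * i + + 40 * i * i * i) + (+ 230 * i + + 345 * i * i + + 130 * i * i * i + + 15 * i * i * i * i) ≡ + 230 * (+ 1 + i) + + 345 * (+ 1 + i) * (+ 1 + i) + + 130 * (+ 1 + i) * (+ 1 + i) * (+ 1 + i) + + 15 * (+ 1 + i) * (+ 1 + i) * (+ 1 + i) * (+ 1 + i)
  ring = solve-∀

closed-UDDD-0 : ℤ → ℤ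
closed-UDDD-0 i = + 130 * i + + 225 * i * i + + 110 * i * i * i + + 15 * i * i * i * i

value-UDDD-0 : ∀ m → + 120 * prefixSum (U ∷ D ∷ D ∷ D ∷ []) 0 (3 N.+ m) ≡ closed-UDDD-0 (+ m)
value-UDDD-0 zero    = refl
value-UDDD-0 (suc m) = begin
  + 120 * prefixSum (U ∷ D ∷ D ∷ D ∷ []) 0 (4 N.+ m)
    ≡⟨ cong (_*_ (+ 120)) (prefixSum-rec-0 (U ∷ D ∷ D ∷ last) (3 N.+ m)) ⟩
  _ ≡⟨ distribute-2 (prefixSum (U ∷ D ∷ D ∷ []) 0 (3 N.+ m)) (prefixSum (D ∷ D ∷ D ∷ []) 0 (3 N.+ m)) (prefixSum (U ∷ D ∷ D ∷ D ∷ []) 0 (3 N.+ m)) ⟩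
  _ ≡⟨ cong₂ _+_ (cong₂ _+_ (value-UDD-0 m) (value-DDD-0 m)) (value-UDDD-0 m) ⟩
  _ ≡⟨ ring (+ m) ⟩
  closed-UDDD-0 (+ suc m) ∎
  where
  open ≡-Reasoning
  ring : ∀ i → (+ 360 + + 620 * i + + 300 * i * i + + 40 * i * i * i) + (+ 120 + + 220 * i + + 120 * i * i + + 20 * i * i * i) + (+ 130 * i + + 225 * i * i + + 110 * i * i * i + + 15 * i * i * i * i) ≡ + 130 * (+ 1 + i) + + 225 * (+ 1 + i) * (+ 1 + i) + + 110 * (+ 1 + i) * (+ 1 + i) * (+ 1 + i) + + 15 * (+ 1 + i) * (+ 1 + i) * (+ 1 + i) * (+ 1 + i)
  ring = solve-∀

closed-DUD-0 : ℤ → ℤ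
closed-DUD-0 i = + 600 + + 920 * i + + 360 * i * i + + 40 * i * i * i

value-DUD-0 : ∀ m → + 120 * prefixSum (D ∷ U ∷ D ∷ []) 0 (3 N.+ m) ≡ closed-DUD-0 (+ m)
value-DUD-0 zero    = refl
value-DUD-0 (suc m) = begin
  + 120 * prefixSum (D ∷ U ∷ D ∷ []) 0 (4 N.+ m)
    ≡⟨ cong (_*_ (+ 120)) (prefixSum-rec-0 (D ∷ U ∷ last) (3 N.+ m)) ⟩
  _ ≡⟨ distribute-3 (prefixSum (U ∷ D ∷ []) 0 (3 N.+ m)) (prefixSum (D ∷ U ∷ []) 0 (3 N.+ m)) (prefixSum (D ∷ D ∷ []) 0 (3 N.+ m)) (prefixSum (D ∷ U ∷ D ∷ []) 0 (3 N.+ m)) ⟩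
  _ ≡⟨ cong₂ _+_ (cong₂ _+_ (cong₂ _+_ (value-UD-0 m) (≡.trans (cong (_*_ (+ 120)) (prefixSum-∷ʳU (D ∷ []) (3 N.+ m) (N.s<s N.z<s))) (value-D-0 m))) (value-DD-0 m)) (value-DUD-0 m) ⟩
  _ ≡⟨ ring (+ m) ⟩
  closed-DUD-0 (+ suc m) ∎
  where
  open ≡-Reasoning
  ring : ∀ i → (+ 600 + + 420 * i + + 60 * i * i) + (+ 360 + + 120 * i) + (+ 360 + + 300 * i + + 60 * i * i) + (+ 600 + + 920 * i + + 360 * i * i + + 40 * i * i * i) ≡ + 600 + + 920 * (+ 1 + i) + + 360 * (+ 1 + i) * (+ 1 + i) + + 40 * (+ 1 + i) * (+ 1 + i) * (+ 1 + i)
  ring = solve-∀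

closed-DUDD-0 : ℤ → ℤ
closed-DUDD-0 i = + 330 * i + + 515 * i * i + + 210 * i * i * i + + 25 * i * i * i * i

value-DUDD-0 : ∀ m → + 120 * prefixSum (D ∷ U ∷ D ∷ D ∷ []) 0 (3 N.+ m) ≡ closed-DUDD-0 (+ m)
value-DUDD-0 zero    = refl
value-DUDD-0 (suc m) = begin
  + 120 * prefixSum (D ∷ U ∷ D ∷ D ∷ []) 0 (4 N.+ m)
    ≡⟨ cong (_*_ (+ 120)) (prefixSum-rec-0 (D ∷ U ∷ D ∷ last) (3 N.+ m)) ⟩
  _ ≡⟨ distribute-3 (prefixSum (U ∷ D ∷ D ∷ []) 0 (3 N.+ m)) (prefixSum (D ∷ U ∷ D ∷ []) 0 (3 N.+ m)) (prefixSum (D ∷ D ∷ D ∷ []) 0 (3 N.+ m)) (prefixSum (D ∷ U ∷ D ∷ D ∷ []) 0 (3 N.+ m)) ⟩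
  _ ≡⟨ cong₂ _+_ (cong₂ _+_ (cong₂ _+_ (value-UDD-0 m) (value-DUD-0 m)) (value-DDD-0 m)) (value-DUDD-0 m) ⟩
  _ ≡⟨ ring (+ m) ⟩
  closed-DUDD-0 (+ suc m) ∎
  where
  open ≡-Reasoning
  ring : ∀ i → (+ 360 + + 620 * i + + 300 * i * i + + 40 * i * i * i) + (+ 600 + + 920 * i + + 360 * i * i + + 40 * i * i * i) + (+ 120 + + 220 * i + + 120 * i * i + + 20 * i * i * i) + (+ 330 * i + + 515 * i * i + + 210 * i * i * i + + 25 * i * i * i * i) ≡ + 330 * (+ 1 + i) + + 515 * (+ 1 + i) * (+ 1 + i) + + 210 * (+ 1 + i) * (+ 1 + i) * (+ 1 + i) + + 25 * (+ 1 + i) * (+ 1 + i) * (+ 1 + i) * (+ 1 + i)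
  ring = solve-∀

closed-UDUD-0 : ℤ → ℤ
closed-UDUD-0 i = + 830 * i + + 815 * i * i + + 250 * i * i * i + + 25 * i * i * i * i

value-UDUD-0 : ∀ m → + 120 * prefixSum (U ∷ D ∷ U ∷ D ∷ []) 0 (3 N.+ m) ≡ closed-UDUD-0 (+ m)
value-UDUD-0 zero    = refl
value-UDUD-0 (suc m) = begin
  + 120 * prefixSum (U ∷ D ∷ U ∷ D ∷ []) 0 (4 N.+ m)
    ≡⟨ cong (_*_ (+ 120)) (prefixSum-rec-0 (U ∷ D ∷ U ∷ last) (3 N.+ m)) ⟩
  _ ≡⟨ distribute-4 (prefixSum (U ∷ U ∷ D ∷ []) 0 (3 N.+ m)) (prefixSum (D ∷ U ∷ D ∷ []) 0 (3 N.+ m)) (prefixSum (U ∷ D ∷ U ∷ []) 0 (3 N.+ m)) (prefixSum (U ∷ D ∷ D ∷ []) 0 (3 N.+ m)) (prefixSum (U ∷ D ∷ U ∷ D ∷ []) 0 (3 N.+ m)) ⟩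
  _ ≡⟨ cong₂ _+_ (cong₂ _+_ (cong₂ _+_ (cong₂ _+_ (value-UUD-0 m) (value-DUD-0 m)) (≡.trans (cong (_*_ (+ 120)) (prefixSum-∷ʳU (U ∷ D ∷ []) (3 N.+ m) (N.s<s (N.s<s N.z<s)))) (value-UD-0 m))) (value-UDD-0 m)) (value-UDUD-0 m) ⟩
  _ ≡⟨ ring (+ m) ⟩
  closed-UDUD-0 (+ suc m) ∎
  where
  open ≡-Reasoning
  ring : ∀ i → (+ 360 + + 520 * i + + 180 * i * i + + 20 * i * i * i) + (+ 600 + + 920 * i + + 360 * i * i + + 40 * i * i * i) + (+ 600 + + 420 * i + + 60 * i * i) + (+ 360 + + 620 * i + + 300 * i * i + + 40 * i * i * i) + (+ 830 * i + + 815 * i * i + + 250 * i * i * i + + 25 * i * i * i * i) ≡ + 830 * (+ 1 + i) + + 815 * (+ 1 + i) * (+ 1 + i) + + 250 * (+ 1 + i) * (+ 1 + i) * (+ 1 + i) + + 25 * (+ 1 + i) * (+ 1 + i) * (+ 1 + i) * (+ 1 + i)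
  ring = solve-∀

closed-UUDDD-0 : ℤ → ℤ
closed-UUDDD-0 i = - (+ 86 * i) - + 45 * i * i + + 80 * i * i * i + + 45 * i * i * i * i + + 6 * i * i * i * i * i

value-UUDDD-0 : ∀ m → + 120 * prefixSum (U ∷ U ∷ D ∷ D ∷ D ∷ []) 0 (3 N.+ m) ≡ closed-UUDDD-0 (+ m)
value-UUDDD-0 zero    = refl
value-UUDDD-0 (suc m) = begin
  + 120 * prefixSum (U ∷ U ∷ D ∷ D ∷ D ∷ []) 0 (4 N.+ m)
    ≡⟨ cong (_*_ (+ 120)) (prefixSum-rec-0 (U ∷ U ∷ D ∷ D ∷ last) (3 N.+ m)) ⟩
  _ ≡⟨ distribute-2 (prefixSum (U ∷ U ∷ D ∷ D ∷ []) 0 (3 N.+ m)) (prefixSum (U ∷ D ∷ D ∷ D ∷ []) 0 (3 N.+ m)) (prefixSum (U ∷ U ∷ D ∷ D ∷ D ∷ []) 0 (3 N.+ m)) ⟩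
  _ ≡⟨ cong₂ _+_ (cong₂ _+_ (value-UUDD-0 m) (value-UDDD-0 m)) (value-UUDDD-0 m) ⟩
  _ ≡⟨ ring (+ m) ⟩
  closed-UUDDD-0 (+ suc m) ∎
  where
  open ≡-Reasoning
  ring : ∀ i → (+ 230 * i + + 345 * i * i + + 130 * i * i * i + + 15 * i * i * i * i) + (+ 130 * i + + 225 * i * i + + 110 * i * i * i + + 15 * i * i * i * i) + (- (+ 86 * i) - + 45 * i * i + + 80 * i * i * i + + 45 * i * i * i * i + + 6 * i * i * i * i * i) ≡ - (+ 86 * (+ 1 + i)) - + 45 * (+ 1 + i) * (+ 1 + i) + + 80 * (+ 1 + i) * (+ 1 + i) * (+ 1 + i) + + 45 * (+ 1 + i) * (+ 1 + i) * (+ 1 + i) * (+ 1 + i) + + 6 * (+ 1 + i) * (+ 1 + i) * (+ 1 + i) * (+ 1 + i) * (+ 1 + i)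
  ring = solve-∀

closed-UDUDD-0 : ℤ → ℤ
closed-UDUDD-0 i = - (+ 446 * i) - + 15 * i * i + + 310 * i * i * i + + 135 * i * i * i * i + + 16 * i * i * i * i * i

value-UDUDD-0 : ∀ m → + 120 * prefixSum (U ∷ D ∷ U ∷ D ∷ D ∷ []) 0 (3 N.+ m) ≡ closed-UDUDD-0 (+ m)
value-UDUDD-0 zero    = refl
value-UDUDD-0 (suc m) = begin
  + 120 * prefixSum (U ∷ D ∷ U ∷ D ∷ D ∷ []) 0 (4 N.+ m)
    ≡⟨ cong (_*_ (+ 120)) (prefixSum-rec-0 (U ∷ D ∷ U ∷ D ∷ last) (3 N.+ m)) ⟩
  _ ≡⟨ distribute-4 (prefixSum (U ∷ U ∷ D ∷ D ∷ []) 0 (3 N.+ m)) (prefixSum (D ∷ U ∷ D ∷ D ∷ []) 0 (3 N.+ m)) (prefixSum (U ∷ D ∷ U ∷ D ∷ []) 0 (3 N.+ m)) (prefixSum (U ∷ D ∷ D ∷ D ∷ []) 0 (3 N.+ m)) (prefixSum (U ∷ D ∷ U ∷ D ∷ D ∷ []) 0 (3 N.+ m)) ⟩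
  _ ≡⟨ cong₂ _+_ (cong₂ _+_ (cong₂ _+_ (cong₂ _+_ (value-UUDD-0 m) (value-DUDD-0 m)) (value-UDUD-0 m)) (value-UDDD-0 m)) (value-UDUDD-0 m) ⟩
  _ ≡⟨ ring (+ m) ⟩
  closed-UDUDD-0 (+ suc m) ∎
  where
  open ≡-Reasoning
  ring : ∀ i → (+ 230 * i + + 345 * i * i + + 130 * i * i * i + + 15 * i * i * i * i) + (+ 330 * i + + 515 * i * i + + 210 * i * i * i + + 25 * i * i * i * i) + (+ 830 * i + + 815 * i * i + + 250 * i * i * i + + 25 * i * i * i * i) + (+ 130 * i + + 225 * i * i + + 110 * i * i * i + + 15 * i * i * i * i) + (- (+ 446 * i) - + 15 * i * i + + 310 * i * i * i + + 135 * i * i * i * i + + 16 * i * i * i * i * i) ≡ - (+ 446 * (+ 1 + i)) - + 15 * (+ 1 + i) * (+ 1 + i) + + 310 * (+ 1 + i) * (+ 1 + i) * (+ 1 + i) + + 135 * (+ 1 + i) * (+ 1 + i) * (+ 1 + i) * (+ 1 + i) + + 16 * (+ 1 + i) * (+ 1 + i) * (+ 1 + i) * (+ 1 + i) * (+ 1 + i)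
  ring = solve-∀

closed-E-1 : ℤ → ℤ → ℤ
closed-E-1 i a = + 1920 * a - + 600 - + 120 * i

value-E-1 : ∀ m → + 120 * prefixSum [] 1 (3 N.+ m) ≡ closed-E-1 (+ m) ((+ 2) ^ m)
value-E-1 m = ≡.trans (eulerian-value-1 (3 N.+ m)) (ring (+ m) ((+ 2) ^ m))
  where
  ring : ∀ i a → + 120 * (+ 2 * (+ 2 * (+ 2 * (+ 2 * a))) - (+ 3 + i) - + 2) ≡ + 1920 * a - + 600 - + 120 * i
  ring = solve-∀

closed-E-2 : ℤ → ℤ → ℤ → ℤ
closed-E-2 i a t = + 9720 * t - + 9600 * a - + 1920 * a * i + + 1200 + + 540 * i + + 60 * i * i

value-E-2 : ∀ m → + 120 * prefixSum [] 2 (3 N.+ m) ≡ closed-E-2 (+ m) ((+ 2) ^ m) ((+ 3) ^ m)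
value-E-2 m = ≡.trans (eulerian-value-2 (3 N.+ m)) (ring (+ m) ((+ 2) ^ m) ((+ 3) ^ m))
  where
  ring : ∀ i a t → + 60 * (+ 6 * (+ 3 * (+ 3 * (+ 3 * t))) - + 4 * (+ 3 + i + + 2) * (+ 2 * (+ 2 * (+ 2 * a))) + (+ 3 + i + + 1) * (+ 3 + i + + 2)) ≡ + 9720 * t - + 9600 * a - + 1920 * a * i + + 1200 + + 540 * i + + 60 * i * i
  ring = solve-∀

value-U-1 : ∀ m → + 120 * prefixSum (U ∷ []) 1 (3 N.+ m) ≡ + 1920 * (+ 2) ^ m - + 960 - + 240 * + m
value-U-1 m = begin
  + 120 * x  ≡⟨ cancel x y ⟩
  + 120 * (x + y) - + 120 * y          ≡⟨ cong (λ z → + 120 * z - + 120 * y) (prefixSum-split 0 (3 N.+ m)) ⟨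
  + 120 * prefixSum [] 1 (3 N.+ m) - + 120 * y ≡⟨ cong₂ _-_ (value-E-1 m) (value-D-0 m) ⟩
  closed-E-1 (+ m) ((+ 2) ^ m) - closed-D-0 (+ m) ≡⟨ ring (+ m) ((+ 2) ^ m) ⟩
  _ ∎
  where
  open ≡-Reasoning
  x y : ℤ
  x = prefixSum (U ∷ []) 1 (3 N.+ m)
  y = prefixSum (D ∷ []) 0 (3 N.+ m)
  cancel : ∀ x y → + 120 * x ≡ + 120 * (x + y) - + 120 * y
  cancel = solve-∀
  ring : ∀ i a → (+ 1920 * a - + 600 - + 120 * i) - (+ 360 + + 120 * i) ≡ + 1920 * a - + 960 - + 240 * i
  ring = solve-∀

closed-D-1 : ℤ → ℤ → ℤ
closed-D-1 i a = + 1920 * a + + 960 * a * i - + 960 - + 720 * i - + 120 * i * i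

value-D-1 : ∀ m → + 120 * prefixSum (D ∷ []) 1 (3 N.+ m) ≡ closed-D-1 (+ m) ((+ 2) ^ m)
value-D-1 zero    = refl
value-D-1 (suc m) = begin
  + 120 * prefixSum (D ∷ []) 1 (4 N.+ m)
    ≡⟨ cong (_*_ (+ 120)) (prefixSum-rec (last) 0 (3 N.+ m)) ⟩
  _ ≡⟨ distribute (prefixSum [] 1 (3 N.+ m)) (prefixSum (D ∷ []) 1 (3 N.+ m)) (prefixSum (D ∷ []) 0 (3 N.+ m)) (+ m) ⟩
  _ ≡⟨ cong₂ _+_ (value-E-1 m) (cong₂ _+_ (cong (_*_ (+ 2)) (value-D-1 m)) (cong (_*_ (+ 3 + + m - + 1)) (value-D-0 m))) ⟩
  _ ≡⟨ ring (+ m) ((+ 2) ^ m) ⟩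
  closed-D-1 (+ suc m) ((+ 2) ^ suc m) ∎
  where
  open ≡-Reasoning
  distribute : ∀ x0 y z i → + 120 * (x0 + (+ 0) + ((+ 2 + + 0) * y + (+ 3 + i - + 1 - + 0) * z)) ≡ + 120 * x0 + (+ 2 * (+ 120 * y) + (+ 3 + i - + 1) * (+ 120 * z))
  distribute = solve-∀
  ring : ∀ i a → (+ 1920 * a - + 600 - + 120 * i) + (+ 2 * (+ 1920 * a + + 960 * a * i - + 960 - + 720 * i - + 120 * i * i) + (+ 3 + i - + 1) * (+ 360 + + 120 * i)) ≡ + 1920 * (+ 2 * a) + + 960 * (+ 2 * a) * (+ 1 + i) - + 960 - + 720 * (+ 1 + i) - + 120 * (+ 1 + i) * (+ 1 + i)
  ring = solve-∀

closed-DD-1 : ℤ → ℤ → ℤ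
closed-DD-1 i a = + 960 * a + + 720 * a * i + + 240 * a * i * i - + 840 - + 960 * i - + 420 * i * i - + 60 * i * i * i

value-DD-1 : ∀ m → + 120 * prefixSum (D ∷ D ∷ []) 1 (3 N.+ m) ≡ closed-DD-1 (+ m) ((+ 2) ^ m)
value-DD-1 zero    = refl
value-DD-1 (suc m) = begin
  + 120 * prefixSum (D ∷ D ∷ []) 1 (4 N.+ m)
    ≡⟨ cong (_*_ (+ 120)) (prefixSum-rec (D ∷ last) 0 (3 N.+ m)) ⟩
  _ ≡⟨ distribute (prefixSum (D ∷ []) 1 (3 N.+ m)) (prefixSum (D ∷ D ∷ []) 1 (3 N.+ m)) (prefixSum (D ∷ D ∷ []) 0 (3 N.+ m)) (+ m) ⟩
  _ ≡⟨ cong₂ _+_ (value-D-1 m) (cong₂ _+_ (cong (_*_ (+ 2)) (value-DD-1 m)) (cong (_*_ (+ 3 + + m - + 2)) (value-DD-0 m))) ⟩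
  _ ≡⟨ ring (+ m) ((+ 2) ^ m) ⟩
  closed-DD-1 (+ suc m) ((+ 2) ^ suc m) ∎
  where
  open ≡-Reasoning
  distribute : ∀ x0 y z i → + 120 * (x0 + (+ 0) + ((+ 2 + + 0) * y + (+ 3 + i - + 2 - + 0) * z)) ≡ + 120 * x0 + (+ 2 * (+ 120 * y) + (+ 3 + i - + 2) * (+ 120 * z))
  distribute = solve-∀
  ring : ∀ i a → (+ 1920 * a + + 960 * a * i - + 960 - + 720 * i - + 120 * i * i) + (+ 2 * (+ 960 * a + + 720 * a * i + + 240 * a * i * i - + 840 - + 960 * i - + 420 * i * i - + 60 * i * i * i) + (+ 3 + i - + 2) * (+ 360 + + 300 * i + + 60 * i * i)) ≡ + 960 * (+ 2 * a) + + 720 * (+ 2 * a) * (+ 1 + i) + + 240 * (+ 2 * a) * (+ 1 + i) * (+ 1 + i) - + 840 - + 960 * (+ 1 + i) - + 420 * (+ 1 + i) * (+ 1 + i) - + 60 * (+ 1 + i) * (+ 1 + i) * (+ 1 + i)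
  ring = solve-∀

closed-UD-1 : ℤ → ℤ → ℤ
closed-UD-1 i a = + 960 * a + + 1680 * a * i + + 240 * a * i * i - + 600 - + 1320 * i - + 540 * i * i - + 60 * i * i * i

value-UD-1 : ∀ m → + 120 * prefixSum (U ∷ D ∷ []) 1 (3 N.+ m) ≡ closed-UD-1 (+ m) ((+ 2) ^ m)
value-UD-1 zero    = refl
value-UD-1 (suc m) = begin
  + 120 * prefixSum (U ∷ D ∷ []) 1 (4 N.+ m)
    ≡⟨ cong (_*_ (+ 120)) (prefixSum-rec (U ∷ last) 0 (3 N.+ m)) ⟩
  _ ≡⟨ distribute (prefixSum (U ∷ []) 1 (3 N.+ m)) (prefixSum (D ∷ []) 1 (3 N.+ m)) (prefixSum (U ∷ D ∷ []) 1 (3 N.+ m)) (prefixSum (U ∷ D ∷ []) 0 (3 N.+ m)) (+ m) ⟩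
  _ ≡⟨ cong₂ _+_ (cong₂ _+_ (value-U-1 m) (value-D-1 m)) (cong₂ _+_ (cong (_*_ (+ 2)) (value-UD-1 m)) (cong (_*_ (+ 3 + + m - + 2)) (value-UD-0 m))) ⟩
  _ ≡⟨ ring (+ m) ((+ 2) ^ m) ⟩
  closed-UD-1 (+ suc m) ((+ 2) ^ suc m) ∎
  where
  open ≡-Reasoning
  distribute : ∀ x0 x1 y z i → + 120 * (x0 + (x1 + (+ 0)) + ((+ 2 + + 0) * y + (+ 3 + i - + 2 - + 0) * z)) ≡ + 120 * x0 + + 120 * x1 + (+ 2 * (+ 120 * y) + (+ 3 + i - + 2) * (+ 120 * z))
  distribute = solve-∀
  ring : ∀ i a → (+ 1920 * a - + 960 - + 240 * i) + (+ 1920 * a + + 960 * a * i - + 960 - + 720 * i - + 120 * i * i) + (+ 2 * (+ 960 * a + + 1680 * a * i + + 240 * a * i * i - + 600 - + 1320 * i - + 540 * i * i - + 60 * i * i * i) + (+ 3 + i - + 2) * (+ 600 + + 420 * i + + 60 * i * i)) ≡ + 960 * (+ 2 * a) + + 1680 * (+ 2 * a) * (+ 1 + i) + + 240 * (+ 2 * a) * (+ 1 + i) * (+ 1 + i) - + 600 - + 1320 * (+ 1 + i) - + 540 * (+ 1 + i) * (+ 1 + i) - + 60 * (+ 1 + i) * (+ 1 + i) * (+ 1 + i)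
  ring = solve-∀

closed-UDD-1 : ℤ → ℤ → ℤ
closed-UDD-1 i a = + 960 * a + + 400 * a * i + + 480 * a * i * i + + 80 * a * i * i * i - + 960 - + 1100 * i - + 920 * i * i - + 340 * i * i * i - + 40 * i * i * i * i

value-UDD-1 : ∀ m → + 120 * prefixSum (U ∷ D ∷ D ∷ []) 1 (3 N.+ m) ≡ closed-UDD-1 (+ m) ((+ 2) ^ m)
value-UDD-1 zero    = refl
value-UDD-1 (suc m) = begin
  + 120 * prefixSum (U ∷ D ∷ D ∷ []) 1 (4 N.+ m)
    ≡⟨ cong (_*_ (+ 120)) (prefixSum-rec (U ∷ D ∷ last) 0 (3 N.+ m)) ⟩
  _ ≡⟨ distribute (prefixSum (U ∷ D ∷ []) 1 (3 N.+ m)) (prefixSum (D ∷ D ∷ []) 1 (3 N.+ m)) (prefixSum (U ∷ D ∷ D ∷ []) 1 (3 N.+ m)) (prefixSum (U ∷ D ∷ D ∷ []) 0 (3 N.+ m)) (+ m) ⟩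
  _ ≡⟨ cong₂ _+_ (cong₂ _+_ (value-UD-1 m) (value-DD-1 m)) (cong₂ _+_ (cong (_*_ (+ 2)) (value-UDD-1 m)) (cong (_*_ (+ 3 + + m - + 3)) (value-UDD-0 m))) ⟩
  _ ≡⟨ ring (+ m) ((+ 2) ^ m) ⟩
  closed-UDD-1 (+ suc m) ((+ 2) ^ suc m) ∎
  where
  open ≡-Reasoning
  distribute : ∀ x0 x1 y z i → + 120 * (x0 + (x1 + (+ 0)) + ((+ 2 + + 0) * y + (+ 3 + i - + 3 - + 0) * z)) ≡ + 120 * x0 + + 120 * x1 + (+ 2 * (+ 120 * y) + (+ 3 + i - + 3) * (+ 120 * z))
  distribute = solve-∀
  ring : ∀ i a → (+ 960 * a + + 1680 * a * i + + 240 * a * i * i - + 600 - + 1320 * i - + 540 * i * i - + 60 * i * i * i) + (+ 960 * a + + 720 * a * i + + 240 * a * i * i - + 840 - + 960 * i - + 420 * i * i - + 60 * i * i * i) + (+ 2 * (+ 960 * a + + 400 * a * i + + 480 * a * i * i + + 80 * a * i * i * i - + 960 - + 1100 * i - + 920 * i * i - + 340 * i * i * i - + 40 * i * i * i * i) + (+ 3 + i - + 3) * (+ 360 + + 620 * i + + 300 * i * i + + 40 * i * i * i)) ≡ + 960 * (+ 2 * a) + + 400 * (+ 2 * a) * (+ 1 + i) + + 480 * (+ 2 * a) * (+ 1 + i) * (+ 1 + i) + + 80 * (+ 2 * a) * (+ 1 + i) * (+ 1 + i) * (+ 1 + i) - + 960 - + 1100 * (+ 1 + i) - + 920 * (+ 1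 + i) * (+ 1 + i) - + 340 * (+ 1 + i) * (+ 1 + i) * (+ 1 + i) - + 40 * (+ 1 + i) * (+ 1 + i) * (+ 1 + i) * (+ 1 + i)
  ring = solve-∀

closed-D-2 : ℤ → ℤ → ℤ → ℤ
closed-D-2 i a t = + 3240 * t + + 3240 * t * i - + 3840 * a - + 4800 * a * i - + 960 * a * i * i + + 720 + + 1140 * i + + 480 * i * i + + 60 * i * i * i

value-D-2 : ∀ m → + 120 * prefixSum (D ∷ []) 2 (3 N.+ m) ≡ closed-D-2 (+ m) ((+ 2) ^ m) ((+ 3) ^ m)
value-D-2 zero    = refl
value-D-2 (suc m) = begin
  + 120 * prefixSum (D ∷ []) 2 (4 N.+ m)
    ≡⟨ cong (_*_ (+ 120)) (prefixSum-rec (last) 1 (3 N.+ m)) ⟩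
  _ ≡⟨ distribute (prefixSum [] 2 (3 N.+ m)) (prefixSum (D ∷ []) 2 (3 N.+ m)) (prefixSum (D ∷ []) 1 (3 N.+ m)) (+ m) ⟩
  _ ≡⟨ cong₂ _+_ (value-E-2 m) (cong₂ _+_ (cong (_*_ (+ 3)) (value-D-2 m)) (cong (_*_ (+ 3 + + m - + 2)) (value-D-1 m))) ⟩
  _ ≡⟨ ring (+ m) ((+ 2) ^ m) ((+ 3) ^ m) ⟩
  closed-D-2 (+ suc m) ((+ 2) ^ suc m) ((+ 3) ^ suc m) ∎
  where
  open ≡-Reasoning
  distribute : ∀ x0 y z i → + 120 * (x0 + (+ 0) + ((+ 2 + + 1) * y + (+ 3 + i - + 1 - + 1) * z)) ≡ + 120 * x0 + (+ 3 * (+ 120 * y) + (+ 3 + i - + 2) * (+ 120 * z))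
  distribute = solve-∀
  ring : ∀ i a t → (+ 9720 * t - + 9600 * a - + 1920 * a * i + + 1200 + + 540 * i + + 60 * i * i) + (+ 3 * (+ 3240 * t + + 3240 * t * i - + 3840 * a - + 4800 * a * i - + 960 * a * i * i + + 720 + + 1140 * i + + 480 * i * i + + 60 * i * i * i) + (+ 3 + i - + 2) * (+ 1920 * a + + 960 * a * i - + 960 - + 720 * i - + 120 * i * i)) ≡ + 3240 * (+ 3 * t) + + 3240 * (+ 3 * t) * (+ 1 + i) - + 3840 * (+ 2 * a) - + 4800 * (+ 2 * a) * (+ 1 + i) - + 960 * (+ 2 * a) * (+ 1 + i) * (+ 1 + i) + + 720 + + 1140 * (+ 1 + i) + + 480 * (+ 1 + i) * (+ 1 + i) + + 60 * (+ 1 + i) * (+ 1 + i) * (+ 1 + i)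
  ring = solve-∀

-- Exponential generating functions as integer sequences

Stream : Set
Stream = ℕ → ℤ

infix  4 _≈_
infixl 6 _⊕_ _⊖_
infixl 7 _⋆_
infixr 8 _·_

_≈_ : Stream → Stream → Set
f ≈ g = ∀ n → f n ≡ g n

_⊕_ _⊖_ _⋆_ : Stream → Stream → Stream
(f ⊕ g) n = f n + g n
(f ⊖ g) n = f n - g n

neg : Stream → Stream
neg f n = - f n

_·_ : ℤ → Stream → Stream
(c · f) n = c * f n

tail : Stream → Stream
tail f n = f (suc n)

-- The product of exponential generating functions, defined through the Leibniz rule.
(f ⋆ g) zero    = f 0 * g 0
(f ⋆ g) (suc n) = (tail f ⋆ g) n + (f ⋆ tail g) n

const : ℤ → Stream
const c zero    = c
const c (suc n) = + 0

⋆-cong : ∀ {f f′ g g′} → f ≈ f′ → g ≈ g′ → f ⋆ g ≈ f′ ⋆ g′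
⋆-cong p q zero    = cong₂ _*_ (p 0) (q 0)
⋆-cong p q (suc n) = cong₂ _+_ (⋆-cong (λ k → p (suc k)) q n) (⋆-cong p (λ k → q (suc k)) n)

⋆-comm : ∀ f g → f ⋆ g ≈ g ⋆ f
⋆-comm f g zero    = ZP.*-comm (f 0) (g 0)
⋆-comm f g (suc n) = ≡.trans (cong₂ _+_ (⋆-comm (tail f) g n) (⋆-comm f (tail g) n)) (ZP.+-comm ((g ⋆ tail f) n) ((tail g ⋆ f) n))

private
  +-interchange : ∀ a b c d → a + b + (c + d) ≡ a + c + (b + d)
  +-interchange = solve-∀

⋆-lin : ∀ c f g h → (c · f ⊕ g) ⋆ h ≈ c · (f ⋆ h) ⊕ g ⋆ h
⋆-lin c f g h zero    = ring c (f 0) (g 0) (h 0)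
  where
  ring : ∀ c f g h → (c * f + g) * h ≡ c * (f * h) + g * h
  ring = solve-∀
⋆-lin c f g h (suc n) = ≡.trans (cong₂ _+_ (⋆-lin c (tail f) (tail g) h n) (⋆-lin c f g (tail h) n))
  (ring c ((tail f ⋆ h) n) ((tail g ⋆ h) n) ((f ⋆ tail h) n) ((g ⋆ tail h) n))
  where
  ring : ∀ c x y x′ y′ → c * x + y + (c * x′ + y′) ≡ c * (x + x′) + (y + y′)
  ring = solve-∀

⋆-distribʳ : ∀ f g h → (f ⊕ g) ⋆ h ≈ f ⋆ h ⊕ g ⋆ h
⋆-distribʳ f g h zero    = ZP.*-distribʳ-+ (h 0) (f 0) (g 0)
⋆-distribʳ f g h (suc n) = ≡.trans (cong₂ _+_ (⋆-distribʳ (tail f) (tail g) h n) (⋆-distribʳ f g (tail h) n))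
  (+-interchange ((tail f ⋆ h) n) ((tail g ⋆ h) n) ((f ⋆ tail h) n) ((g ⋆ tail h) n))

⋆-distribˡ : ∀ f g h → f ⋆ (g ⊕ h) ≈ f ⋆ g ⊕ f ⋆ h
⋆-distribˡ f g h n = ≡.trans (⋆-comm f (g ⊕ h) n) (≡.trans (⋆-distribʳ g h f n) (cong₂ _+_ (⋆-comm g f n) (⋆-comm h f n)))

-- Both bracketings obey the same Leibniz rule for a threefold product, so an induction on the
-- coefficient, for all streams at once, suffices and no binomial sums appear.
⋆-assoc : ∀ f g h → (f ⋆ g) ⋆ h ≈ f ⋆ (g ⋆ h)
⋆-assoc f g h zero    = ZP.*-assoc (f 0) (g 0) (h 0)
⋆-assoc f g h (suc n) = begin
  (tail (f ⋆ g) ⋆ h) n + (f ⋆ g ⋆ tail h) n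
    ≡⟨ cong₂ _+_ (⋆-distribʳ (tail f ⋆ g) (f ⋆ tail g) h n) (⋆-assoc f g (tail h) n) ⟩
  (tail f ⋆ g ⋆ h) n + (f ⋆ tail g ⋆ h) n + (f ⋆ (g ⋆ tail h)) n
    ≡⟨ cong₂ (λ x y → x + y + (f ⋆ (g ⋆ tail h)) n) (⋆-assoc (tail f) g h n) (⋆-assoc f (tail g) h n) ⟩
  (tail f ⋆ (g ⋆ h)) n + (f ⋆ (tail g ⋆ h)) n + (f ⋆ (g ⋆ tail h)) n
    ≡⟨ ZP.+-assoc ((tail f ⋆ (g ⋆ h)) n) ((f ⋆ (tail g ⋆ h)) n) ((f ⋆ (g ⋆ tail h)) n) ⟩
  (tail f ⋆ (g ⋆ h)) n + ((f ⋆ (tail g ⋆ h)) n + (f ⋆ (g ⋆ tail h)) n)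
    ≡⟨ cong (_+_ ((tail f ⋆ (g ⋆ h)) n)) (⋆-distribˡ f (tail g ⋆ h) (g ⋆ tail h) n) ⟨
  (tail f ⋆ (g ⋆ h)) n + (f ⋆ tail (g ⋆ h)) n ∎
  where open ≡-Reasoning

const-0 : ∀ n → const (+ 0) n ≡ + 0
const-0 zero    = refl
const-0 (suc n) = refl

0⋆ : ∀ f → (λ _ → + 0) ⋆ f ≈ (λ _ → + 0)
0⋆ f zero    = ZP.*-zeroˡ (f 0)
0⋆ f (suc n) = cong₂ _+_ (0⋆ f n) (0⋆ (tail f) n)

const-⋆ : ∀ c f → const c ⋆ f ≈ c · f
const-⋆ c f zero    = refl
const-⋆ c f (suc n) = ≡.trans (cong₂ _+_ (0⋆ f n) (const-⋆ c (tail f) n)) (ZP.+-identityˡ (c * f (suc n)))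

·-⋆ : ∀ c f g → (c · f) ⋆ g ≈ c · (f ⋆ g)
·-⋆ c f g n = ≡.trans (⋆-cong (λ k → sym (const-⋆ c f k)) (λ _ → refl) n)
  (≡.trans (⋆-assoc (const c) f g n) (const-⋆ c (f ⋆ g) n))

streamRing : CommutativeRing 0ℓ 0ℓ
streamRing = record
  { Carrier = Stream
  ; _≈_ = _≈_
  ; _+_ = _⊕_
  ; _*_ = _⋆_
  ; -_ = neg
  ; 0# = const (+ 0)
  ; 1# = const (+ 1)
  ; isCommutativeRing = record
    { isRing = record
      { +-isAbelianGroup = record
        { isGroup = record
          { isMonoid = record
            { isSemigroup = record
              { isMagma = record
                { isEquivalence = record
                  { refl = λ _ → refl ; sym = λ p n → sym (p n) ; trans = λ p q n → ≡.trans (p n) (q n) }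
                ; ∙-cong = λ p q n → cong₂ _+_ (p n) (q n) }
              ; assoc = λ f g h n → ZP.+-assoc (f n) (g n) (h n) }
            ; identity = (λ f n → ≡.trans (cong (_+ f n) (const-0 n)) (ZP.+-identityˡ (f n)))
                       , (λ f n → ≡.trans (cong (_+_ (f n)) (const-0 n)) (ZP.+-identityʳ (f n))) }
          ; inverse = (λ f n → ≡.trans (ZP.+-inverseˡ (f n)) (sym (const-0 n)))
                    , (λ f n → ≡.trans (ZP.+-inverseʳ (f n)) (sym (const-0 n)))
          ; ⁻¹-cong = λ p n → cong -_ (p n) }
        ; comm = λ f g n → ZP.+-comm (f n) (g n) }
      ; *-cong = ⋆-cong
      ; *-assoc = ⋆-assoc
      ; *-identity = (λ f n → ≡.trans (const-⋆ (+ 1) f n) (ZP.*-identityˡ (f n)))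
                   , (λ f n → ≡.trans (⋆-comm f (const (+ 1)) n) (≡.trans (const-⋆ (+ 1) f n) (ZP.*-identityˡ (f n))))
      ; distrib = ⋆-distribˡ , (λ f g h → ⋆-distribʳ g h f) }
    ; *-comm = ⋆-comm } }

streamACR : AlmostCommutativeRing 0ℓ 0ℓ
streamACR = fromCommutativeRing streamRing

constMorphism : CommutativeRing.rawRing ZP.+-*-commutativeRing -Raw-AlmostCommutative⟶ streamACR
constMorphism = record
  { ⟦_⟧    = const
  ; +-homo = λ { a b zero → refl ; a b (suc n) → refl }
  ; *-homo = λ a b n → sym (≡.trans (const-⋆ a (const b) n) (const-* a b n))
  ; -‿homo = λ { a zero → refl ; a (suc n) → refl }
  ; 0-homo = λ _ → refl
  ; 1-homo = λ _ → refl
  }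
  where
  const-* : ∀ a b → a · const b ≈ const (a * b)
  const-* a b zero    = refl
  const-* a b (suc n) = ZP.*-zeroʳ a

const-≟ : ∀ a b → Maybe (const a ≈ const b)
const-≟ a b with a Z.≟ b
... | yes refl = just (λ _ → refl)
... | no _     = nothing

module StreamSolver = RingSolver (CommutativeRing.rawRing ZP.+-*-commutativeRing) streamACR constMorphism const-≟
open StreamSolver using (solve; _:=_; _:+_; _:*_; _:-_; con)

expo : ℤ → Stream
expo c n = c ^ n

expo-⋆ : ∀ b c → expo b ⋆ expo c ≈ expo (b + c)
expo-⋆ b c zero    = refl
expo-⋆ b c (suc n) = begin
  (b · expo b ⋆ expo c) n + (expo b ⋆ c · expo c) n ≡⟨ cong₂ _+_ (·-⋆ b (expo b) (expo c) n)
      (≡.trans (⋆-comm (expo b) (c · expo c) n) (≡.trans (·-⋆ c (expo c) (expo b) n) (cong (_*_ c) (⋆-comm (expo c) (expo b) n)))) ⟩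
  b * (expo b ⋆ expo c) n + c * (expo b ⋆ expo c) n ≡⟨ ZP.*-distribʳ-+ ((expo b ⋆ expo c) n) b c ⟨
  (b + c) * (expo b ⋆ expo c) n  ≡⟨ cong (_*_ (b + c)) (expo-⋆ b c n) ⟩
  (b + c) * (b + c) ^ n  ∎
  where open ≡-Reasoning

-- The exponential generating function x^k / k!.
δ : ℕ → Stream
δ zero    zero    = + 1
δ zero    (suc n) = + 0
δ (suc k) zero    = + 0
δ (suc k) (suc n) = δ k n

X⋆-suc : ∀ f n → (δ 1 ⋆ f) (suc n) ≡ + suc n * f n
X⋆-suc f zero    = ring (f 0) (f 1)
  where
  ring : ∀ x y → + 1 * x + + 0 * y ≡ + 1 * x
  ring = solve-∀
X⋆-suc f (suc n) = ≡.trans (cong₂ _+_ (≡.trans (⋆-cong δ0 (λ _ → refl) (suc n)) (const-⋆ (+ 1) f (suc n))) (X⋆-suc (tail f) n)) (ring (f (suc n)) (+ n))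
  where
  δ0 : δ 0 ≈ const (+ 1)
  δ0 zero    = refl
  δ0 (suc n) = refl
  ring : ∀ x i → + 1 * x + (+ 1 + i) * x ≡ (+ 1 + (+ 1 + i)) * x
  ring = solve-∀

X⋆δ : ∀ k → δ 1 ⋆ δ k ≈ (+ suc k) · δ (suc k)
X⋆δ k zero    = ≡.trans (ZP.*-zeroˡ (δ k 0)) (sym (ZP.*-zeroʳ (+ suc k)))
X⋆δ k (suc n) = ≡.trans (X⋆-suc (δ k) n) (diagonal k n)
  where
  diagonal : ∀ k n → + suc n * δ k n ≡ + suc k * δ k n
  diagonal zero    zero    = refl
  diagonal zero    (suc n) = ZP.*-zeroʳ (+ suc (suc n))
  diagonal (suc k) zero    = sym (ZP.*-zeroʳ (+ suc (suc k)))
  diagonal (suc k) (suc n) = ≡.trans (peel (+ suc n) (δ k n)) (≡.trans (cong (_+_ (δ k n)) (diagonal k n)) (sym (peel (+ suc k) (δ k n))))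
    where
    peel : ∀ i x → (+ 1 + i) * x ≡ x + i * x
    peel = solve-∀

-- The Leibniz rule for x^k / k! times e^x is Pascal's rule.
δ⋆expo1 : ∀ k n → (δ k ⋆ expo (+ 1)) n ≡ + (n C k)
δ⋆expo1 k n = go n k
  where
  pascal : ∀ n k → + (n C k) + + (n C suc k) ≡ + (suc n C suc k)
  pascal n k = cong +_ (nCk+nC[k+1]≡[n+1]C[k+1] n k)
  u′ : tail (expo (+ 1)) ≈ expo (+ 1)
  u′ n = ZP.*-identityˡ ((+ 1) ^ n)
  0⋆u : ∀ n → (tail (δ 0) ⋆ expo (+ 1)) n ≡ + 0
  0⋆u = 0⋆ (expo (+ 1))
  go : ∀ n k → (δ k ⋆ expo (+ 1)) n ≡ + (n C k)
  go zero    zero    = refl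
  go zero    (suc k) = refl
  go (suc n) zero    = ≡.trans (cong₂ _+_ (0⋆u n) (≡.trans (⋆-cong {f = δ 0} (λ _ → refl) u′ n) (go n 0))) refl
  go (suc n) (suc k) = ≡.trans (cong₂ _+_ (go n k) (≡.trans (⋆-cong {f = δ (suc k)} (λ _ → refl) u′ n) (go n (suc k)))) (pascal n k)

ode-unique : ∀ f g r → f 0 ≡ g 0 → tail f ≈ f ⊕ r → tail g ≈ g ⊕ r → f ≈ g
ode-unique f g r z p q zero    = z
ode-unique f g r z p q (suc n) = ≡.trans (p n) (≡.trans (cong (_+ r n) (ode-unique f g r z p q n)) (sym (q n)))

-- The exponential formula for cycles

-- A state (a , d) records the cyclic ascents and descents of a cycle. A new maximum in place of one
-- of the a ascents adds a descent, in place of one of the d descents it adds an ascent.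
grow : (ℕ → ℕ → ℤ) → ℕ → ℕ → ℤ
grow g a d = + a * g a (suc d) + + d * g (suc a) d

iterGrow : ℕ → (ℕ → ℕ → ℤ) → ℕ → ℕ → ℤ
iterGrow zero    g = g
iterGrow (suc r) g = grow (iterGrow r g)

-- The new element enters one of the cycles or becomes a fixed point, whose state is (1 , 0) because
-- `cA` counts weak inequalities.
growAll : (List (ℕ × ℕ) → ℤ) → List (ℕ × ℕ) → ℤ
growAll F []            = F ((1 , 0) ∷ [])
growAll F ((a , d) ∷ s) = grow (λ a′ d′ → F ((a′ , d′) ∷ s)) a d + growAll (F ∘ ((a , d) ∷_)) s

iterGrowAll : ℕ → (List (ℕ × ℕ) → ℤ) → List (ℕ × ℕ) → ℤ
iterGrowAll zero    F = F
iterGrowAll (suc n) F = growAll (iterGrowAll n F)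

growAll-cong : ∀ {F G} → (∀ s → F s ≡ G s) → ∀ s → growAll F s ≡ growAll G s
growAll-cong h []            = h _
growAll-cong h ((a , d) ∷ s) = cong₂ _+_ (cong₂ (λ x y → + a * x + + d * y) (h _) (h _)) (growAll-cong (h ∘ ((a , d) ∷_)) s)

iterGrowAll-shift : ∀ n F s → iterGrowAll (suc n) F s ≡ iterGrowAll n (growAll F) s
iterGrowAll-shift zero    F s = refl
iterGrowAll-shift (suc n) F s = growAll-cong (iterGrowAll-shift n F) s

growAll-lin : ∀ c F G s → growAll (λ z → c * F z + G z) s ≡ c * growAll F s + growAll G s
growAll-lin c F G []            = refl
growAll-lin c F G ((a , d) ∷ s) = ≡.trans
  (cong (_+_ (grow (λ a′ d′ → c * F ((a′ , d′) ∷ s) + G ((a′ , d′) ∷ s)) a d)) (growAll-lin c (F ∘ ((a , d) ∷_)) (G ∘ ((a , d) ∷_)) s))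
  (ring c (+ a) (+ d) _ _ _ _ (growAll (F ∘ ((a , d) ∷_)) s) (growAll (G ∘ ((a , d) ∷_)) s))
  where
  ring : ∀ c a d x x′ y y′ z z′ → a * (c * x + x′) + d * (c * y + y′) + (c * z + z′) ≡ c * (a * x + d * y + z) + (a * x′ + d * y′ + z′)
  ring = solve-∀

growAll-+ : ∀ F G s → growAll (λ z → F z + G z) s ≡ growAll F s + growAll G s
growAll-+ F G s = ≡.trans (growAll-cong (λ z → cong (_+ G z) (sym (ZP.*-identityˡ (F z)))) s)
  (≡.trans (growAll-lin (+ 1) F G s) (cong (_+ growAll G s) (ZP.*-identityˡ (growAll F s))))

growAll-* : ∀ c F s → growAll (λ z → c * F z) s ≡ c * growAll F s
growAll-* c F []            = refl
growAll-* c F ((a , d) ∷ s) = ≡.trans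
  (cong (_+_ (grow (λ a′ d′ → c * F ((a′ , d′) ∷ s)) a d)) (growAll-* c (F ∘ ((a , d) ∷_)) s))
  (ring c (+ a) (+ d) _ _ (growAll (F ∘ ((a , d) ∷_)) s))
  where
  ring : ∀ c a d x y z → a * (c * x) + d * (c * y) + c * z ≡ c * (a * x + d * y + z)
  ring = solve-∀

growAll-⋆ : ∀ f (H : List (ℕ × ℕ) → Stream) n s →
  growAll (λ z → (f ⋆ H z) n) s ≡ (f ⋆ (λ k → growAll (λ z → H z k) s)) n
growAll-⋆ f H zero    s = growAll-* (f 0) (λ z → H z 0) s
growAll-⋆ f H (suc n) s = ≡.trans (growAll-+ (λ z → (tail f ⋆ H z) n) (λ z → (f ⋆ tail (H z)) n) s)
  (cong₂ _+_ (growAll-⋆ (tail f) H n s) (growAll-⋆ f (λ z → tail (H z)) n s))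

-- The coefficient of t^j in the product of two power series in t whose coefficients are streams.
convolve : (ℕ → Stream) → (ℕ → Stream) → ℕ → Stream
convolve f g zero    = f 0 ⋆ g 0
convolve f g (suc j) = f 0 ⋆ g (suc j) ⊕ convolve (f ∘ suc) g j

convolve-tail : ∀ f g j n → convolve f g j (suc n) ≡ convolve (tail ∘ f) g j n + convolve f (tail ∘ g) j n
convolve-tail f g zero    n = refl
convolve-tail f g (suc j) n = ≡.trans (cong (_+_ ((f 0 ⋆ g (suc j)) (suc n))) (convolve-tail (f ∘ suc) g j n))
  (ring ((tail (f 0) ⋆ g (suc j)) n) ((f 0 ⋆ tail (g (suc j))) n) (convolve (tail ∘ f ∘ suc) g j n) (convolve (f ∘ suc) (tail ∘ g) j n))
  where
  ring : ∀ a b c d → a + b + (c + d) ≡ a + c + (b + d)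
  ring = solve-∀

convolve-growAll : ∀ f (H : List (ℕ × ℕ) → ℕ → Stream) j n s →
  growAll (λ z → convolve f (H z) j n) s ≡ convolve f (λ i k → growAll (λ z → H z i k) s) j n
convolve-growAll f H zero    n s = growAll-⋆ (f 0) (λ z → H z 0) n s
convolve-growAll f H (suc j) n s = ≡.trans
  (growAll-+ (λ z → (f 0 ⋆ H z (suc j)) n) (λ z → convolve (f ∘ suc) (H z) j n) s)
  (cong₂ _+_ (growAll-⋆ (f 0) (λ z → H z (suc j)) n s) (convolve-growAll (f ∘ suc) H j n s))

convolve-lin : ∀ x y f g h j n →
  convolve (λ i → x · f i ⊕ y · g i) h j n ≡ x * convolve f h j n + y * convolve g h j n
convolve-lin x y f g h zero    n = lin₂ (f 0) (g 0) (h 0) n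
  where
  lin₂ : ∀ f g h → (x · f ⊕ y · g) ⋆ h ≈ x · (f ⋆ h) ⊕ y · (g ⋆ h)
  lin₂ f g h n = ≡.trans (⋆-lin x f (y · g) h n) (cong (_+_ (x * (f ⋆ h) n)) (·-⋆ y g h n))
convolve-lin x y f g h (suc j) n = ≡.trans
  (cong₂ _+_ (≡.trans (⋆-lin x (f 0) (y · g 0) (h (suc j)) n) (cong (_+_ (x * (f 0 ⋆ h (suc j)) n)) (·-⋆ y (g 0) (h (suc j)) n)))
    (convolve-lin x y (f ∘ suc) (g ∘ suc) h j n))
  (ring x y ((f 0 ⋆ h (suc j)) n) ((g 0 ⋆ h (suc j)) n) (convolve (f ∘ suc) h j n) (convolve (g ∘ suc) h j n))
  where
  ring : ∀ x y a b c d → x * a + y * b + (x * c + y * d) ≡ x * (a + c) + y * (b + d)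
  ring = solve-∀

cycleWeight : ℕ → ℕ → ℕ → ℤ
cycleWeight i a d = ind (oddᵇ (a N.+ d) ∧ (a N.⊓ d N.≡ᵇ i))

convolveℤ : (ℕ → ℤ) → (ℕ → ℤ) → ℕ → ℤ
convolveℤ f g zero    = f 0 * g 0
convolveℤ f g (suc j) = f 0 * g (suc j) + convolveℤ (f ∘ suc) g j

-- The coefficient of t^j in the product over the cycles of t^M for odd length and 0 for even
-- length.
weight : ℕ → List (ℕ × ℕ) → ℤ
weight j []            = ind (0 N.≡ᵇ j)
weight j ((a , d) ∷ s) = convolveℤ (λ i → cycleWeight i a d) (λ i → weight i s) j

-- Its r-th coefficient counts the ways to enlarge a cycle in state (a , d) by r elements to a cycle
-- of odd length with M = i.
cycleStream : ℕ → ℕ → ℕ → Stream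
cycleStream i a d r = iterGrow r (cycleWeight i) a d

weightStream : ℕ → List (ℕ × ℕ) → Stream
weightStream j s n = iterGrowAll n (weight j) s

-- Each inserted element goes to the first cycle or elsewhere. One growth step is therefore a
-- derivation on the product of the two weights, and this is the Leibniz rule by which `⋆` is
-- defined.
weightStream-∷ : ∀ n j a d s → weightStream j ((a , d) ∷ s) n ≡
  convolve (λ i → cycleStream i a d) (λ i → weightStream i s) j n
weightStream-∷ zero    j a d s = go (λ i → cycleStream i a d) j
  where
  go : ∀ (f : ℕ → Stream) j → convolveℤ (λ i → f i 0) (λ i → weight i s) j ≡ convolve f (λ i → weightStream i s) j 0
  go f zero    = refl
  go f (suc j) = cong (_+_ (f 0 0 * weight (suc j) s)) (go (f ∘ suc) j)
weightStream-∷ (suc n) j a d s = begin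
  + a * weightStream j ((a , suc d) ∷ s) n + + d * weightStream j ((suc a , d) ∷ s) n
    + growAll (λ z → weightStream j ((a , d) ∷ z) n) s
    ≡⟨ cong₂ _+_ (cong₂ (λ x y → + a * x + + d * y) (weightStream-∷ n j a (suc d) s) (weightStream-∷ n j (suc a) d s))
        (growAll-cong (weightStream-∷ n j a d) s) ⟩
  + a * convolve (λ i → cycleStream i a (suc d)) Q j n + + d * convolve (λ i → cycleStream i (suc a) d) Q j n
    + growAll (λ z → convolve (λ i → cycleStream i a d) (λ i → weightStream i z) j n) s
    ≡⟨ cong₂ _+_ (sym (convolve-lin (+ a) (+ d) (λ i → cycleStream i a (suc d)) (λ i → cycleStream i (suc a) d) Q j n))
        (convolve-growAll (λ i → cycleStream i a d) (λ z i → weightStream i z) j n s) ⟩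
  convolve (λ i → tail (cycleStream i a d)) Q j n + convolve (λ i → cycleStream i a d) (λ i → tail (Q i)) j n
    ≡⟨ convolve-tail (λ i → cycleStream i a d) Q j n ⟨
  convolve (λ i → cycleStream i a d) Q j (suc n) ∎
  where
  open ≡-Reasoning
  Q : ℕ → Stream
  Q i = weightStream i s

γ : ℕ → Stream
γ i = cycleStream i 1 0

P : ℕ → Stream
P j = weightStream j []

-- Starting from no cycles, the first element must open one in state (1 , 0). The cycle that
-- contains it contributes γ, and all others together contribute P again.
P-tail : ∀ j → tail (P j) ≈ convolve γ P j
P-tail j n = weightStream-∷ n j 1 0 []

iterGrow-cong : ∀ r {g h} → (∀ a d → g a d ≡ h a d) → ∀ a d → iterGrow r g a d ≡ iterGrow r h a d
iterGrow-cong zero    e a d = e a d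
iterGrow-cong (suc r) e a d = cong₂ (λ x y → + a * x + + d * y) (iterGrow-cong r e a (suc d)) (iterGrow-cong r e (suc a) d)

iterGrow-shift : ∀ r g a d → iterGrow (suc r) g a d ≡ iterGrow r (grow g) a d
iterGrow-shift zero    g a d = refl
iterGrow-shift (suc r) g a d = cong₂ (λ x y → + a * x + + d * y) (iterGrow-shift r g a (suc d)) (iterGrow-shift r g (suc a) d)

iterGrow-lin : ∀ r c g h a d → iterGrow r (λ a d → c * g a d + h a d) a d ≡ c * iterGrow r g a d + iterGrow r h a d
iterGrow-lin zero    c g h a d = refl
iterGrow-lin (suc r) c g h a d = ≡.trans
  (cong₂ (λ x y → + a * x + + d * y) (iterGrow-lin r c g h a (suc d)) (iterGrow-lin r c g h (suc a) d))
  (ring c (+ a) (+ d) (iterGrow r g a (suc d)) (iterGrow r h a (suc d)) (iterGrow r g (suc a) d) (iterGrow r h (suc a) d))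
  where
  ring : ∀ c a d x x′ y y′ → a * (c * x + x′) + d * (c * y + y′) ≡ c * (a * x + d * y) + (a * x′ + d * y′)
  ring = solve-∀

iterGrow-0 : ∀ r a d → iterGrow r (λ _ _ → + 0) a d ≡ + 0
iterGrow-0 zero    a d = refl
iterGrow-0 (suc r) a d = ≡.trans (cong₂ (λ x y → + a * x + + d * y) (iterGrow-0 r a (suc d)) (iterGrow-0 r (suc a) d)) (ring (+ a) (+ d))
  where
  ring : ∀ a d → a * + 0 + d * + 0 ≡ + 0
  ring = solve-∀

[_≡_]ᵢ : ℕ → ℕ → ℤ
[ m ≡ n ]ᵢ = ind (m N.≡ᵇ n)

*-[≡] : ∀ m n (f : ℕ → ℤ) → f m * [ m ≡ n ]ᵢ ≡ f n * [ m ≡ n ]ᵢ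
*-[≡] m n f with m N.≡ᵇ n in eq
... | true  = cong (λ k → f k * + 1) (NP.≡ᵇ⇒≡ m n (subst T (sym eq) tt))
... | false = ≡.trans (ZP.*-zeroʳ (f m)) (sym (ZP.*-zeroʳ (f n)))

-- The Eulerian triangle shifted by one column, with first row `z`. For r ≥ 1 the entry `euler₀ r j`
-- is E(r, j - 1), the number of cycles on r + 1 elements with j descents.
euler : (ℕ → ℤ) → ℕ → ℕ → ℤ
euler z zero    j       = z j
euler z (suc r) zero    = + 0
euler z (suc r) (suc j) = (+ 1 + + j) * euler z r (suc j) + (+ 1 + + r - + j) * euler z r j

-- Every step raises a + d by one, so after r steps from total length 1 the factor G is evaluated at
-- r + 1 and comes out of the iteration. What remains counts by descents and satisfies the Eulerian
-- recurrence.
iterGrow-desc : ∀ {a₀ d₀} → a₀ N.+ d₀ ≡ 1 → ∀ r j (G : ℕ → ℤ) →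
  iterGrow r (λ a d → G (a N.+ d) * [ d ≡ j ]ᵢ) a₀ d₀ ≡ G (suc r) * euler (λ k → [ d₀ ≡ k ]ᵢ) r j
iterGrow-desc {d₀ = d₀} e zero    j G = cong (λ s → G s * [ d₀ ≡ j ]ᵢ) e
iterGrow-desc {a₀} {d₀} e (suc r) zero G = begin
  iterGrow (suc r) g a₀ d₀           ≡⟨ iterGrow-shift r g a₀ d₀ ⟩
  iterGrow r (grow g) a₀ d₀          ≡⟨ iterGrow-cong r vanish a₀ d₀ ⟩
  iterGrow r (λ _ _ → + 0) a₀ d₀     ≡⟨ iterGrow-0 r a₀ d₀ ⟩
  + 0  ≡⟨ ZP.*-zeroʳ (G (suc (suc r))) ⟨
  G (suc (suc r)) * + 0  ∎
  where
  open ≡-Reasoning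
  g : ℕ → ℕ → ℤ
  g a d = G (a N.+ d) * [ d ≡ 0 ]ᵢ
  vanish : ∀ a d → grow g a d ≡ + 0
  vanish a zero    = ring (+ a) (G (a N.+ 1)) (G (suc a N.+ 0) * + 1)
    where
    ring : ∀ a x y → a * (x * + 0) + + 0 * y ≡ + 0
    ring = solve-∀
  vanish a (suc d) = ring (+ a) (+ suc d) (G (a N.+ suc (suc d))) (G (suc a N.+ suc d))
    where
    ring : ∀ a d x y → a * (x * + 0) + d * (y * + 0) ≡ + 0
    ring = solve-∀
iterGrow-desc {a₀} {d₀} e (suc r) (suc j) G = begin
  iterGrow (suc r) g a₀ d₀           ≡⟨ iterGrow-shift r g a₀ d₀ ⟩
  iterGrow r (grow g) a₀ d₀          ≡⟨ iterGrow-cong r grow-g a₀ d₀ ⟩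
  iterGrow r (λ a d → (+ 1 + + j) * (G (suc (a N.+ d)) * [ d ≡ suc j ]ᵢ) + G′ (a N.+ d) * [ d ≡ j ]ᵢ) a₀ d₀
    ≡⟨ iterGrow-lin r (+ 1 + + j) (λ a d → G (suc (a N.+ d)) * [ d ≡ suc j ]ᵢ) (λ a d → G′ (a N.+ d) * [ d ≡ j ]ᵢ) a₀ d₀ ⟩
  (+ 1 + + j) * iterGrow r (λ a d → G (suc (a N.+ d)) * [ d ≡ suc j ]ᵢ) a₀ d₀ + iterGrow r (λ a d → G′ (a N.+ d) * [ d ≡ j ]ᵢ) a₀ d₀
    ≡⟨ cong₂ (λ x y → (+ 1 + + j) * x + y) (iterGrow-desc e r (suc j) (G ∘ suc)) (iterGrow-desc e r j G′) ⟩
  (+ 1 + + j) * (G (suc (suc r)) * x) + G (suc (suc r)) * (+ suc r - + j) * y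
    ≡⟨ ring (+ j) (+ r) (G (suc (suc r))) x y ⟩
  G (suc (suc r)) * ((+ 1 + + j) * x + (+ 1 + + r - + j) * y) ∎
  where
  open ≡-Reasoning
  g : ℕ → ℕ → ℤ
  g a d = G (a N.+ d) * [ d ≡ suc j ]ᵢ
  G′ : ℕ → ℤ
  G′ s = G (suc s) * (+ s - + j)
  x y : ℤ
  x = euler (λ k → [ d₀ ≡ k ]ᵢ) r (suc j)
  y = euler (λ k → [ d₀ ≡ k ]ᵢ) r j
  ring : ∀ j r g x y → (+ 1 + j) * (g * x) + g * (+ 1 + r - j) * y ≡ g * ((+ 1 + j) * x + (+ 1 + r - j) * y)
  ring = solve-∀
  grow-g : ∀ a d → grow g a d ≡ (+ 1 + + j) * (G (suc (a N.+ d)) * [ d ≡ suc j ]ᵢ) + G′ (a N.+ d) * [ d ≡ j ]ᵢ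
  grow-g a d = begin
    + a * (G (a N.+ suc d) * [ d ≡ j ]ᵢ) + + d * (G (suc (a N.+ d)) * [ d ≡ suc j ]ᵢ)
      ≡⟨ cong (λ k → + a * (G k * [ d ≡ j ]ᵢ) + + d * (G (suc (a N.+ d)) * [ d ≡ suc j ]ᵢ)) (NP.+-suc a d) ⟩
    + a * (h * [ d ≡ j ]ᵢ) + + d * (h * [ d ≡ suc j ]ᵢ)
      ≡⟨ ring₁ (+ a) (+ d) h [ d ≡ j ]ᵢ [ d ≡ suc j ]ᵢ ⟩
    h * (+ d * [ d ≡ suc j ]ᵢ) + h * ((+ a + + d) * [ d ≡ j ]ᵢ - + d * [ d ≡ j ]ᵢ)
      -- On the support of its indicator the factor d is the constant j + 1 or j.
      ≡⟨ cong₂ (λ p q → h * p + h * ((+ a + + d) * [ d ≡ j ]ᵢ - q)) (*-[≡] d (suc j) (λ k → + k)) (*-[≡] d j (λ k → + k)) ⟩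
    h * (+ suc j * [ d ≡ suc j ]ᵢ) + h * ((+ a + + d) * [ d ≡ j ]ᵢ - + j * [ d ≡ j ]ᵢ)
      ≡⟨ ring₂ (+ a + + d) (+ j) h [ d ≡ j ]ᵢ [ d ≡ suc j ]ᵢ ⟩
    (+ 1 + + j) * (h * [ d ≡ suc j ]ᵢ) + h * (+ (a N.+ d) - + j) * [ d ≡ j ]ᵢ ∎
    where
    h : ℤ
    h = G (suc (a N.+ d))
    ring₁ : ∀ a d h e f → a * (h * e) + d * (h * f) ≡ h * (d * f) + h * ((a + d) * e - d * e)
    ring₁ = solve-∀
    ring₂ : ∀ s j h e f → h * ((+ 1 + j) * f) + h * (s * e - j * e) ≡ (+ 1 + j) * (h * f) + h * (s - j) * e
    ring₂ = solve-∀

iterGrow-swap : ∀ r g a d → iterGrow r (λ a d → g d a) a d ≡ iterGrow r g d a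
iterGrow-swap zero    g a d = refl
iterGrow-swap (suc r) g a d = ≡.trans (cong₂ (λ x y → + a * x + + d * y) (iterGrow-swap r g a (suc d)) (iterGrow-swap r g (suc a) d))
  (ZP.+-comm (+ a * iterGrow r g (suc d) a) (+ d * iterGrow r g d (suc a)))

oddᵇ-double : ∀ a → oddᵇ (a N.+ a) ≡ false
oddᵇ-double zero    = refl
oddᵇ-double (suc a) rewrite NP.+-suc a a = oddᵇ-double a

≡ᵇ-refl : ∀ n → (n N.≡ᵇ n) ≡ true
≡ᵇ-refl zero    = refl
≡ᵇ-refl (suc n) = ≡ᵇ-refl n

≢⇒≡ᵇ-false : ∀ {m n} → m ≢ n → (m N.≡ᵇ n) ≡ false
≢⇒≡ᵇ-false {m} {n} m≢n with m N.≡ᵇ n in eq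
... | true  = ⊥-elim (m≢n (NP.≡ᵇ⇒≡ m n (subst T (sym eq) tt)))
... | false = refl

<⇒<ᵇ-true : ∀ {m n} → m N.< n → (m N.<ᵇ n) ≡ true
<⇒<ᵇ-true {m} {n} m<n with m N.<ᵇ n in eq
... | true  = refl
... | false = ⊥-elim (subst T eq (NP.<⇒<ᵇ m<n))

≮⇒<ᵇ-false : ∀ {m n} → n N.≤ m → (m N.<ᵇ n) ≡ false
≮⇒<ᵇ-false {m} {n} n≤m with m N.<ᵇ n in eq
... | true  = ⊥-elim (NP.<⇒≱ (NP.<ᵇ⇒< m n (subst T (sym eq) tt)) n≤m)
... | false = refl

-- For odd a + d, the minimum of a and d is j iff one of them is j and 2 j < a + d.
majority : ℕ → ℕ → ℤ
majority j s = ind (oddᵇ s ∧ (j N.+ j N.<ᵇ s))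

cycleWeight-split-< : ∀ j a d → a N.< d →
  ind (oddᵇ (a N.+ d) ∧ (a N.≡ᵇ j)) ≡ + 1 * (majority j (a N.+ d) * [ d ≡ j ]ᵢ) + majority j (a N.+ d) * [ a ≡ j ]ᵢ
cycleWeight-split-< j a d a<d with a N.≟ j | d N.≟ j
... | yes refl | yes refl = ⊥-elim (NP.<-irrefl refl a<d)
... | yes refl | no d≢a
  rewrite ≡ᵇ-refl a | ≢⇒≡ᵇ-false d≢a | <⇒<ᵇ-true (NP.+-monoʳ-< a a<d) | ∧-identityʳ (oddᵇ (a N.+ d)) = ring (ind (oddᵇ (a N.+ d)))
  where
  ring : ∀ x → x ≡ + 1 * (x * + 0) + x * + 1
  ring = solve-∀
... | no a≢d | yes refl
  rewrite ≢⇒≡ᵇ-false a≢d | ≮⇒<ᵇ-false (NP.+-monoˡ-≤ d (NP.<⇒≤ a<d)) | ∧-zeroʳ (oddᵇ (a N.+ d)) = ring [ d ≡ d ]ᵢ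
  where
  ring : ∀ x → + 0 ≡ + 1 * (+ 0 * x) + + 0 * + 0
  ring = solve-∀
... | no a≢j | no d≢j
  rewrite ≢⇒≡ᵇ-false a≢j | ≢⇒≡ᵇ-false d≢j | ∧-zeroʳ (oddᵇ (a N.+ d)) = ring (majority j (a N.+ d))
  where
  ring : ∀ x → + 0 ≡ + 1 * (x * + 0) + x * + 0
  ring = solve-∀

cycleWeight-split : ∀ j a d → cycleWeight j a d ≡
  + 1 * (majority j (a N.+ d) * [ d ≡ j ]ᵢ) + majority j (d N.+ a) * [ a ≡ j ]ᵢ
cycleWeight-split j a d with NP.<-cmp a d
... | tri< a<d _ _ rewrite NP.m≤n⇒m⊓n≡m (NP.<⇒≤ a<d) | NP.+-comm d a = cycleWeight-split-< j a d a<d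
... | tri≈ _ refl _ rewrite oddᵇ-double a = ring [ a ≡ j ]ᵢ
  where
  ring : ∀ x → + 0 ≡ + 1 * (+ 0 * x) + + 0 * x
  ring = solve-∀
... | tri> _ _ d<a rewrite NP.m≥n⇒m⊓n≡n (NP.<⇒≤ d<a) | NP.+-comm a d =
  ≡.trans (cycleWeight-split-< j d a d<a) (ring (majority j (d N.+ a) * [ a ≡ j ]ᵢ) (majority j (d N.+ a) * [ d ≡ j ]ᵢ))
  where
  ring : ∀ x y → + 1 * x + y ≡ + 1 * y + x
  ring = solve-∀

-- The two rows start from the fixed point, which has no descent and one ascent: `euler₀` counts
-- cycles by descents, `euler₁` by ascents.
euler₀ euler₁ : ℕ → ℕ → ℤ
euler₀ = euler (λ k → [ 0 ≡ k ]ᵢ)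
euler₁ = euler (λ k → [ 1 ≡ k ]ᵢ)

γ-euler : ∀ j r → γ j r ≡ majority j (suc r) * (euler₀ r j + euler₁ r j)
γ-euler j r = begin
  iterGrow r (cycleWeight j) 1 0
    ≡⟨ iterGrow-cong r (cycleWeight-split j) 1 0 ⟩
  iterGrow r (λ a d → + 1 * (majority j (a N.+ d) * [ d ≡ j ]ᵢ) + majority j (d N.+ a) * [ a ≡ j ]ᵢ) 1 0
    ≡⟨ iterGrow-lin r (+ 1) (λ a d → majority j (a N.+ d) * [ d ≡ j ]ᵢ) (λ a d → majority j (d N.+ a) * [ a ≡ j ]ᵢ) 1 0 ⟩
  + 1 * iterGrow r (λ a d → majority j (a N.+ d) * [ d ≡ j ]ᵢ) 1 0 + iterGrow r (λ a d → majority j (d N.+ a) * [ a ≡ j ]ᵢ) 1 0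
    ≡⟨ cong₂ (λ x y → + 1 * x + y) (iterGrow-desc refl r j (majority j))
        (≡.trans (iterGrow-swap r (λ a d → majority j (a N.+ d) * [ d ≡ j ]ᵢ) 1 0) (iterGrow-desc refl r j (majority j))) ⟩
  + 1 * (majority j (suc r) * euler₀ r j) + majority j (suc r) * euler₁ r j
    ≡⟨ ring (majority j (suc r)) (euler₀ r j) (euler₁ r j) ⟩
  majority j (suc r) * (euler₀ r j + euler₁ r j) ∎
  where
  open ≡-Reasoning
  ring : ∀ m x y → + 1 * (m * x) + m * y ≡ m * (x + y)
  ring = solve-∀

-- The initial rows differ, but one step takes both to the row 0, 1, 0, ... of the single cycle of
-- length 2, which has one ascent and one descent.
euler₁≡euler₀ : ∀ r j → euler₁ (suc r) j ≡ euler₀ (suc r) j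
euler₁≡euler₀ zero    zero                = refl
euler₁≡euler₀ zero    (suc zero)          = refl
euler₁≡euler₀ zero    (suc (suc zero))    = refl
euler₁≡euler₀ zero    (suc (suc (suc j))) = refl
euler₁≡euler₀ (suc r) zero    = refl
euler₁≡euler₀ (suc r) (suc j) = cong₂ (λ x y → (+ 1 + + j) * x + (+ 1 + + suc r - + j) * y) (euler₁≡euler₀ r (suc j)) (euler₁≡euler₀ r j)

euler₀-1 : ∀ r → euler₀ (suc r) 1 ≡ + 1
euler₀-1 zero    = refl
euler₀-1 (suc r) = ≡.trans (cong (λ x → + 1 * x + (+ 2 + + r - + 0) * + 0) (euler₀-1 r)) (ring (+ r))
  where
  ring : ∀ r → + 1 * + 1 + (+ 2 + r - + 0) * + 0 ≡ + 1
  ring = solve-∀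

euler₀-2 : ∀ r → euler₀ (suc r) 2 ≡ + 2 * (+ 2) ^ r - + r - + 2
euler₀-2 zero    = refl
euler₀-2 (suc r) = ≡.trans (cong₂ (λ x y → + 2 * x + (+ 2 + + r - + 1) * y) (euler₀-2 r) (euler₀-1 r)) (ring (+ r) ((+ 2) ^ r))
  where
  ring : ∀ r a → + 2 * (+ 2 * a - r - + 2) + (+ 2 + r - + 1) * + 1 ≡ + 2 * (+ 2 * a) - (+ 1 + r) - + 2
  ring = solve-∀

euler₀-3 : ∀ r → + 2 * euler₀ (suc r) 3 ≡ + 6 * (+ 3) ^ r - + 4 * (+ r + + 2) * (+ 2) ^ r + (+ r + + 1) * (+ r + + 2)
euler₀-3 zero    = refl
euler₀-3 (suc r) = begin
  + 2 * (+ 3 * euler₀ (suc r) 3 + (+ 2 + + r - + 2) * euler₀ (suc r) 2)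
    ≡⟨ distribute (+ r) (euler₀ (suc r) 3) (euler₀ (suc r) 2) ⟩
  + 3 * (+ 2 * euler₀ (suc r) 3) + + 2 * + r * euler₀ (suc r) 2
    ≡⟨ cong₂ (λ x y → + 3 * x + + 2 * + r * y) (euler₀-3 r) (euler₀-2 r) ⟩
  _ ≡⟨ ring (+ r) ((+ 2) ^ r) ((+ 3) ^ r) ⟩
  _ ∎
  where
  open ≡-Reasoning
  distribute : ∀ r x y → + 2 * (+ 3 * x + (+ 2 + r - + 2) * y) ≡ + 3 * (+ 2 * x) + + 2 * r * y
  distribute = solve-∀
  ring : ∀ r a t → + 3 * (+ 6 * t - + 4 * (r + + 2) * a + (r + + 1) * (r + + 2)) + + 2 * r * (+ 2 * a - r - + 2)
    ≡ + 6 * (+ 3 * t) - + 4 * (+ 1 + r + + 2) * (+ 2 * a) + (+ 1 + r + + 1) * (+ 1 + r + + 2)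
  ring = solve-∀

-- Solving the differential equation

module StreamReasoning = SetoidReasoning (CommutativeRing.setoid streamRing)

⊕-cong : ∀ {f f′ g g′} → f ≈ f′ → g ≈ g′ → f ⊕ g ≈ f′ ⊕ g′
⊕-cong p q n = cong₂ _+_ (p n) (q n)

≈-refl : ∀ {f} → f ≈ f
≈-refl _ = refl

tail-const-⋆ : ∀ c f → tail (const c ⋆ f) ≈ const c ⋆ tail f
tail-const-⋆ c f n = ≡.trans (const-⋆ c f (suc n)) (sym (const-⋆ c (tail f) n))

u v X : Stream
u = expo (+ 1)
v = expo (- + 1)
X = δ 1

tail-u : tail u ≈ u
tail-u n = ZP.*-identityˡ (u n)

-- A cycle of length at least 2 has both an ascent and a descent, so only the fixed point has M = 0.
-- This reduces the homogeneous part of each equation to y′ = y.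
γ-0 : γ 0 ≈ const (+ 1)
γ-0 zero    = refl
γ-0 (suc r) = ≡.trans (γ-euler 0 (suc r)) (ZP.*-zeroʳ (majority 0 (suc (suc r))))

P-tail′ : ∀ j r → convolve γ P j ≈ γ 0 ⋆ P j ⊕ r → tail (P j) ≈ P j ⊕ r
P-tail′ j r e = begin
  tail (P j)  ≈⟨ P-tail j ⟩
  convolve γ P j  ≈⟨ e ⟩
  γ 0 ⋆ P j ⊕ r  ≈⟨ ⊕-cong {g = r} (⋆-cong {g = P j} γ-0 ≈-refl) ≈-refl ⟩
  const (+ 1) ⋆ P j ⊕ r      ≈⟨ solve 2 (λ p r → con (+ 1) :* p :+ r := p :+ r) ≈-refl (P j) r ⟩
  P j ⊕ r  ∎
  where open StreamReasoning

P-0 : P 0 ≈ u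
P-0 zero    = refl
P-0 (suc n) = begin
  P 0 (suc n)  ≡⟨ P-tail 0 n ⟩
  (γ 0 ⋆ P 0) n  ≡⟨ ⋆-cong {g = P 0} γ-0 ≈-refl n ⟩
  (const (+ 1) ⋆ P 0) n       ≡⟨ const-⋆ (+ 1) (P 0) n ⟩
  + 1 * P 0 n  ≡⟨ cong (_*_ (+ 1)) (P-0 n) ⟩
  + 1 * u n  ∎
  where open ≡-Reasoning

-- The solution of P′ = (Σ γ_j t^j) P is u exp (Σ A_j t^j / j!), the sum over j ≥ 1.
module Exponential (A₁ A₂ A₃ : Stream) (A₁0 : A₁ 0 ≡ + 0) (A₂0 : A₂ 0 ≡ + 0) (A₃0 : A₃ 0 ≡ + 0)
  (A₁′ : tail A₁ ≈ γ 1) (A₂′ : tail A₂ ≈ const (+ 2) ⋆ γ 2) (A₃′ : tail A₃ ≈ const (+ 6) ⋆ γ 3) where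

  open StreamReasoning

  P-1 : P 1 ≈ u ⋆ A₁
  P-1 = ode-unique (P 1) (u ⋆ A₁) (γ 1 ⋆ u) (sym (cong (_*_ (+ 1)) A₁0))
    (P-tail′ 1 (γ 1 ⋆ u) (⊕-cong {f = γ 0 ⋆ P 1} ≈-refl (⋆-cong {f = γ 1} ≈-refl P-0)))
    (begin
      tail u ⋆ A₁ ⊕ u ⋆ tail A₁  ≈⟨ ⊕-cong (⋆-cong {g = A₁} tail-u ≈-refl) (⋆-cong {f = u} ≈-refl A₁′) ⟩
      u ⋆ A₁ ⊕ u ⋆ γ 1           ≈⟨ solve 3 (λ u a g → u :* a :+ u :* g := u :* a :+ g :* u) ≈-refl u A₁ (γ 1) ⟩
      u ⋆ A₁ ⊕ γ 1 ⋆ u           ∎)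

  2P-2 : const (+ 2) ⋆ P 2 ≈ u ⋆ (A₂ ⊕ A₁ ⋆ A₁)
  2P-2 = ode-unique (const (+ 2) ⋆ P 2) (u ⋆ (A₂ ⊕ A₁ ⋆ A₁)) (const (+ 2) ⋆ r) zeros
    (begin
      tail (const (+ 2) ⋆ P 2)          ≈⟨ tail-const-⋆ (+ 2) (P 2) ⟩
      const (+ 2) ⋆ tail (P 2)          ≈⟨ ⋆-cong {f = const (+ 2)} ≈-refl (P-tail′ 2 r
        (⊕-cong {f = γ 0 ⋆ P 2} ≈-refl (⊕-cong (⋆-cong {f = γ 1} ≈-refl P-1) (⋆-cong {f = γ 2} ≈-refl P-0)))) ⟩
      const (+ 2) ⋆ (P 2 ⊕ r)           ≈⟨ ⋆-distribˡ (const (+ 2)) (P 2) r ⟩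
      const (+ 2) ⋆ P 2 ⊕ const (+ 2) ⋆ r ∎)
    (begin
      tail u ⋆ (A₂ ⊕ A₁ ⋆ A₁) ⊕ u ⋆ (tail A₂ ⊕ (tail A₁ ⋆ A₁ ⊕ A₁ ⋆ tail A₁))
        ≈⟨ ⊕-cong (⋆-cong {g = A₂ ⊕ A₁ ⋆ A₁} tail-u ≈-refl)
            (⋆-cong {f = u} ≈-refl (⊕-cong A₂′ (⊕-cong (⋆-cong {g = A₁} A₁′ ≈-refl) (⋆-cong {f = A₁} ≈-refl A₁′)))) ⟩
      u ⋆ (A₂ ⊕ A₁ ⋆ A₁) ⊕ u ⋆ (const (+ 2) ⋆ γ 2 ⊕ (γ 1 ⋆ A₁ ⊕ A₁ ⋆ γ 1))
        ≈⟨ solve 5 (λ u a₁ a₂ g₁ g₂ →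
             u :* (a₂ :+ a₁ :* a₁) :+ u :* (con (+ 2) :* g₂ :+ (g₁ :* a₁ :+ a₁ :* g₁)) :=
             u :* (a₂ :+ a₁ :* a₁) :+ con (+ 2) :* (g₁ :* (u :* a₁) :+ g₂ :* u)) ≈-refl u A₁ A₂ (γ 1) (γ 2) ⟩
      u ⋆ (A₂ ⊕ A₁ ⋆ A₁) ⊕ const (+ 2) ⋆ r ∎)
    where
    r : Stream
    r = γ 1 ⋆ (u ⋆ A₁) ⊕ γ 2 ⋆ u
    zeros : + 0 ≡ + 1 * (A₂ 0 + A₁ 0 * A₁ 0)
    zeros rewrite A₁0 | A₂0 = refl

  -- The bracket is 3! times the coefficient of t^3 in exp (A₁ t + A₂ t^2 / 2 + A₃ t^3 / 6). The
  -- proof compares differential equations, so the exponential series itself is never formed.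
  6P-3 : const (+ 6) ⋆ P 3 ≈ u ⋆ (A₃ ⊕ const (+ 3) ⋆ (A₁ ⋆ A₂) ⊕ A₁ ⋆ (A₁ ⋆ A₁))
  6P-3 = ode-unique (const (+ 6) ⋆ P 3) (u ⋆ S) r zeros
    (begin
      tail (const (+ 6) ⋆ P 3)          ≈⟨ tail-const-⋆ (+ 6) (P 3) ⟩
      const (+ 6) ⋆ tail (P 3)          ≈⟨ ⋆-cong {f = const (+ 6)} ≈-refl (P-tail′ 3 (γ 1 ⋆ P 2 ⊕ (γ 2 ⋆ (u ⋆ A₁) ⊕ γ 3 ⋆ u))
        (⊕-cong {f = γ 0 ⋆ P 3} ≈-refl (⊕-cong {f = γ 1 ⋆ P 2} ≈-refl (⊕-cong (⋆-cong {f = γ 2} ≈-refl P-1) (⋆-cong {f = γ 3} ≈-refl P-0))))) ⟩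
      const (+ 6) ⋆ (P 3 ⊕ (γ 1 ⋆ P 2 ⊕ (γ 2 ⋆ (u ⋆ A₁) ⊕ γ 3 ⋆ u)))
        -- Splitting 6 as 3 times 2 makes `2P-2` applicable without division.
        ≈⟨ solve 7 (λ u a₁ p₂ p₃ g₁ g₂ g₃ →
             con (+ 6) :* (p₃ :+ (g₁ :* p₂ :+ (g₂ :* (u :* a₁) :+ g₃ :* u))) :=
             con (+ 6) :* p₃ :+ (con (+ 3) :* g₁ :* (con (+ 2) :* p₂) :+ con (+ 6) :* (g₂ :* (u :* a₁) :+ g₃ :* u)))
             ≈-refl u A₁ (P 2) (P 3) (γ 1) (γ 2) (γ 3) ⟩
      const (+ 6) ⋆ P 3 ⊕ (const (+ 3) ⋆ γ 1 ⋆ (const (+ 2) ⋆ P 2) ⊕ const (+ 6) ⋆ (γ 2 ⋆ (u ⋆ A₁) ⊕ γ 3 ⋆ u))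
        ≈⟨ ⊕-cong {f = const (+ 6) ⋆ P 3} ≈-refl (⊕-cong {g = const (+ 6) ⋆ (γ 2 ⋆ (u ⋆ A₁) ⊕ γ 3 ⋆ u)}
            (⋆-cong {f = const (+ 3) ⋆ γ 1} ≈-refl 2P-2) ≈-refl) ⟩
      const (+ 6) ⋆ P 3 ⊕ r ∎)
    (begin
      tail u ⋆ S ⊕ u ⋆ (tail A₃ ⊕ tail (const (+ 3) ⋆ (A₁ ⋆ A₂)) ⊕ (tail A₁ ⋆ (A₁ ⋆ A₁) ⊕ A₁ ⋆ (tail A₁ ⋆ A₁ ⊕ A₁ ⋆ tail A₁)))
        ≈⟨ ⊕-cong (⋆-cong {g = S} tail-u ≈-refl) (⋆-cong {f = u} ≈-refl (⊕-cong
            (⊕-cong A₃′ (λ n → ≡.trans (tail-const-⋆ (+ 3) (A₁ ⋆ A₂) n)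
              (⋆-cong {f = const (+ 3)} ≈-refl (⊕-cong (⋆-cong {g = A₂} A₁′ ≈-refl) (⋆-cong {f = A₁} ≈-refl A₂′)) n)))
            (⊕-cong (⋆-cong {g = A₁ ⋆ A₁} A₁′ ≈-refl)
              (⋆-cong {f = A₁} ≈-refl (⊕-cong (⋆-cong {g = A₁} A₁′ ≈-refl) (⋆-cong {f = A₁} ≈-refl A₁′)))))) ⟩
      u ⋆ S ⊕ u ⋆ (const (+ 6) ⋆ γ 3 ⊕ const (+ 3) ⋆ (γ 1 ⋆ A₂ ⊕ A₁ ⋆ (const (+ 2) ⋆ γ 2)) ⊕ (γ 1 ⋆ (A₁ ⋆ A₁) ⊕ A₁ ⋆ (γ 1 ⋆ A₁ ⊕ A₁ ⋆ γ 1)))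
        ≈⟨ solve 7 (λ u a₁ a₂ s g₁ g₂ g₃ →
             u :* s :+ u :* (con (+ 6) :* g₃ :+ con (+ 3) :* (g₁ :* a₂ :+ a₁ :* (con (+ 2) :* g₂)) :+ (g₁ :* (a₁ :* a₁) :+ a₁ :* (g₁ :* a₁ :+ a₁ :* g₁))) :=
             u :* s :+ (con (+ 3) :* g₁ :* (u :* (a₂ :+ a₁ :* a₁)) :+ con (+ 6) :* (g₂ :* (u :* a₁) :+ g₃ :* u)))
             ≈-refl u A₁ A₂ S (γ 1) (γ 2) (γ 3) ⟩
      u ⋆ S ⊕ r ∎)
    where
    S r : Stream
    S = A₃ ⊕ const (+ 3) ⋆ (A₁ ⋆ A₂) ⊕ A₁ ⋆ (A₁ ⋆ A₁)
    r = const (+ 3) ⋆ γ 1 ⋆ (u ⋆ (A₂ ⊕ A₁ ⋆ A₁)) ⊕ const (+ 6) ⋆ (γ 2 ⋆ (u ⋆ A₁) ⊕ γ 3 ⋆ u)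
    zeros : + 0 ≡ + 1 * (A₃ 0 + + 3 * (A₁ 0 * A₂ 0) + A₁ 0 * (A₁ 0 * A₁ 0))
    zeros rewrite A₁0 | A₃0 = refl

-- Antiderivatives of γ and the coefficient of t^3

neg-^ : ∀ c n → (- c) ^ n ≡ (- + 1) ^ n * c ^ n
neg-^ c zero    = refl
neg-^ c (suc n) = ≡.trans (cong (_*_ (- c)) (neg-^ c n)) (ring c ((- + 1) ^ n) (c ^ n))
  where
  ring : ∀ c s x → - c * (s * x) ≡ - + 1 * s * (c * x)
  ring = solve-∀

-- The factor 1 + (-1)^q arises from pairing `u` with `v`; it is the parity condition on the cycle
-- length.
2·odd : ∀ q → + 2 * ind (oddᵇ (suc q)) ≡ + 1 + (- + 1) ^ q
2·odd zero          = refl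
2·odd (suc zero)    = refl
2·odd (suc (suc q)) = ≡.trans (2·odd q) (ring ((- + 1) ^ q))
  where
  ring : ∀ s → + 1 + s ≡ + 1 + - + 1 * (- + 1 * s)
  ring = solve-∀

u^2 : u ⋆ u ≈ expo (+ 2)
u^2 = expo-⋆ (+ 1) (+ 1)

u^3 : u ⋆ u ⋆ u ≈ expo (+ 3)
u^3 n = ≡.trans (⋆-cong {g = u} u^2 ≈-refl n) (expo-⋆ (+ 2) (+ 1) n)

u^4 : u ⋆ u ⋆ u ⋆ u ≈ expo (+ 4)
u^4 n = ≡.trans (⋆-cong {g = u} u^3 ≈-refl n) (expo-⋆ (+ 3) (+ 1) n)

v^2 : v ⋆ v ≈ expo (- + 2)
v^2 = expo-⋆ (- + 1) (- + 1)

v^3 : v ⋆ v ⋆ v ≈ expo (- + 3)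
v^3 n = ≡.trans (⋆-cong {g = v} v^2 ≈-refl n) (expo-⋆ (- + 2) (- + 1) n)

uv : u ⋆ v ≈ const (+ 1)
uv n = ≡.trans (expo-⋆ (+ 1) (- + 1) n) (expo-0 n)
  where
  expo-0 : expo (+ 0) ≈ const (+ 1)
  expo-0 zero    = refl
  expo-0 (suc n) = refl

γ-suc : ∀ j r → γ j (suc r) ≡ majority j (2 N.+ r) * (euler₀ (suc r) j + euler₀ (suc r) j)
γ-suc j r = ≡.trans (γ-euler j (suc r)) (cong (λ x → majority j (2 N.+ r) * (euler₀ (suc r) j + x)) (euler₁≡euler₀ r j))

-- A_j / j! is the antiderivative of γ_j, read off the closed forms of the Eulerian numbers.
A₁ A₂ A₃ : Stream
A₁ = u ⊖ v ⊖ const (+ 2) ⋆ X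
A₂ = u ⋆ u ⊖ v ⋆ v ⊖ const (+ 2) ⋆ (X ⋆ (u ⊕ v)) ⊖ const (+ 4) ⋆ δ 3
A₃ = const (+ 2) ⋆ (u ⋆ u ⋆ u ⊖ v ⋆ v ⋆ v) ⊖ const (+ 6) ⋆ (X ⋆ (u ⋆ u ⊕ v ⋆ v)) ⊕ const (+ 3) ⋆ (X ⋆ (X ⋆ (u ⊖ v)))
  ⊖ const (+ 132) ⋆ δ 5

u≡1 : ∀ n → u n ≡ + 1
u≡1 = ZP.^-zeroˡ

-- `u ⊖ v` alone would give 2 in degree 0 of the derivative, but there the cycle is a fixed point,
-- with M = 0; subtracting twice `X` corrects this.
tail-A₁ : tail A₁ ≈ γ 1
tail-A₁ zero          = refl
tail-A₁ (suc zero)    = refl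
tail-A₁ (suc (suc q)) = begin
  u (3 N.+ q) - v (3 N.+ q) - (const (+ 2) ⋆ X) (3 N.+ q)
    ≡⟨ cong₂ (λ x y → x - v (3 N.+ q) - y) (u≡1 (3 N.+ q)) (const-⋆ (+ 2) X (3 N.+ q)) ⟩
  + 1 - v (3 N.+ q) - + 0  ≡⟨ ring₁ (v q) ⟩
  + 1 + v q  ≡⟨ 2·odd q ⟨
  + 2 * ind (oddᵇ (suc q))  ≡⟨ ring₂ (ind (oddᵇ (suc q))) ⟩
  ind (oddᵇ (suc q)) * (+ 1 + + 1)  ≡⟨ cong (λ b → ind b * (+ 1 + + 1)) (∧-identityʳ (oddᵇ (suc q))) ⟨
  majority 1 (3 N.+ q) * (+ 1 + + 1)  ≡⟨ cong (λ x → majority 1 (3 N.+ q) * (x + x)) (euler₀-1 (suc q)) ⟨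
  majority 1 (3 N.+ q) * (euler₀ (2 N.+ q) 1 + euler₀ (2 N.+ q) 1) ≡⟨ γ-suc 1 (suc q) ⟨
  γ 1 (2 N.+ q)  ∎
  where
  open ≡-Reasoning
  ring₁ : ∀ s → + 1 - - + 1 * (- + 1 * (- + 1 * s)) - + 0 ≡ + 1 + s
  ring₁ = solve-∀
  ring₂ : ∀ x → + 2 * x ≡ x * (+ 1 + + 1)
  ring₂ = solve-∀

-- The term 4 `δ 3` removes the 3-cycle with two descents and the one with two ascents, both with M
-- = 1, doubled like γ 2. From degree 4 on the length exceeds 2 * 2, so only its parity is left in
-- `majority`.
tail-A₂ : tail A₂ ≈ const (+ 2) ⋆ γ 2
tail-A₂ 0 = refl
tail-A₂ 1 = refl
tail-A₂ 2 = refl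
tail-A₂ 3 = refl
tail-A₂ (suc (suc (suc (suc q)))) = begin
  (u ⋆ u) (5 N.+ q) - (v ⋆ v) (5 N.+ q) - (const (+ 2) ⋆ (X ⋆ (u ⊕ v))) (5 N.+ q) - (const (+ 4) ⋆ δ 3) (5 N.+ q)
    ≡⟨ cong₂ _-_ (cong₂ _-_ (cong₂ _-_ (u^2 (5 N.+ q)) (≡.trans (v^2 (5 N.+ q)) (neg-^ (+ 2) (5 N.+ q))))
        (≡.trans (const-⋆ (+ 2) (X ⋆ (u ⊕ v)) (5 N.+ q)) (cong (_*_ (+ 2)) (≡.trans (X⋆-suc (u ⊕ v) (4 N.+ q))
          (cong (λ x → + (5 N.+ q) * (x + v (4 N.+ q))) (u≡1 (4 N.+ q)))))))
        (const-⋆ (+ 4) (δ 3) (5 N.+ q)) ⟩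
  _ ≡⟨ ring₁ (+ q) (v q) ((+ 2) ^ q) ⟩
  (+ 1 + v q) * (+ 2 * w)  ≡⟨ cong (_* (+ 2 * w)) (2·odd q) ⟨
  + 2 * ind (oddᵇ (suc q)) * (+ 2 * w)  ≡⟨ ring₂ (ind (oddᵇ (suc q))) w ⟩
  + 2 * (ind (oddᵇ (suc q)) * (w + w))  ≡⟨ cong (λ b → + 2 * (ind b * (w + w))) (∧-identityʳ (oddᵇ (suc q))) ⟨
  + 2 * (majority 2 (5 N.+ q) * (w + w))  ≡⟨ cong (λ x → + 2 * (majority 2 (5 N.+ q) * (x + x))) (euler₀-2 (3 N.+ q)) ⟨
  + 2 * (majority 2 (5 N.+ q) * (euler₀ (4 N.+ q) 2 + euler₀ (4 N.+ q) 2)) ≡⟨ cong (_*_ (+ 2)) (γ-suc 2 (3 N.+ q)) ⟨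
  + 2 * γ 2 (4 N.+ q)  ≡⟨ const-⋆ (+ 2) (γ 2) (4 N.+ q) ⟨
  (const (+ 2) ⋆ γ 2) (4 N.+ q)  ∎
  where
  open ≡-Reasoning
  w : ℤ
  w = + 2 * (+ 2) ^ (3 N.+ q) - + (3 N.+ q) - + 2
  ring₁ : ∀ i s a → + 2 * (+ 2 * (+ 2 * (+ 2 * (+ 2 * a))))
    - - + 1 * (- + 1 * (- + 1 * (- + 1 * (- + 1 * s)))) * (+ 2 * (+ 2 * (+ 2 * (+ 2 * (+ 2 * a)))))
    - + 2 * ((+ 5 + i) * (+ 1 + - + 1 * (- + 1 * (- + 1 * (- + 1 * s))))) - + 0
    ≡ (+ 1 + s) * (+ 2 * (+ 2 * (+ 2 * (+ 2 * (+ 2 * a))) - (+ 3 + i) - + 2))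
  ring₁ = solve-∀
  ring₂ : ∀ e w → + 2 * e * (+ 2 * w) ≡ + 2 * (e * (w + w))
  ring₂ = solve-∀

-- The term 132 `δ 5` acts in degree 4, that is on cycles of length 5, where three descents or three
-- ascents mean M = 2. From degree 6 on the length exceeds 2 * 3; the smaller degrees are settled by
-- evaluation.
tail-A₃ : tail A₃ ≈ const (+ 6) ⋆ γ 3
tail-A₃ 0 = refl
tail-A₃ 1 = refl
tail-A₃ 2 = refl
tail-A₃ 3 = refl
tail-A₃ 4 = refl
tail-A₃ 5 = refl
tail-A₃ (suc (suc (suc (suc (suc (suc q)))))) = begin
  (const (+ 2) ⋆ (u ⋆ u ⋆ u ⊖ v ⋆ v ⋆ v)) n - (const (+ 6) ⋆ (X ⋆ (u ⋆ u ⊕ v ⋆ v))) n + (const (+ 3) ⋆ (X ⋆ (X ⋆ (u ⊖ v)))) n - (const (+ 132) ⋆ δ 5) n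
    ≡⟨ cong₂ _-_ (cong₂ _+_ (cong₂ _-_
        (≡.trans (const-⋆ (+ 2) (u ⋆ u ⋆ u ⊖ v ⋆ v ⋆ v) n) (cong (_*_ (+ 2)) (cong₂ _-_ (u^3 n) (≡.trans (v^3 n) (neg-^ (+ 3) n)))))
        (≡.trans (const-⋆ (+ 6) (X ⋆ (u ⋆ u ⊕ v ⋆ v)) n) (cong (_*_ (+ 6)) (≡.trans (X⋆-suc (u ⋆ u ⊕ v ⋆ v) (6 N.+ q))
          (cong (_*_ (+ n)) (cong₂ _+_ (u^2 (6 N.+ q)) (≡.trans (v^2 (6 N.+ q)) (neg-^ (+ 2) (6 N.+ q)))))))))
        (≡.trans (const-⋆ (+ 3) (X ⋆ (X ⋆ (u ⊖ v))) n) (cong (_*_ (+ 3)) (≡.trans (X⋆-suc (X ⋆ (u ⊖ v)) (6 N.+ q))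
          (cong (_*_ (+ n)) (≡.trans (X⋆-suc (u ⊖ v) (5 N.+ q)) (cong (λ x → + (6 N.+ q) * (x - v (5 N.+ q))) (u≡1 (5 N.+ q)))))))))
        (const-⋆ (+ 132) (δ 5) n) ⟩
  _ ≡⟨ ring₁ (+ q) (v q) ((+ 2) ^ q) ((+ 3) ^ q) ⟩
  (+ 1 + v q) * (+ 3 * w)  ≡⟨ cong₂ (λ x y → x * (+ 3 * y)) (2·odd q) (euler₀-3 (5 N.+ q)) ⟨
  + 2 * ind (oddᵇ (suc q)) * (+ 3 * (+ 2 * e))  ≡⟨ ring₂ (ind (oddᵇ (suc q))) e ⟩
  + 6 * (ind (oddᵇ (suc q)) * (e + e))  ≡⟨ cong (λ b → + 6 * (ind b * (e + e))) (∧-identityʳ (oddᵇ (suc q))) ⟨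
  + 6 * (majority 3 (7 N.+ q) * (e + e))  ≡⟨ cong (_*_ (+ 6)) (γ-suc 3 (5 N.+ q)) ⟨
  + 6 * γ 3 (6 N.+ q)  ≡⟨ const-⋆ (+ 6) (γ 3) (6 N.+ q) ⟨
  (const (+ 6) ⋆ γ 3) (6 N.+ q)  ∎
  where
  open ≡-Reasoning
  n : ℕ
  n = 7 N.+ q
  e w : ℤ
  e = euler₀ (6 N.+ q) 3
  w = + 6 * (+ 3) ^ (5 N.+ q) - + 4 * (+ (5 N.+ q) + + 2) * (+ 2) ^ (5 N.+ q) + (+ (5 N.+ q) + + 1) * (+ (5 N.+ q) + + 2)
  ring₁ : ∀ i s a t →
    + 2 * (+ 3 * (+ 3 * (+ 3 * (+ 3 * (+ 3 * (+ 3 * (+ 3 * t))))))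
      - - + 1 * (- + 1 * (- + 1 * (- + 1 * (- + 1 * (- + 1 * (- + 1 * s)))))) * (+ 3 * (+ 3 * (+ 3 * (+ 3 * (+ 3 * (+ 3 * (+ 3 * t))))))))
    - + 6 * ((+ 7 + i) * (+ 2 * (+ 2 * (+ 2 * (+ 2 * (+ 2 * (+ 2 * a)))))
      + - + 1 * (- + 1 * (- + 1 * (- + 1 * (- + 1 * (- + 1 * s))))) * (+ 2 * (+ 2 * (+ 2 * (+ 2 * (+ 2 * (+ 2 * a))))))))
    + + 3 * ((+ 7 + i) * ((+ 6 + i) * (+ 1 - - + 1 * (- + 1 * (- + 1 * (- + 1 * (- + 1 * s)))))))
    - + 0
    ≡ (+ 1 + s) * (+ 3 * (+ 6 * (+ 3 * (+ 3 * (+ 3 * (+ 3 * (+ 3 * t))))) - + 4 * (+ 5 + i + + 2) * (+ 2 * (+ 2 * (+ 2 * (+ 2 * (+ 2 * a)))))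
      + (+ 5 + i + + 1) * (+ 5 + i + + 2)))
  ring₁ = solve-∀
  ring₂ : ∀ e w → + 2 * e * (+ 3 * (+ 2 * w)) ≡ + 6 * (e * (w + w))
  ring₂ = solve-∀

open Exponential A₁ A₂ A₃ refl refl refl tail-A₁ tail-A₂ tail-A₃

-- The correction in `A₂` occurs multiplied by `A₁`. As a power of `X` it merges with the other
-- terms, whose coefficients follow from `X⋆-suc`.
6δ-3 : const (+ 6) ⋆ δ 3 ≈ X ⋆ (X ⋆ X)
6δ-3 n = sym (begin
  (X ⋆ (X ⋆ X)) n  ≡⟨ ⋆-cong {f = X} ≈-refl (λ k → ≡.trans (X⋆δ 1 k) (sym (const-⋆ (+ 2) (δ 2) k))) n ⟩
  (X ⋆ (const (+ 2) ⋆ δ 2)) n     ≡⟨ solve 2 (λ x d → x :* (con (+ 2) :* d) := con (+ 2) :* (x :* d)) ≈-refl X (δ 2) n ⟩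
  (const (+ 2) ⋆ (X ⋆ δ 2)) n     ≡⟨ const-⋆ (+ 2) (X ⋆ δ 2) n ⟩
  + 2 * (X ⋆ δ 2) n  ≡⟨ cong (_*_ (+ 2)) (X⋆δ 2 n) ⟩
  + 2 * (+ 3 * δ 3 n)  ≡⟨ ring (δ 3 n) ⟩
  + 6 * δ 3 n  ≡⟨ const-⋆ (+ 6) (δ 3) n ⟨
  (const (+ 6) ⋆ δ 3) n           ∎)
  where
  open ≡-Reasoning
  ring : ∀ x → + 2 * (+ 3 * x) ≡ + 6 * x
  ring = solve-∀

-- In the bracket of `6P-3` all terms with v^2 or v^3 cancel identically. Every remaining v occurs
-- once and is absorbed by the factor u in front, by u v = 1.
6P-3-expanded : const (+ 6) ⋆ P 3 ≈
  const (+ 6) ⋆ (u ⋆ u ⋆ u ⋆ u) ⊖ const (+ 24) ⋆ (X ⋆ (u ⋆ u ⋆ u)) ⊕ const (+ 27) ⋆ (X ⋆ (X ⋆ (u ⋆ u)))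
  ⊖ const (+ 8) ⋆ (X ⋆ (X ⋆ (X ⋆ u))) ⊖ const (+ 132) ⋆ (δ 5 ⋆ u)
  ⊕ const (+ 4) ⋆ (X ⋆ (X ⋆ (X ⋆ (X ⋆ u)))) ⊖ const (+ 2) ⋆ (X ⋆ (X ⋆ (X ⋆ (u ⋆ u)))) ⊕ const (+ 2) ⋆ (X ⋆ (X ⋆ X))
  ⊖ const (+ 6) ⋆ (u ⋆ u) ⊕ const (+ 12) ⋆ (X ⋆ u) ⊖ const (+ 3) ⋆ (X ⋆ X)
6P-3-expanded = begin
  const (+ 6) ⋆ P 3  ≈⟨ 6P-3 ⟩
  u ⋆ (A₃ ⊕ const (+ 3) ⋆ (A₁ ⋆ A₂) ⊕ A₁ ⋆ (A₁ ⋆ A₁))  ≈⟨ collect ⟩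
  R ⊕ const (+ 6) ⋆ δ 3 ⋆ (const (+ 2) ⋆ (const (+ 2) ⋆ (X ⋆ u) ⊖ u ⋆ u ⊕ u ⋆ v)) ⊕ u ⋆ v ⋆ K
    ≈⟨ ⊕-cong (⊕-cong {f = R} ≈-refl (⋆-cong 6δ-3 (⋆-cong {f = const (+ 2)} ≈-refl
         (⊕-cong {f = const (+ 2) ⋆ (X ⋆ u) ⊖ u ⋆ u} ≈-refl uv)))) (⋆-cong {g = K} uv ≈-refl) ⟩
  R ⊕ X ⋆ (X ⋆ X) ⋆ (const (+ 2) ⋆ (const (+ 2) ⋆ (X ⋆ u) ⊖ u ⋆ u ⊕ const (+ 1))) ⊕ const (+ 1) ⋆ K
    ≈⟨ rearrange ⟩
  _ ∎
  where
  open StreamReasoning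
  R K : Stream
  R = const (+ 6) ⋆ (u ⋆ u ⋆ u ⋆ u) ⊖ const (+ 24) ⋆ (X ⋆ (u ⋆ u ⋆ u)) ⊕ const (+ 27) ⋆ (X ⋆ (X ⋆ (u ⋆ u)))
    ⊖ const (+ 8) ⋆ (X ⋆ (X ⋆ (X ⋆ u))) ⊖ const (+ 132) ⋆ (δ 5 ⋆ u)
  K = const (+ 12) ⋆ (X ⋆ u) ⊖ const (+ 6) ⋆ (u ⋆ u) ⊖ const (+ 3) ⋆ (X ⋆ X)
  collect : u ⋆ (A₃ ⊕ const (+ 3) ⋆ (A₁ ⋆ A₂) ⊕ A₁ ⋆ (A₁ ⋆ A₁)) ≈
    R ⊕ const (+ 6) ⋆ δ 3 ⋆ (const (+ 2) ⋆ (const (+ 2) ⋆ (X ⋆ u) ⊖ u ⋆ u ⊕ u ⋆ v)) ⊕ u ⋆ v ⋆ K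
  collect = solve 5 (λ u v x d₃ d₅ →
    let a₁ = u :- v :- con (+ 2) :* x
        a₂ = u :* u :- v :* v :- con (+ 2) :* (x :* (u :+ v)) :- con (+ 4) :* d₃
        a₃ = con (+ 2) :* (u :* u :* u :- v :* v :* v) :- con (+ 6) :* (x :* (u :* u :+ v :* v)) :+ con (+ 3) :* (x :* (x :* (u :- v)))
             :- con (+ 132) :* d₅
        r  = con (+ 6) :* (u :* u :* u :* u) :- con (+ 24) :* (x :* (u :* u :* u)) :+ con (+ 27) :* (x :* (x :* (u :* u)))
             :- con (+ 8) :* (x :* (x :* (x :* u))) :- con (+ 132) :* (d₅ :* u)
        k  = con (+ 12) :* (x :* u) :- con (+ 6) :* (u :* u) :- con (+ 3) :* (x :* x)
    in u :* (a₃ :+ con (+ 3) :* (a₁ :* a₂) :+ a₁ :* (a₁ :* a₁)) :=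
       r :+ con (+ 6) :* d₃ :* (con (+ 2) :* (con (+ 2) :* (x :* u) :- u :* u :+ u :* v)) :+ u :* v :* k)
    ≈-refl u v X (δ 3) (δ 5)
  rearrange : R ⊕ X ⋆ (X ⋆ X) ⋆ (const (+ 2) ⋆ (const (+ 2) ⋆ (X ⋆ u) ⊖ u ⋆ u ⊕ const (+ 1))) ⊕ const (+ 1) ⋆ K ≈ _
  rearrange = solve 3 (λ r u x →
    r :+ x :* (x :* x) :* (con (+ 2) :* (con (+ 2) :* (x :* u) :- u :* u :+ con (+ 1))) :+
      con (+ 1) :* (con (+ 12) :* (x :* u) :- con (+ 6) :* (u :* u) :- con (+ 3) :* (x :* x)) :=
    r :+ con (+ 4) :* (x :* (x :* (x :* (x :* u)))) :- con (+ 2) :* (x :* (x :* (x :* (u :* u)))) :+ con (+ 2) :* (x :* (x :* x))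
      :- con (+ 6) :* (u :* u) :+ con (+ 12) :* (x :* u) :- con (+ 3) :* (x :* x))
    ≈-refl R u X

-- For n ≥ 4 the pure powers X^2 and X^3 contribute nothing; this is where the bound 4 enters on the
-- side of `p`.
6P-3-value : ∀ m → + 6 * P 3 (4 N.+ m) ≡
  + 6 * (+ 4) ^ (4 N.+ m) - + 24 * ((+ 4 + + m) * (+ 3) ^ (3 N.+ m)) + + 27 * ((+ 4 + + m) * ((+ 3 + + m) * (+ 2) ^ (2 N.+ m)))
  - + 8 * ((+ 4 + + m) * ((+ 3 + + m) * (+ 2 + + m))) - + 132 * + ((4 N.+ m) C 5)
  + + 4 * ((+ 4 + + m) * ((+ 3 + + m) * ((+ 2 + + m) * (+ 1 + + m)))) - + 2 * ((+ 4 + + m) * ((+ 3 + + m) * ((+ 2 + + m) * (+ 2) ^ (1 N.+ m))))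
  - + 6 * (+ 2) ^ (4 N.+ m) + + 12 * (+ 4 + + m)
6P-3-value m = begin
  + 6 * P 3 n  ≡⟨ const-⋆ (+ 6) (P 3) n ⟨
  (const (+ 6) ⋆ P 3) n  ≡⟨ 6P-3-expanded n ⟩
  _ ≡⟨ cong₂ _-_ (cong₂ _+_ (cong₂ _-_ (cong₂ _+_ (cong₂ _-_ (cong₂ _+_ (cong₂ _-_ (cong₂ _-_ (cong₂ _+_ (cong₂ _-_
        (scaled (+ 6) (u ⋆ u ⋆ u ⋆ u) (u^4 n))
        (scaled (+ 24) (X ⋆ (u ⋆ u ⋆ u)) (X⋆ (3 N.+ m) (u ⋆ u ⋆ u) (u^3 (3 N.+ m)))))
        (scaled (+ 27) (X ⋆ (X ⋆ (u ⋆ u))) (X⋆ (3 N.+ m) (X ⋆ (u ⋆ u)) (X⋆ (2 N.+ m) (u ⋆ u) (u^2 (2 N.+ m))))))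
        (scaled (+ 8) (X ⋆ (X ⋆ (X ⋆ u))) (X⋆ (3 N.+ m) (X ⋆ (X ⋆ u)) (X⋆ (2 N.+ m) (X ⋆ u) (X⋆ (1 N.+ m) u (u≡1 (1 N.+ m)))))))
        (scaled (+ 132) (δ 5 ⋆ u) (δ⋆expo1 5 n)))
        (scaled (+ 4) (X ⋆ (X ⋆ (X ⋆ (X ⋆ u)))) (X⋆ (3 N.+ m) (X ⋆ (X ⋆ (X ⋆ u))) (X⋆ (2 N.+ m) (X ⋆ (X ⋆ u)) (X⋆ (1 N.+ m) (X ⋆ u) (X⋆ m u (u≡1 m)))))))
        (scaled (+ 2) (X ⋆ (X ⋆ (X ⋆ (u ⋆ u)))) (X⋆ (3 N.+ m) (X ⋆ (X ⋆ (u ⋆ u))) (X⋆ (2 N.+ m) (X ⋆ (u ⋆ u)) (X⋆ (1 N.+ m) (u ⋆ u) (u^2 (1 N.+ m)))))))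
        (scaled (+ 2) (X ⋆ (X ⋆ X)) (X⋆ (3 N.+ m) (X ⋆ X) (X⋆-suc X (2 N.+ m)))))
        (scaled (+ 6) (u ⋆ u) (u^2 n)))
        (scaled (+ 12) (X ⋆ u) (X⋆ (3 N.+ m) u (u≡1 (3 N.+ m)))))
        (scaled (+ 3) (X ⋆ X) (X⋆-suc X (3 N.+ m))) ⟩
  _ ≡⟨ ring (+ m) ((+ 2) ^ m) ((+ 3) ^ m) ((+ 4) ^ m) (+ (n C 5)) ⟩
  _ ∎
  where
  open ≡-Reasoning
  n : ℕ
  n = 4 N.+ m
  scaled : ∀ c f {x} → f n ≡ x → (const c ⋆ f) n ≡ c * x
  scaled c f e = ≡.trans (const-⋆ c f n) (cong (_*_ c) e)
  X⋆ : ∀ k f {x} → f k ≡ x → (X ⋆ f) (suc k) ≡ + suc k * x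
  X⋆ k f e = ≡.trans (X⋆-suc f k) (cong (_*_ (+ suc k)) e)
  ring : ∀ i a t f c → + 6 * (+ 4 * (+ 4 * (+ 4 * (+ 4 * f)))) - + 24 * ((+ 4 + i) * (+ 3 * (+ 3 * (+ 3 * t)))) + + 27 * ((+ 4 + i) * ((+ 3 + i) * (+ 2 * (+ 2 * a))))
    - + 8 * ((+ 4 + i) * ((+ 3 + i) * ((+ 2 + i) * + 1))) - + 132 * c
    + + 4 * ((+ 4 + i) * ((+ 3 + i) * ((+ 2 + i) * ((+ 1 + i) * + 1)))) - + 2 * ((+ 4 + i) * ((+ 3 + i) * ((+ 2 + i) * (+ 2 * a))))
    + + 2 * ((+ 4 + i) * ((+ 3 + i) * + 0)) - + 6 * (+ 2 * (+ 2 * (+ 2 * (+ 2 * a)))) + + 12 * ((+ 4 + i) * + 1) - + 3 * ((+ 4 + i) * + 0)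
    ≡ + 6 * (+ 4 * (+ 4 * (+ 4 * (+ 4 * f)))) - + 24 * ((+ 4 + i) * (+ 3 * (+ 3 * (+ 3 * t)))) + + 27 * ((+ 4 + i) * ((+ 3 + i) * (+ 2 * (+ 2 * a))))
    - + 8 * ((+ 4 + i) * ((+ 3 + i) * (+ 2 + i))) - + 132 * c
    + + 4 * ((+ 4 + i) * ((+ 3 + i) * ((+ 2 + i) * (+ 1 + i)))) - + 2 * ((+ 4 + i) * ((+ 3 + i) * ((+ 2 + i) * (+ 2 * a))))
    - + 6 * (+ 2 * (+ 2 * (+ 2 * (+ 2 * a)))) + + 12 * (+ 4 + i)
  ring = solve-∀

-- Cycle decompositions under insertion of the largest element

infix 8 _!_

-- Total lookup turns a word into a map on ℕ that can be iterated; the value 0 outside the word only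
-- serves totality.
_!_ : List ℕ → ℕ → ℕ
[]       ! i     = 0
(x ∷ xs) ! zero  = x
(x ∷ xs) ! suc i = xs ! i

∷ʳ-!-last : ∀ xs x → (xs ∷ʳ x) ! length xs ≡ x
∷ʳ-!-last []       x = refl
∷ʳ-!-last (y ∷ xs) x = ∷ʳ-!-last xs x

∷ʳ-!-init : ∀ xs x j → j N.< length xs → (xs ∷ʳ x) ! j ≡ xs ! j
∷ʳ-!-init (y ∷ xs) x zero    _ = refl
∷ʳ-!-init (y ∷ xs) x (suc j) h = ∷ʳ-!-init xs x j (N.s<s⁻¹ h)

length-graft : ∀ m l i → length (graft m l i) ≡ suc (length l)
length-graft m []       i       = refl
length-graft m (x ∷ xs) zero    = cong suc (≡.trans (LP.length-++ xs) (NP.+-comm (length xs) 1))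
length-graft m (x ∷ xs) (suc i) = cong suc (length-graft m xs i)

graft-!-at : ∀ m l i → i N.≤ length l → graft m l i ! i ≡ m
graft-!-at m []       zero    _ = refl
graft-!-at m (x ∷ xs) zero    _ = refl
graft-!-at m (x ∷ xs) (suc i) h = graft-!-at m xs i (N.s≤s⁻¹ h)

graft-!-last : ∀ m l i → i N.< length l → graft m l i ! length l ≡ l ! i
graft-!-last m (x ∷ xs) zero    _ = ∷ʳ-!-last xs x
graft-!-last m (x ∷ xs) (suc i) h = graft-!-last m xs i (N.s<s⁻¹ h)

graft-!-other : ∀ m l i j → j N.< length l → j ≢ i → graft m l i ! j ≡ l ! j
graft-!-other m (x ∷ xs) zero    zero    _ j≢i = contradiction refl j≢i
graft-!-other m (x ∷ xs) zero    (suc j) h j≢i = ∷ʳ-!-init xs x j (N.s<s⁻¹ h)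
graft-!-other m (x ∷ xs) (suc i) zero    h j≢i = refl
graft-!-other m (x ∷ xs) (suc i) (suc j) h j≢i = graft-!-other m xs i j (N.s<s⁻¹ h) (j≢i ∘ cong suc)

Path : (ℕ → ℕ) → ℕ → List ℕ → ℕ → Set
Path f x []       z = f x ≡ z
Path f x (y ∷ ys) z = f x ≡ y × Path f y ys z

-- A cycle is written from its least element, the one that `isLeader` selects. Inserted maxima never
-- come first, so this normal form is preserved.
IsCycle : (ℕ → ℕ) → List ℕ → Set
IsCycle f []       = ⊥
IsCycle f (x ∷ ys) = Path f x ys x × All (x N.≤_) ys

record Decomposition (n : ℕ) (l : List ℕ) (cs : List (List ℕ)) : Set where
  constructor decomposition
  field
    size   : length l ≡ n
    cover  : concat cs ↭ upTo n
    cycles : All (IsCycle (l !_)) cs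

-- Each result carries the element i behind which `m` is put, so that the matching one-line word is
-- `graft m l i`.
insCycle : ℕ → List ℕ → List (ℕ × List ℕ)
insCycle m []       = []
insCycle m (x ∷ ys) = (x , x ∷ m ∷ ys) ∷ map (λ (i , c) → i , x ∷ c) (insCycle m ys)

insCycles : ℕ → List (List ℕ) → List (ℕ × List (List ℕ))
insCycles m []       = (m , (m ∷ []) ∷ []) ∷ []
insCycles m (c ∷ cs) = map (λ (i , c′) → i , c′ ∷ cs) (insCycle m c) ++ map (λ (i , cs′) → i , c ∷ cs′) (insCycles m cs)

insCycle-positions : ∀ m c → map proj₁ (insCycle m c) ≡ c
insCycle-positions m []       = refl
insCycle-positions m (x ∷ ys) = cong (x ∷_) (≡.trans (sym (LP.map-∘ (insCycle m ys))) (insCycle-positions m ys))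

insCycles-positions : ∀ m cs → map proj₁ (insCycles m cs) ≡ concat cs ∷ʳ m
insCycles-positions m []       = refl
insCycles-positions m (c ∷ cs) = begin
  map proj₁ (map (λ (i , c′) → i , c′ ∷ cs) (insCycle m c) ++ map (λ (i , cs′) → i , c ∷ cs′) (insCycles m cs))
    ≡⟨ LP.map-++ proj₁ (map (λ (i , c′) → i , c′ ∷ cs) (insCycle m c)) _ ⟩
  map proj₁ (map (λ (i , c′) → i , c′ ∷ cs) (insCycle m c)) ++ map proj₁ (map (λ (i , cs′) → i , c ∷ cs′) (insCycles m cs))
    ≡⟨ cong₂ _++_ (≡.trans (sym (LP.map-∘ (insCycle m c))) (insCycle-positions m c))
                  (≡.trans (sym (LP.map-∘ (insCycles m cs))) (insCycles-positions m cs)) ⟩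
  c ++ (concat cs ++ m ∷ [])
    ≡⟨ LP.++-assoc c (concat cs) (m ∷ []) ⟨
  (c ++ concat cs) ++ m ∷ [] ∎
  where open ≡-Reasoning

insCycle-↭ : ∀ m c {i c′} → (i , c′) ∈ insCycle m c → c′ ↭ m ∷ c
insCycle-↭ m (x ∷ ys) (here refl) = swap x m ↭-refl
insCycle-↭ m (x ∷ ys) (there p) with ∈-map⁻ _ p
... | (i , c) , c∈ , refl = ↭-trans (prep x (insCycle-↭ m ys c∈)) (swap x m ↭-refl)

insCycles-↭ : ∀ m cs {i cs′} → (i , cs′) ∈ insCycles m cs → concat cs′ ↭ m ∷ concat cs
insCycles-↭ m []       (here refl) = ↭-refl
insCycles-↭ m (c ∷ cs) p with ∈-++⁻ (map (λ (i , c′) → i , c′ ∷ cs) (insCycle m c)) p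
... | inj₁ q with ∈-map⁻ _ q
...   | (i , c′) , c′∈ , refl = PermP.++⁺ʳ (concat cs) (insCycle-↭ m c c′∈)
insCycles-↭ m (c ∷ cs) p | inj₂ q with ∈-map⁻ _ q
... | (i , cs′) , cs′∈ , refl = ↭-trans (PermP.++⁺ˡ c (insCycles-↭ m cs cs′∈)) (PermP.shift m c (concat cs))

-- What grafting does to the map. The field `at-m` is restricted to i < m because i = m denotes the
-- new fixed point, for which `at-i` already gives the value.
record Redirected (f f′ : ℕ → ℕ) (i m : ℕ) : Set where
  constructor redirected
  field
    at-i  : f′ i ≡ m
    at-m  : i N.< m → f′ m ≡ f i
    other : ∀ {j} → j N.< m → j ≢ i → f′ j ≡ f j

path-other : ∀ {f f′ i m} → Redirected f f′ i m → ∀ x ys z →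
  All (N._< m) (x ∷ ys) → All (_≢ i) (x ∷ ys) → Path f x ys z → Path f′ x ys z
path-other r x []       z (x< ∷ _)  (x≢ ∷ _)  p       = ≡.trans (Redirected.other r x< x≢) p
path-other r x (y ∷ ys) z (x< ∷ bd) (x≢ ∷ ne) (e , p) = ≡.trans (Redirected.other r x< x≢) e , path-other r y ys z bd ne p

cycle-other : ∀ {f f′ i m} → Redirected f f′ i m → ∀ c → All (N._< m) c → All (_≢ i) c → IsCycle f c → IsCycle f′ c
cycle-other r (x ∷ ys) bd ne (p , mn) = path-other r x ys x bd ne p , mn

path-insCycle : ∀ {f f′ i m} → Redirected f f′ i m → ∀ x ys z {c′} → (i , c′) ∈ insCycle m (x ∷ ys) →
  All (N._< m) (x ∷ ys) → Unique (x ∷ ys) → Path f x ys z → ∃ λ ys′ → c′ ≡ x ∷ ys′ × Path f′ x ys′ z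
path-insCycle {f} {f′} {m = m} r x ys z (here refl) (x< ∷ bd) (x∉ ∷ u) p =
  _ , refl , Redirected.at-i r , jump ys bd x∉ p
  where
  jump : ∀ ys → All (N._< m) ys → All (x ≢_) ys → Path f x ys z → Path f′ m ys z
  jump []       bd       ne       p       = ≡.trans (Redirected.at-m r x<) p
  jump (y ∷ ys) bd       ne       (e , p) = ≡.trans (Redirected.at-m r x<) e , path-other r y ys z bd (All.map (_∘ sym) ne) p
path-insCycle {i = i} r x (y ∷ ys) z (there q) (x< ∷ bd) (x∉ ∷ u) (e , p) with ∈-map⁻ _ q
... | (j , c) , c∈ , refl with path-insCycle r y ys z c∈ bd u p
...   | ys′ , refl , p′ = _ , refl , ≡.trans (Redirected.other r x< x≢i) e , p′
  where
  x≢i : x ≢ i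
  x≢i = All.lookup x∉ (subst (i ∈_) (insCycle-positions _ (y ∷ ys)) (∈-map⁺ proj₁ c∈))

cycle-insCycle : ∀ {f f′ i m} → Redirected f f′ i m → ∀ c {c′} → (i , c′) ∈ insCycle m c →
  All (N._< m) c → Unique c → IsCycle f c → IsCycle f′ c′
cycle-insCycle {m = m} r (x ∷ ys) q bd@(x<m ∷ _) u (p , mn) with path-insCycle r x ys x q bd u p
... | ys′ , refl , p′ = p′ ,
  All.tail (PermP.All-resp-↭ (↭-sym (insCycle-↭ m (x ∷ ys) q)) (NP.<⇒≤ x<m ∷ NP.≤-refl ∷ mn))

Unique-++⁻ : ∀ {A : Set} (xs : List A) {ys} → Unique (xs ++ ys) → Unique xs × Unique ys × (∀ {x y} → x ∈ xs → y ∈ ys → x ≢ y)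
Unique-++⁻ []       u        = [] , u , λ ()
Unique-++⁻ (x ∷ xs) (x∉ ∷ u) with Unique-++⁻ xs u
... | ux , uy , ne = AllP.++⁻ˡ xs x∉ ∷ ux , uy , λ { (here refl) y∈ → All.lookup (AllP.++⁻ʳ xs x∉) y∈ ; (there x∈) y∈ → ne x∈ y∈ }

-- Since the cycles are disjoint, i lies in at most one of them; every other cycle avoids both i and
-- m and does not notice the redirection.
cycles-insCycles : ∀ {f f′ i m} → Redirected f f′ i m → ∀ cs {cs′} → (i , cs′) ∈ insCycles m cs →
  All (N._< m) (concat cs) → Unique (concat cs) → All (IsCycle f) cs → All (IsCycle f′) cs′
cycles-insCycles r [] (here refl) _ _ [] = (Redirected.at-i r , []) ∷ []
cycles-insCycles {f} {f′} {i} {m} r (c ∷ cs) q bd u (ic ∷ ics)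
  with Unique-++⁻ c u | AllP.++⁻ c bd | ∈-++⁻ (map (λ (i , c′) → i , c′ ∷ cs) (insCycle m c)) q
... | uc , ucs , ne | bc , bcs | inj₁ q₁ with ∈-map⁻ _ q₁
...   | (_ , c′) , c′∈ , refl = cycle-insCycle r c c′∈ bc uc ic ∷ others cs bcs i∉ ics
  where
  i∉ : All (_≢ i) (concat cs)
  i∉ = All.tabulate (λ y∈ → ne (subst (i ∈_) (insCycle-positions m c) (∈-map⁺ proj₁ c′∈)) y∈ ∘ sym)
  others : ∀ cs → All (N._< m) (concat cs) → All (_≢ i) (concat cs) → All (IsCycle f) cs → All (IsCycle f′) cs
  others []       bd nd []         = []
  others (c ∷ cs) bd nd (ic ∷ ics) =
    cycle-other r c (AllP.++⁻ˡ c bd) (AllP.++⁻ˡ c nd) ic ∷ others cs (AllP.++⁻ʳ c bd) (AllP.++⁻ʳ c nd) ics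
cycles-insCycles {i = i} {m} r (c ∷ cs) q bd u (ic ∷ ics) | uc , ucs , ne | bc , bcs | inj₂ q₂ with ∈-map⁻ _ q₂
... | (_ , cs′) , cs′∈ , refl = cycle-other r c bc i∉ ic ∷ cycles-insCycles r cs cs′∈ bcs ucs ics
  where
  i∈ : i ∈ concat cs ∷ʳ m
  i∈ = subst (i ∈_) (insCycles-positions m cs) (∈-map⁺ proj₁ cs′∈)
  i∉ : All (_≢ i) c
  i∉ with ∈-++⁻ (concat cs) i∈
  ... | inj₁ i∈cs         = All.tabulate (λ y∈ → ne y∈ i∈cs)
  ... | inj₂ (here refl)  = All.map NP.<⇒≢ bc

-- Words and cycle lists are built side by side, so a decomposition never has to be computed from a
-- word.
decomposed : ℕ → List (List ℕ × List (List ℕ))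
decomposed zero    = ([] , []) ∷ []
decomposed (suc n) = concatMap (λ (l , cs) → map (λ (i , cs′) → graft n l i , cs′) (insCycles n cs)) (decomposed n)

positions-↭ : ∀ {n l cs} → Decomposition n l cs → map proj₁ (insCycles n cs) ↭ upTo (suc n)
positions-↭ {n} {l} {cs} d = ↭-trans (↭-reflexive (insCycles-positions n cs))
  (↭-trans (PermP.++⁺ʳ (n ∷ []) (Decomposition.cover d)) (↭-reflexive (LP.upTo-∷ʳ n)))

upTo-bounded : ∀ n → All (N._< n) (upTo n)
upTo-bounded n = AllP.applyUpTo⁺₁ id n id

decomposition-step : ∀ {n l cs i cs′} → Decomposition n l cs → (i , cs′) ∈ insCycles n cs → Decomposition (suc n) (graft n l i) cs′
decomposition-step {n} {l} {cs} {i} {cs′} d@(decomposition size cover cycles) q = decomposition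
  (≡.trans (length-graft n l i) (cong suc size))
  (↭-trans (insCycles-↭ n cs q) (↭-trans (PermP.∷↭∷ʳ n (concat cs)) (↭-trans (PermP.++⁺ʳ (n ∷ []) cover) (↭-reflexive (LP.upTo-∷ʳ n)))))
  (cycles-insCycles redirect cs q (PermP.All-resp-↭ (↭-sym cover) (upTo-bounded n)) (Unique-resp-↭ (↭-sym cover) (UP.upTo⁺ n)) cycles)
  where
  i<1+n : i N.< suc n
  i<1+n = All.lookup (PermP.All-resp-↭ (↭-sym (positions-↭ d)) (upTo-bounded (suc n))) (∈-map⁺ proj₁ q)
  redirect : Redirected (l !_) (graft n l i !_) i n
  redirect = redirected
    (graft-!-at n l i (subst (i N.≤_) (sym size) (N.s≤s⁻¹ i<1+n)))
    (λ i<n → subst (λ k → graft n l i ! k ≡ l ! i) size (graft-!-last n l i (subst (i N.<_) (sym size) i<n)))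
    (λ {j} j<n → graft-!-other n l i j (subst (j N.<_) (sym size) j<n))

decomposed-sound : ∀ n {l cs} → (l , cs) ∈ decomposed n → Decomposition n l cs
decomposed-sound zero    (here refl) = decomposition refl ↭-refl []
decomposed-sound (suc n) q with find (∈-concatMap⁻ _ {xs = decomposed n} q)
... | (l , cs) , lcs∈ , q′ with ∈-map⁻ _ q′
...   | (i , cs′) , cs′∈ , refl = decomposition-step (decomposed-sound n lcs∈) cs′∈

concatMap-↭ : {A B : Set} (f g : A → List B) (xs : List A) → (∀ x → x ∈ xs → f x ↭ g x) → concatMap f xs ↭ concatMap g xs
concatMap-↭ f g []       h = ↭-refl
concatMap-↭ f g (x ∷ xs) h = PermP.++⁺ (h x (here refl)) (concatMap-↭ f g xs (λ y → h y ∘ there))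

concatMap⁺-↭ : {A B : Set} (f : A → List B) {xs ys : List A} → xs ↭ ys → concatMap f xs ↭ concatMap f ys
concatMap⁺-↭ f refl         = ↭-refl
concatMap⁺-↭ f (prep x r)   = PermP.++⁺ˡ (f x) (concatMap⁺-↭ f r)
concatMap⁺-↭ f (swap {xs} {ys} x y r) = ↭-trans (PermP.shifts (f x) (f y)) (PermP.++⁺ˡ (f y) (PermP.++⁺ˡ (f x) (concatMap⁺-↭ f r)))
concatMap⁺-↭ f (trans r s)  = ↭-trans (concatMap⁺-↭ f r) (concatMap⁺-↭ f s)

perms↭decomposed : ∀ n → perms n ↭ map proj₁ (decomposed n)
perms↭decomposed zero    = ↭-refl
perms↭decomposed (suc n) = ↭-trans (perms-graft n) (↭-trans (concatMap⁺-↭ grafts (perms↭decomposed n))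
  (↭-trans (↭-reflexive (LP.concatMap-map grafts proj₁ (decomposed n)))
    (↭-sym (↭-trans (↭-reflexive eq) (concatMap-↭ _ _ (decomposed n) same)))))
  where
  grafts : List ℕ → List (List ℕ)
  grafts l = map (graft n l) (upTo (suc n))
  next : List ℕ × List (List ℕ) → List (List ℕ × List (List ℕ))
  next (l , cs) = map (λ (i , cs′) → graft n l i , cs′) (insCycles n cs)
  eq : map proj₁ (concatMap next (decomposed n)) ≡ concatMap (map proj₁ ∘ next) (decomposed n)
  eq = LP.map-concatMap proj₁ next (decomposed n)
  same : ∀ x → x ∈ decomposed n → map proj₁ (next x) ↭ grafts (proj₁ x)
  same (l , cs) x∈ = ↭-trans (↭-reflexive (≡.trans (sym (LP.map-∘ (insCycles n cs))) (LP.map-∘ (insCycles n cs))))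
    (PermP.map⁺ (graft n l) (positions-↭ (decomposed-sound n x∈)))

-- Ascents and descents of cycles

bit : Bool → ℕ
bit b = if b then 1 else 0

pathCount : (ℕ → ℕ → Bool) → ℕ → List ℕ → ℕ → ℕ
pathCount q x []       z = bit (q x z)
pathCount q x (y ∷ ys) z = bit (q x y) N.+ pathCount q y ys z

-- The end point z is kept apart from the list, so that an induction can peel elements off the front
-- while the closing step of the cycle remains.
pathState : ℕ → List ℕ → ℕ × ℕ
pathState z []       = 0 , 0
pathState z (x ∷ ys) = pathCount N._≤ᵇ_ x ys z , pathCount (λ s t → t N.<ᵇ s) x ys z

cycleState : List ℕ → ℕ × ℕ
cycleState []         = 0 , 0
cycleState c@(x ∷ ys) = pathState x c

≤⇒≤ᵇ-true : ∀ {x y} → x N.≤ y → (x N.≤ᵇ y) ≡ true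
≤⇒≤ᵇ-true {x} {y} h with x N.≤ᵇ y in eq
... | true  = refl
... | false = ⊥-elim (subst T eq (NP.≤⇒≤ᵇ h))

>⇒≤ᵇ-false : ∀ {x y} → y N.< x → (x N.≤ᵇ y) ≡ false
>⇒≤ᵇ-false {x} {y} h with x N.≤ᵇ y in eq
... | true  = ⊥-elim (NP.<⇒≱ h (NP.≤ᵇ⇒≤ x y (subst T (sym eq) tt)))
... | false = refl

-- As m exceeds both ends of a step x, y, the steps x, m and m, y are an ascent and a descent.
-- Insertions further on leave the first step alone; it is passed to the induction as a shift of G.
∑-insCycle : ∀ (G : ℕ → ℕ → ℤ) m z x ys → z N.< m → All (N._< m) (x ∷ ys) →
  ∑ (λ (_ , c) → G (proj₁ (pathState z c)) (proj₂ (pathState z c))) (insCycle m (x ∷ ys)) ≡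
  grow G (proj₁ (pathState z (x ∷ ys))) (proj₂ (pathState z (x ∷ ys)))
∑-insCycle G m z x [] z<m (x<m ∷ []) with x N.≤? z
... | yes x≤z
  rewrite ≤⇒≤ᵇ-true (NP.<⇒≤ x<m) | >⇒≤ᵇ-false z<m | ≮⇒<ᵇ-false (NP.<⇒≤ x<m) | <⇒<ᵇ-true z<m
        | ≤⇒≤ᵇ-true x≤z | ≮⇒<ᵇ-false x≤z = ring (G 1 1) (G 2 0)
  where
  ring : ∀ g h → g + + 0 ≡ + 1 * g + + 0 * h
  ring = solve-∀
... | no x≰z
  rewrite ≤⇒≤ᵇ-true (NP.<⇒≤ x<m) | >⇒≤ᵇ-false z<m | ≮⇒<ᵇ-false (NP.<⇒≤ x<m) | <⇒<ᵇ-true z<m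
        | >⇒≤ᵇ-false (NP.≰⇒> x≰z) | <⇒<ᵇ-true (NP.≰⇒> x≰z) = ring (G 1 1) (G 0 2)
  where
  ring : ∀ g h → g + + 0 ≡ + 0 * h + + 1 * g
  ring = solve-∀
∑-insCycle G m z x (y ∷ ys) z<m (x<m ∷ bd@(y<m ∷ _)) = begin
  G (b₁ N.+ (b₂ N.+ a)) (b₃ N.+ (b₄ N.+ d)) + ∑ value (map (λ (i , c) → i , x ∷ c) (insCycle m (y ∷ ys)))
    ≡⟨ cong (_+_ (G (b₁ N.+ (b₂ N.+ a)) (b₃ N.+ (b₄ N.+ d)))) (begin
      ∑ value (map (λ (i , c) → i , x ∷ c) (insCycle m (y ∷ ys)))
        ≡⟨ ∑-map value (λ (i , c) → i , x ∷ c) (insCycle m (y ∷ ys)) ⟩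
      ∑ (λ (i , c) → value (i , x ∷ c)) (insCycle m (y ∷ ys))
        ≡⟨ ∑-cong (insCycle m (y ∷ ys)) (λ (i , c) → peel i c) ⟩
      ∑ (λ (_ , c) → G′ (proj₁ (pathState z c)) (proj₂ (pathState z c))) (insCycle m (y ∷ ys))
        ≡⟨ ∑-insCycle G′ m z y ys z<m bd ⟩
      grow G′ a d ∎) ⟩
  G (b₁ N.+ (b₂ N.+ a)) (b₃ N.+ (b₄ N.+ d)) + grow G′ a d
    ≡⟨ combine ⟩
  grow G (bit (x N.≤ᵇ y) N.+ a) (bit (y N.<ᵇ x) N.+ d) ∎
  where
  open ≡-Reasoning
  b₁ b₂ b₃ b₄ a d : ℕ
  b₁ = bit (x N.≤ᵇ m)
  b₂ = bit (m N.≤ᵇ y)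
  b₃ = bit (m N.<ᵇ x)
  b₄ = bit (y N.<ᵇ m)
  a  = pathCount N._≤ᵇ_ y ys z
  d  = pathCount (λ s t → t N.<ᵇ s) y ys z
  value : ℕ × List ℕ → ℤ
  value (_ , c) = G (proj₁ (pathState z c)) (proj₂ (pathState z c))
  G′ : ℕ → ℕ → ℤ
  G′ s t = G (bit (x N.≤ᵇ y) N.+ s) (bit (y N.<ᵇ x) N.+ t)
  peel : ∀ i c → (i , c) ∈ insCycle m (y ∷ ys) → value (i , x ∷ c) ≡ G′ (proj₁ (pathState z c)) (proj₂ (pathState z c))
  peel i c (here refl) = refl
  peel i c (there c∈) with ∈-map⁻ _ c∈
  ... | _ , _ , refl = refl
  combine : G (b₁ N.+ (b₂ N.+ a)) (b₃ N.+ (b₄ N.+ d)) + grow G′ a d ≡ grow G (bit (x N.≤ᵇ y) N.+ a) (bit (y N.<ᵇ x) N.+ d)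
  combine with x N.≤? y
  ... | yes x≤y
    rewrite ≤⇒≤ᵇ-true (NP.<⇒≤ x<m) | >⇒≤ᵇ-false y<m | ≮⇒<ᵇ-false (NP.<⇒≤ x<m) | <⇒<ᵇ-true y<m
          | ≤⇒≤ᵇ-true x≤y | ≮⇒<ᵇ-false x≤y = ring (+ a) (+ d) (G (suc a) (suc d)) (G (suc (suc a)) d)
    where
    ring : ∀ a d g h → g + (a * g + d * h) ≡ (+ 1 + a) * g + d * h
    ring = solve-∀
  ... | no x≰y
    rewrite ≤⇒≤ᵇ-true (NP.<⇒≤ x<m) | >⇒≤ᵇ-false y<m | ≮⇒<ᵇ-false (NP.<⇒≤ x<m) | <⇒<ᵇ-true y<m
          | >⇒≤ᵇ-false (NP.≰⇒> x≰y) | <⇒<ᵇ-true (NP.≰⇒> x≰y) = ring (+ a) (+ d) (G (suc a) (suc d)) (G a (suc (suc d)))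
    where
    ring : ∀ a d g h → g + (a * h + d * g) ≡ a * h + (+ 1 + d) * g
    ring = solve-∀

∑-insCycles : ∀ {f} (F : List (ℕ × ℕ) → ℤ) m cs → All (IsCycle f) cs → All (N._< m) (concat cs) →
  ∑ (λ (_ , cs′) → F (map cycleState cs′)) (insCycles m cs) ≡ growAll F (map cycleState cs)
∑-insCycles F m [] [] bd = ≡.trans (ZP.+-identityʳ _)
  -- The step from m to m counts as an ascent, so a new fixed point has state (1 , 0).
  (cong₂ (λ s t → F ((bit s , bit t) ∷ [])) (≤⇒≤ᵇ-true (NP.≤-refl {m})) (≮⇒<ᵇ-false (NP.≤-refl {m})))
∑-insCycles F m (c@(x ∷ ys) ∷ cs) (_ ∷ ics) bd = begin
  ∑ value (map (λ (i , c′) → i , c′ ∷ cs) (insCycle m c) ++ map (λ (i , cs′) → i , c ∷ cs′) (insCycles m cs))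
    ≡⟨ ∑-++ value (map (λ (i , c′) → i , c′ ∷ cs) (insCycle m c)) _ ⟩
  ∑ value (map (λ (i , c′) → i , c′ ∷ cs) (insCycle m c)) + ∑ value (map (λ (i , cs′) → i , c ∷ cs′) (insCycles m cs))
    ≡⟨ cong₂ _+_ (∑-map value (λ (i , c′) → i , c′ ∷ cs) (insCycle m c)) (∑-map value (λ (i , cs′) → i , c ∷ cs′) (insCycles m cs)) ⟩
  ∑ (λ (i , c′) → F (cycleState c′ ∷ s)) (insCycle m c) + ∑ (λ (i , cs′) → F (cycleState c ∷ map cycleState cs′)) (insCycles m cs)
    ≡⟨ cong₂ _+_
        (≡.trans (∑-cong (insCycle m c) (λ (i , c′) → same-head i c′))
          (∑-insCycle (λ a d → F ((a , d) ∷ s)) m x x ys (All.head (AllP.++⁻ˡ c bd)) (AllP.++⁻ˡ c bd)))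
        (∑-insCycles (F ∘ (cycleState c ∷_)) m cs ics (AllP.++⁻ʳ c bd)) ⟩
  grow (λ a d → F ((a , d) ∷ s)) (proj₁ (pathState x c)) (proj₂ (pathState x c)) + growAll (F ∘ (cycleState c ∷_)) s ∎
  where
  open ≡-Reasoning
  s : List (ℕ × ℕ)
  s = map cycleState cs
  value : ℕ × List (List ℕ) → ℤ
  value (_ , cs′) = F (map cycleState cs′)
  same-head : ∀ i c′ → (i , c′) ∈ insCycle m c → F (cycleState c′ ∷ s) ≡ F ((proj₁ (pathState x c′) , proj₂ (pathState x c′)) ∷ s)
  same-head i c′ (here refl) = refl
  same-head i c′ (there c∈) with ∈-map⁻ _ c∈
  ... | _ , _ , refl = refl

∑-decomposed : ∀ n (F : List (ℕ × ℕ) → ℤ) → ∑ (λ (_ , cs) → F (map cycleState cs)) (decomposed n) ≡ iterGrowAll n F []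
∑-decomposed zero    F = ZP.+-identityʳ _
∑-decomposed (suc n) F = begin
  ∑ value (concatMap next (decomposed n))  ≡⟨ ∑-concatMap value next (decomposed n) ⟩
  ∑ (λ x → ∑ value (next x)) (decomposed n)  ≡⟨ ∑-cong (decomposed n) (λ (l , cs) → peel l cs) ⟩
  ∑ (λ (_ , cs) → growAll F (map cycleState cs)) (decomposed n) ≡⟨ ∑-decomposed n (growAll F) ⟩
  iterGrowAll n (growAll F) []  ≡⟨ iterGrowAll-shift n F [] ⟨
  iterGrowAll (suc n) F []  ∎
  where
  open ≡-Reasoning
  value : List ℕ × List (List ℕ) → ℤ
  value (_ , cs) = F (map cycleState cs)
  next : List ℕ × List (List ℕ) → List (List ℕ × List (List ℕ))
  next (l , cs) = map (λ (i , cs′) → graft n l i , cs′) (insCycles n cs)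
  peel : ∀ l cs → (l , cs) ∈ decomposed n → ∑ value (next (l , cs)) ≡ growAll F (map cycleState cs)
  peel l cs lcs∈ with decomposed-sound n lcs∈
  ... | decomposition _ cover cycles = ≡.trans (∑-map value (λ (i , cs′) → graft n l i , cs′) (insCycles n cs))
    (∑-insCycles F n cs cycles (PermP.All-resp-↭ (↭-sym cover) (upTo-bounded n)))

allOdd : List (ℕ × ℕ) → Bool
allOdd []            = true
allOdd ((a , d) ∷ s) = oddᵇ (a N.+ d) ∧ allOdd s

totalM : List (ℕ × ℕ) → ℕ
totalM []            = 0
totalM ((a , d) ∷ s) = a N.⊓ d N.+ totalM s

-- The first factor is the power t^k, or 0 if `o` is false, and multiplication by it shifts
-- coefficients. The guard `k ≤ᵇ j` keeps the truncated difference harmless.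
convolveℤ-pick : ∀ o k (g : ℕ → ℤ) j →
  convolveℤ (λ i → ind (o ∧ (k N.≡ᵇ i))) g j ≡ (if o ∧ (k N.≤ᵇ j) then g (j N.∸ k) else + 0)
convolveℤ-pick = go
  where
  zeros : ∀ (h : ℕ → ℤ) → (∀ i → h i ≡ + 0) → ∀ g j → convolveℤ h g j ≡ + 0
  zeros h h0 g zero    = ≡.trans (cong (_* g 0) (h0 0)) refl
  zeros h h0 g (suc j) = cong₂ _+_ (≡.trans (cong (_* g (suc j)) (h0 0)) refl) (zeros (h ∘ suc) (h0 ∘ suc) g j)
  go : ∀ o k g j → convolveℤ (λ i → ind (o ∧ (k N.≡ᵇ i))) g j ≡ (if o ∧ (k N.≤ᵇ j) then g (j N.∸ k) else + 0)
  go false k       g j       = zeros _ (λ _ → refl) g j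
  go true  zero    g zero    = ZP.*-identityˡ (g 0)
  go true  zero    g (suc j) = ≡.trans (cong₂ _+_ (ZP.*-identityˡ (g (suc j))) (zeros _ (λ _ → refl) g j)) (ZP.+-identityʳ _)
  go true  (suc k) g zero    = refl
  go true  (suc k) g (suc j) = ≡.trans (ZP.+-identityˡ _) (≡.trans (go true k g j) (cong (λ b → if b then g (j N.∸ k) else + 0) (≤ᵇ-suc k j)))
    where
    ≤ᵇ-suc : ∀ k j → (k N.≤ᵇ j) ≡ (suc k N.≤ᵇ suc j)
    ≤ᵇ-suc zero    j = refl
    ≤ᵇ-suc (suc k) j = refl

weight≡ind : ∀ j s → weight j s ≡ ind (allOdd s ∧ (totalM s N.≡ᵇ j))
weight≡ind j []            = refl
weight≡ind j ((a , d) ∷ s) = ≡.trans (convolveℤ-pick (oddᵇ (a N.+ d)) (a N.⊓ d) (λ i → weight i s) j) (cases (oddᵇ (a N.+ d)))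
  where
  +-cancel-≡ᵇ : ∀ k t j → k N.≤ j → (t N.≡ᵇ j N.∸ k) ≡ (k N.+ t N.≡ᵇ j)
  +-cancel-≡ᵇ zero    t j       _ = refl
  +-cancel-≡ᵇ (suc k) t (suc j) h = +-cancel-≡ᵇ k t j (N.s≤s⁻¹ h)
  cases : ∀ o → (if o ∧ (a N.⊓ d N.≤ᵇ j) then weight (j N.∸ a N.⊓ d) s else + 0) ≡
    ind ((o ∧ allOdd s) ∧ (a N.⊓ d N.+ totalM s N.≡ᵇ j))
  cases false = refl
  cases true with a N.⊓ d N.≤? j
  ... | yes h rewrite ≤⇒≤ᵇ-true h = ≡.trans (weight≡ind (j N.∸ a N.⊓ d) s) (cong (λ b → ind (allOdd s ∧ b)) (+-cancel-≡ᵇ (a N.⊓ d) (totalM s) j h))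
  ... | no h rewrite >⇒≤ᵇ-false (NP.≰⇒> h) | ≢⇒≡ᵇ-false {a N.⊓ d N.+ totalM s} {j} (λ e → h (NP.m+n≤o⇒m≤o (a N.⊓ d) (NP.≤-reflexive e)))
    = sym (cong ind (∧-zeroʳ (allOdd s)))

-- Cycle statistics defined by iteration, computed from a decomposition

iterate : (ℕ → ℕ) → ℕ → ℕ → ℕ
iterate f zero    x = x
iterate f (suc k) x = f (iterate f k x)

iterate-suc : ∀ f k x → iterate f (suc k) x ≡ iterate f k (f x)
iterate-suc f zero    x = refl
iterate-suc f (suc k) x = cong f (iterate-suc f k x)

path-++⁻ : ∀ {f} x as y bs z → Path f x (as ++ y ∷ bs) z → Path f x as y × Path f y bs z
path-++⁻ x []       y bs z (e , q) = e , q
path-++⁻ x (a ∷ as) y bs z (e , q) = let q₁ , q₂ = path-++⁻ a as y bs z q in (e , q₁) , q₂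

path-++⁺ : ∀ {f} x as y bs z → Path f x as y → Path f y bs z → Path f x (as ++ y ∷ bs) z
path-++⁺ x []       y bs z e        q₂ = e , q₂
path-++⁺ x (a ∷ as) y bs z (e , q₁) q₂ = e , path-++⁺ a as y bs z q₁ q₂

path-end : ∀ {f} x ys z → Path f x ys z → iterate f (suc (length ys)) x ≡ z
path-end     x []       z e       = e
path-end {f} x (y ∷ ys) z (e , q) = ≡.trans (iterate-suc f (suc (length ys)) x) (≡.trans (cong (iterate f (suc (length ys))) e) (path-end y ys z q))

path-mid : ∀ {f} x ys z → Path f x ys z → ∀ j → j N.< length ys → iterate f (suc j) x ∈ ys
path-mid     x (y ∷ ys) z (e , q) zero    _ = here e
path-mid {f} x (y ∷ ys) z (e , q) (suc j) h = there (subst (_∈ ys)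
  (sym (≡.trans (iterate-suc f (suc j) x) (cong (iterate f (suc j)) e))) (path-mid y ys z q j (N.s<s⁻¹ h)))

-- Cutting the closed path at y and exchanging the two pieces makes it start at y. It is needed
-- because `cycLen` is evaluated at every element, not only at the first of a cycle.
path-rotate : ∀ {f} x ys → Path f x ys x → ∀ {y} → y ∈ x ∷ ys → ∃ λ zs → Path f y zs y × y ∷ zs ↭ x ∷ ys
path-rotate x ys q (here refl) = ys , q , ↭-refl
path-rotate x ys q (there y∈) with ∈-∃++ y∈
... | as , bs , refl with path-++⁻ x as _ bs x q
...   | q₁ , q₂ = bs ++ x ∷ as , path-++⁺ _ bs x as _ q₂ q₁ ,
  ↭-trans (PermP.++-comm (_ ∷ bs) (x ∷ as)) ↭-refl

path-closed : ∀ {f} x ys → Path f x ys x → ∀ {y} → y ∈ x ∷ ys → f y ∈ x ∷ ys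
path-closed {f} x ys q {y} y∈ with path-rotate x ys q y∈
... | zs , q′ , r = PermP.∈-resp-↭ r (next zs q′)
  where
  next : ∀ zs → Path f y zs y → f y ∈ y ∷ zs
  next []       e       = here e
  next (z ∷ zs) (e , _) = there (here e)

path-iterate : ∀ {f} x ys → Path f x ys x → ∀ j → iterate f j x ∈ x ∷ ys
path-iterate x ys q zero    = here refl
path-iterate x ys q (suc j) = path-closed x ys q (path-iterate x ys q j)

toℕ-lookup : ∀ {n k} (v : Vec (Fin n) k) i → toℕ (V.lookup v i) ≡ toℕs v ! toℕ i
toℕ-lookup (x ∷ v) F.zero    = refl
toℕ-lookup (x ∷ v) (F.suc i) = toℕ-lookup v i

countUpTo : (ℕ → Bool) → ℕ → ℕ
countUpTo r zero    = 0
countUpTo r (suc m) = bit (r 0) N.+ countUpTo (r ∘ suc) m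

length-filter-applyUpTo : ∀ (r : ℕ → Bool) h m → length (filter (T? ∘ r) (applyUpTo h m)) ≡ countUpTo (r ∘ h) m
length-filter-applyUpTo r h zero    = refl
length-filter-applyUpTo r h (suc m) with r (h 0)
... | true  = cong suc (length-filter-applyUpTo r (h ∘ suc) m)
... | false = length-filter-applyUpTo r (h ∘ suc) m

countUpTo-cong : ∀ {r s : ℕ → Bool} → (∀ j → r j ≡ s j) → ∀ m → countUpTo r m ≡ countUpTo s m
countUpTo-cong e zero    = refl
countUpTo-cong e (suc m) = cong₂ (λ b k → bit b N.+ k) (e 0) (countUpTo-cong (e ∘ suc) m)

countUpTo-path : ∀ {f} (q : ℕ → ℕ → Bool) x ys z → Path f x ys z →
  countUpTo (λ j → q (iterate f j x) (iterate f (suc j) x)) (suc (length ys)) ≡ pathCount q x ys z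
countUpTo-path q x []       z refl       = NP.+-identityʳ _
countUpTo-path {f} q x (y ∷ ys) z (refl , p′) = cong (bit (q x (f x)) N.+_)
  (≡.trans (countUpTo-cong (λ j → cong₂ q (iterate-suc f j x) (iterate-suc f (suc j) x)) (suc (length ys))) (countUpTo-path q (f x) ys z p′))

all-applyUpTo-true : ∀ (r : ℕ → Bool) h m → (∀ j → r (h j) ≡ true) → all r (applyUpTo h m) ≡ true
all-applyUpTo-true r h zero    e = refl
all-applyUpTo-true r h (suc m) e = cong₂ _∧_ (e 0) (all-applyUpTo-true r (h ∘ suc) m (e ∘ suc))

all-applyUpTo-false : ∀ (r : ℕ → Bool) h m j → j N.< m → r (h j) ≡ false → all r (applyUpTo h m) ≡ false
all-applyUpTo-false r h (suc m) zero    _ e = cong (_∧ all r (applyUpTo (h ∘ suc) m)) e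
all-applyUpTo-false r h (suc m) (suc j) l e =
  ≡.trans (cong (r (h 0) ∧_) (all-applyUpTo-false r (h ∘ suc) m j (N.s<s⁻¹ l) e)) (∧-zeroʳ (r (h 0)))

module Statistics {n} (v : Vec (Fin n) n) where

  f : ℕ → ℕ
  f = oneLine v !_

  toℕ-iter : ∀ k i → toℕ (iter v k i) ≡ iterate f k (toℕ i)
  toℕ-iter zero    i = refl
  toℕ-iter (suc k) i = ≡.trans (toℕ-lookup v (iter v k i)) (cong f (toℕ-iter k i))

  -- The position t of the first return lies inside the searched range, so the default value is not
  -- reached. The enumeration h is kept general because each step of the search replaces it by
  -- `h ∘ suc`.
  cycLenAux-first : ∀ i dflt h m t → t N.< m →
    (∀ s → s N.< t → iterate f (suc (h s)) (toℕ i) ≢ toℕ i) → iterate f (suc (h t)) (toℕ i) ≡ toℕ i →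
    cycLenAux v i dflt (applyUpTo h m) ≡ suc (h t)
  cycLenAux-first i dflt h (suc m) zero    _   miss hit
    rewrite toℕ-iter (suc (h 0)) i | hit | ≡ᵇ-refl (toℕ i) = refl
  cycLenAux-first i dflt h (suc m) (suc t) t<m miss hit
    rewrite toℕ-iter (suc (h 0)) i | ≢⇒≡ᵇ-false (miss 0 N.z<s) =
      cycLenAux-first i dflt (h ∘ suc) m t (N.s<s⁻¹ t<m) (λ s s<t → miss (suc s) (N.s<s s<t)) hit

  cycLen-path : ∀ i ys → Path f (toℕ i) ys (toℕ i) → All (toℕ i ≢_) ys → suc (length ys) N.≤ n → cycLen v i ≡ suc (length ys)
  cycLen-path i ys q i∉ len = cycLenAux-first i n id n (length ys) len
    (λ s s<t e → All.lookup i∉ (path-mid (toℕ i) ys (toℕ i) q s s<t) (sym e)) (path-end (toℕ i) ys (toℕ i) q)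

  cycLen-member : ∀ i x ys → Path f x ys x → Unique (x ∷ ys) → suc (length ys) N.≤ n → toℕ i ∈ x ∷ ys → cycLen v i ≡ suc (length ys)
  cycLen-member i x ys q u len i∈ with path-rotate x ys q i∈
  ... | zs , q′ , r with Unique-resp-↭ (↭-sym r) u
  ...   | i∉ ∷ _ = ≡.trans (cycLen-path i zs q′ i∉ (subst (N._≤ n) (sym (PermP.↭-length r)) len)) (PermP.↭-length r)

  count-path : ∀ (q : ℕ → ℕ → Bool) i ys → Path f (toℕ i) ys (toℕ i) →
    length (filter (λ j → T? (q (toℕ (iter v j i)) (toℕ (iter v (suc j) i)))) (upTo (suc (length ys)))) ≡ pathCount q (toℕ i) ys (toℕ i)
  count-path q i ys π = ≡.trans (length-filter-applyUpTo (λ j → q (toℕ (iter v j i)) (toℕ (iter v (suc j) i))) id (suc (length ys)))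
    (≡.trans (countUpTo-cong (λ j → cong₂ q (toℕ-iter j i) (toℕ-iter (suc j) i)) (suc (length ys))) (countUpTo-path q (toℕ i) ys (toℕ i) π))

  cA-path : ∀ i ys → Path f (toℕ i) ys (toℕ i) → cycLen v i ≡ suc (length ys) → cA v i ≡ pathCount N._≤ᵇ_ (toℕ i) ys (toℕ i)
  cA-path i ys q len rewrite len = count-path N._≤ᵇ_ i ys q

  cD-path : ∀ i ys → Path f (toℕ i) ys (toℕ i) → cycLen v i ≡ suc (length ys) → cD v i ≡ pathCount (λ s t → t N.<ᵇ s) (toℕ i) ys (toℕ i)
  cD-path i ys q len rewrite len = count-path (λ s t → t N.<ᵇ s) i ys q

  isLeader-true : ∀ i ys → Path f (toℕ i) ys (toℕ i) → All (toℕ i N.≤_) ys → isLeader v i ≡ true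
  isLeader-true i ys q mn = all-applyUpTo-true _ id n λ j → ≤⇒≤ᵇ-true (subst (toℕ i N.≤_) (sym (toℕ-iter j i))
    (All.lookup (NP.≤-refl ∷ mn) (path-iterate (toℕ i) ys q j)))

  -- Following the cycle from i to its end leads back to the smaller element x. This takes fewer
  -- than n steps, as `isLeader` inspects only the iterates below n.
  isLeader-false : ∀ i x ys → Path f x ys x → All (x N.≤_) ys → Unique (x ∷ ys) → suc (length ys) N.≤ n → toℕ i ∈ ys → isLeader v i ≡ false
  isLeader-false i x ys q mn (x∉ ∷ _) len i∈ with ∈-∃++ i∈
  ... | as , bs , refl with path-++⁻ x as (toℕ i) bs x q
  ...   | _ , q₂ = all-applyUpTo-false _ id n (suc (length bs)) short
    (>⇒≤ᵇ-false (subst (N._< toℕ i) (sym (≡.trans (toℕ-iter (suc (length bs)) i) (path-end (toℕ i) bs x q₂)))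
      (NP.≤∧≢⇒< (All.lookup mn i∈) (All.lookup x∉ i∈))))
    where
    open NP.≤-Reasoning
    short : suc (length bs) N.< n
    short = begin-strict
      suc (length bs)                          ≤⟨ NP.m≤n+m (suc (length bs)) (length as) ⟩
      length as N.+ suc (length bs)  ≡⟨ LP.length-++ as ⟨
      length (as ++ toℕ i ∷ bs)                <⟨ NP.n<1+n _ ⟩
      suc (length (as ++ toℕ i ∷ bs))          ≤⟨ len ⟩
      n  ∎

-- Functions on `Fin n` are moved to ℕ, so that a sum or conjunction over `allFin n` can be
-- rearranged along the cycles, which are lists of numbers.
extend : ∀ {n} {A : Set} → A → (Fin n → A) → ℕ → A
extend {n} a s y with y N.<? n
... | yes h = s (F.fromℕ< h)
... | no _  = a

extend-toℕ : ∀ {n} {A : Set} (a : A) (s : Fin n → A) i → extend a s (toℕ i) ≡ s i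
extend-toℕ {n} a s i with toℕ i N.<? n
... | yes h = cong s (FP.fromℕ<-toℕ i h)
... | no ¬h = contradiction (FP.toℕ<n i) ¬h

map-allFin : ∀ {A : Set} (h : ℕ → A) n → map (h ∘ toℕ) (allFin n) ≡ map h (upTo n)
map-allFin h n = ≡.trans (LP.map-tabulate id (h ∘ toℕ)) (≡.trans (go h n) (sym (LP.map-upTo h n)))
  where
  go : ∀ {A : Set} (h : ℕ → A) n → tabulate {n = n} (h ∘ toℕ) ≡ applyUpTo h n
  go h zero    = refl
  go h (suc n) = cong (h 0 ∷_) (go (h ∘ suc) n)

map-allFin-extend : ∀ {n} {A : Set} (a : A) (s : Fin n → A) → map s (allFin n) ≡ map (extend a s) (upTo n)
map-allFin-extend {n} a s = ≡.trans (LP.map-cong (sym ∘ extend-toℕ a s) (allFin n)) (map-allFin (extend a s) n)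

all-↭ : ∀ {A : Set} (r : A → Bool) {xs ys} → xs ↭ ys → all r xs ≡ all r ys
all-↭ r refl         = refl
all-↭ r (prep x e)   = cong (r x ∧_) (all-↭ r e)
all-↭ r (swap {xs} {ys} x y e) = ≡.trans (sym (∧-assoc (r x) (r y) (all r xs)))
  (≡.trans (cong₂ _∧_ (∧-comm (r x) (r y)) (all-↭ r e)) (∧-assoc (r y) (r x) (all r ys)))
all-↭ r (trans e g)  = ≡.trans (all-↭ r e) (all-↭ r g)

all-++ : ∀ {A : Set} (r : A → Bool) xs ys → all r (xs ++ ys) ≡ all r xs ∧ all r ys
all-++ r []       ys = refl
all-++ r (x ∷ xs) ys = ≡.trans (cong (r x ∧_) (all-++ r xs ys)) (sym (∧-assoc (r x) (all r xs) (all r ys)))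

all-const : ∀ {A : Set} (r : A → Bool) b x xs → (∀ {y} → y ∈ x ∷ xs → r y ≡ b) → all r (x ∷ xs) ≡ b
all-const r b x []       e = ≡.trans (∧-identityʳ (r x)) (e (here refl))
all-const r b x (y ∷ xs) e = ≡.trans (cong₂ _∧_ (e (here refl)) (all-const r b y xs (e ∘ there))) (∧-idem b)

sum-zeros : ∀ {A : Set} (h : A → ℕ) xs → (∀ {y} → y ∈ xs → h y ≡ 0) → sum (map h xs) ≡ 0
sum-zeros h []       e = refl
sum-zeros h (x ∷ xs) e = cong₂ N._+_ (e (here refl)) (sum-zeros h xs (e ∘ there))

pathCount-total : ∀ x ys z → pathCount N._≤ᵇ_ x ys z N.+ pathCount (λ s t → t N.<ᵇ s) x ys z ≡ suc (length ys)
pathCount-total x ys z = go x ys z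
  where
  open ≡-Reasoning
  one : ∀ x y → bit (x N.≤ᵇ y) N.+ bit (y N.<ᵇ x) ≡ 1
  one x y with x N.≤? y
  ... | yes h rewrite ≤⇒≤ᵇ-true h | ≮⇒<ᵇ-false h = refl
  ... | no h  rewrite >⇒≤ᵇ-false (NP.≰⇒> h) | <⇒<ᵇ-true (NP.≰⇒> h) = refl
  interchange : ∀ a b c d → (a N.+ b) N.+ (c N.+ d) ≡ (a N.+ c) N.+ (b N.+ d)
  interchange a b c d = begin
    (a N.+ b) N.+ (c N.+ d) ≡⟨ NP.+-assoc a b (c N.+ d) ⟩
    a N.+ (b N.+ (c N.+ d)) ≡⟨ cong (a N.+_) (≡.trans (sym (NP.+-assoc b c d)) (≡.trans (cong (N._+ d) (NP.+-comm b c)) (NP.+-assoc c b d))) ⟩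
    a N.+ (c N.+ (b N.+ d)) ≡⟨ NP.+-assoc a c (b N.+ d) ⟨
    (a N.+ c) N.+ (b N.+ d) ∎
  go : ∀ x ys z → pathCount N._≤ᵇ_ x ys z N.+ pathCount (λ s t → t N.<ᵇ s) x ys z ≡ suc (length ys)
  go x []       z = one x z
  go x (y ∷ ys) z = ≡.trans (interchange (bit (x N.≤ᵇ y)) (pathCount N._≤ᵇ_ y ys z) (bit (y N.<ᵇ x)) (pathCount (λ s t → t N.<ᵇ s) y ys z))
    (cong₂ N._+_ (one x y) (go y ys z))

module _ {n} (v : Vec (Fin n) n) where
  open Statistics v

  private
    leaderM : Fin n → ℕ
    leaderM i = if isLeader v i then Mcyc v i else 0

    oddCycle : Fin n → Bool
    oddCycle i = oddᵇ (cycLen v i)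

    index : ∀ {y} → y N.< n → ∃ λ i → toℕ i ≡ y
    index h = F.fromℕ< h , FP.toℕ-fromℕ< h

  -- Only the least element of the cycle is a leader, so all other summands are 0.
  sum-leaderM : ∀ c → IsCycle f c → Unique c → All (N._< n) c → length c N.≤ n →
    sum (map (extend 0 leaderM) c) ≡ proj₁ (cycleState c) N.⊓ proj₂ (cycleState c)
  sum-leaderM (x ∷ ys) (q , mn) u@(x∉ ∷ _) (x<n ∷ bd) len = ≡.trans (cong₂ N._+_ leader others) (NP.+-identityʳ _)
    where
    leader : extend 0 leaderM x ≡ proj₁ (cycleState (x ∷ ys)) N.⊓ proj₂ (cycleState (x ∷ ys))
    leader with index x<n
    ... | i , refl rewrite extend-toℕ 0 leaderM i | isLeader-true i ys q mn =
      cong₂ N._⊓_ (cA-path i ys q (cycLen-path i ys q x∉ len)) (cD-path i ys q (cycLen-path i ys q x∉ len))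
    others : sum (map (extend 0 leaderM) ys) ≡ 0
    others = sum-zeros _ ys λ y∈ → other y∈ (index (All.lookup bd y∈))
      where
      other : ∀ {y} → y ∈ ys → (∃ λ i → toℕ i ≡ y) → extend 0 leaderM y ≡ 0
      other y∈ (i , refl) rewrite extend-toℕ 0 leaderM i | isLeader-false i x ys q mn u len y∈ = refl

  -- All elements of the cycle see the same length, and every step is either an ascent or a descent,
  -- so the length is the sum of the two counts.
  all-oddCycle : ∀ c → IsCycle f c → Unique c → All (N._< n) c → length c N.≤ n →
    all (extend true oddCycle) c ≡ oddᵇ (proj₁ (cycleState c) N.+ proj₂ (cycleState c))
  all-oddCycle (x ∷ ys) (q , _) u bd len = ≡.trans
    (all-const _ (oddᵇ (suc (length ys))) x ys (λ y∈ → same y∈ (index (All.lookup bd y∈))))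
    (cong oddᵇ (sym (pathCount-total x ys x)))
    where
    same : ∀ {y} → y ∈ x ∷ ys → (∃ λ i → toℕ i ≡ y) → extend true oddCycle y ≡ oddᵇ (suc (length ys))
    same y∈ (i , refl) = ≡.trans (extend-toℕ true oddCycle i) (cong oddᵇ (cycLen-member i x ys q u len y∈))

  private
    totals : ∀ cs → All (IsCycle f) cs → Unique (concat cs) → All (N._< n) (concat cs) → length (concat cs) N.≤ n →
      sum (map (extend 0 leaderM) (concat cs)) ≡ totalM (map cycleState cs) ×
      all (extend true oddCycle) (concat cs) ≡ allOdd (map cycleState cs)
    totals []       []         u bd len = refl , refl
    totals (c ∷ cs) (ic ∷ ics) u bd len with Unique-++⁻ c u | AllP.++⁻ c bd
    ... | uc , ucs , _ | bc , bcs with totals cs ics ucs bcs (NP.≤-trans (NP.m≤n+m _ (length c)) (subst (N._≤ n) (LP.length-++ c) len))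
    ...   | e₁ , e₂ =
      ≡.trans (cong sum (LP.map-++ (extend 0 leaderM) c (concat cs)))
        (≡.trans (sum-++ (map (extend 0 leaderM) c) _) (cong₂ N._+_ (sum-leaderM c ic uc bc lenc) e₁)) ,
      ≡.trans (all-++ (extend true oddCycle) c (concat cs)) (cong₂ _∧_ (all-oddCycle c ic uc bc lenc) e₂)
      where
      lenc : length c N.≤ n
      lenc = NP.≤-trans (NP.m≤m+n (length c) _) (subst (N._≤ n) (LP.length-++ c) len)

  decomposition-statistics : ∀ {cs} → Decomposition n (oneLine v) cs →
    Mperm v ≡ totalM (map cycleState cs) × allCyclesOdd v ≡ allOdd (map cycleState cs)
  decomposition-statistics {cs} (decomposition size cover cycles)
    with totals cs cycles (Unique-resp-↭ (↭-sym cover) (UP.upTo⁺ n)) (PermP.All-resp-↭ (↭-sym cover) (upTo-bounded n))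
           (NP.≤-reflexive (≡.trans (PermP.↭-length cover) (LP.length-upTo n)))
  ... | e₁ , e₂ =
    ≡.trans (cong sum (map-allFin-extend 0 leaderM)) (≡.trans (sum-↭ (PermP.map⁺ (extend 0 leaderM) (↭-sym cover))) e₁) ,
    ≡.trans (cong (foldr _∧_ true) (map-allFin-extend true oddCycle)) (≡.trans (all-↭ (extend true oddCycle) (↭-sym cover)) e₂)

∑-paired : {A B C : Set} (g : A → C) (h : B → C) (F : A → ℤ) (G : B → ℤ) (xs : List A) (ys : List B) → map g xs ≡ map h ys →
  (∀ x y → y ∈ ys → g x ≡ h y → F x ≡ G y) → ∑ F xs ≡ ∑ G ys
∑-paired g h F G []       []       e k = refl
∑-paired g h F G (x ∷ xs) (y ∷ ys) e k = cong₂ _+_ (k x y (here refl) (LP.∷-injectiveˡ e))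
  (∑-paired g h F G xs ys (LP.∷-injectiveʳ e) (λ x′ y′ → k x′ y′ ∘ there))

-- `perms↭decomposed` compares words. `↭-map-inv` lifts it to a rearrangement of the vectors
-- themselves, which is then paired entry by entry with the decompositions.
p≡P : ∀ n j → + p n j ≡ P j n
p≡P n j with PermP.↭-map-inv oneLine (perms↭decomposed n)
... | vs , e , r = begin
  + p n j  ≡⟨ length-filter good (Sym n) ⟩
  ∑ (ind ∘ good) (Sym n)  ≡⟨ ∑-↭ (ind ∘ good) r ⟩
  ∑ (ind ∘ good) vs  ≡⟨ ∑-paired oneLine proj₁ (ind ∘ good) _ vs (decomposed n) (sym e) (λ v (l , cs) → value v l cs) ⟩
  ∑ (λ (_ , cs) → weight j (map cycleState cs)) (decomposed n) ≡⟨ ∑-decomposed n (weight j) ⟩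
  P j n  ∎
  where
  open ≡-Reasoning
  good : Vec (Fin n) n → Bool
  good v = allCyclesOdd v ∧ (Mperm v N.≡ᵇ j)
  value : ∀ v l cs → (l , cs) ∈ decomposed n → oneLine v ≡ l → ind (good v) ≡ weight j (map cycleState cs)
  value v l cs lcs∈ refl with decomposition-statistics v (decomposed-sound n lcs∈)
  ... | e₁ , e₂ = ≡.trans (cong₂ (λ o m → ind (o ∧ (m N.≡ᵇ j))) e₂ e₁) (sym (weight≡ind j (map cycleState cs)))

-- Comparison of the closed forms

-- The absorption identity, stated over the integers so that k > n needs no separate hypothesis:
-- both binomial coefficients are then 0.
C-absorb : ∀ n k → (+ 1 + + k) * + (n C suc k) ≡ (+ n - + k) * + (n C k)
C-absorb zero    zero    = refl
C-absorb zero    (suc k) = ≡.trans (ZP.*-zeroʳ (+ 2 + + k)) (sym (ZP.*-zeroʳ (+ 0 - + suc k)))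
C-absorb (suc n) zero    = begin
  (+ 1 + + 0) * + (suc n C 1)  ≡⟨ cong (λ x → (+ 1 + + 0) * + x) (nCk+nC[k+1]≡[n+1]C[k+1] n 0) ⟨
  (+ 1 + + 0) * (+ 1 + + (n C 1))         ≡⟨ ring₁ (+ (n C 1)) ⟩
  + 1 + (+ 1 + + 0) * + (n C 1)           ≡⟨ cong (_+_ (+ 1)) (C-absorb n 0) ⟩
  + 1 + (+ n - + 0) * + 1  ≡⟨ ring₂ (+ n) ⟩
  (+ suc n - + 0) * + 1  ∎
  where
  open ≡-Reasoning
  ring₁ : ∀ c → (+ 1 + + 0) * (+ 1 + c) ≡ + 1 + (+ 1 + + 0) * c
  ring₁ = solve-∀
  ring₂ : ∀ n → + 1 + (n - + 0) * + 1 ≡ (+ 1 + n - + 0) * + 1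
  ring₂ = solve-∀
C-absorb (suc n) (suc k) = begin
  (+ 2 + + k) * + (suc n C suc (suc k))  ≡⟨ cong (λ x → (+ 2 + + k) * + x) (nCk+nC[k+1]≡[n+1]C[k+1] n (suc k)) ⟨
  (+ 2 + + k) * (c₁ + c₂)  ≡⟨ ZP.*-distribˡ-+ (+ 2 + + k) c₁ c₂ ⟩
  (+ 2 + + k) * c₁ + (+ 2 + + k) * c₂  ≡⟨ cong (_+_ ((+ 2 + + k) * c₁)) (C-absorb n (suc k)) ⟩
  (+ 2 + + k) * c₁ + (+ n - + suc k) * c₁  ≡⟨ ring₁ (+ k) (+ n) c₁ ⟩
  (+ n - + k) * c₁ + (+ 1 + + k) * c₁  ≡⟨ cong (_+_ ((+ n - + k) * c₁)) (C-absorb n k) ⟩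
  (+ n - + k) * c₁ + (+ n - + k) * c₀  ≡⟨ ring₂ (+ k) (+ n) c₀ c₁ ⟩
  (+ suc n - + suc k) * (c₀ + c₁)  ≡⟨ cong (λ x → (+ suc n - + suc k) * + x) (nCk+nC[k+1]≡[n+1]C[k+1] n k) ⟩
  (+ suc n - + suc k) * + (suc n C suc k)  ∎
  where
  open ≡-Reasoning
  c₀ c₁ c₂ : ℤ
  c₀ = + (n C k)
  c₁ = + (n C suc k)
  c₂ = + (n C suc (suc k))
  ring₁ : ∀ k n c → (+ 2 + k) * c + (n - (+ 1 + k)) * c ≡ (n - k) * c + (+ 1 + k) * c
  ring₁ = solve-∀
  ring₂ : ∀ k n c d → (n - k) * d + (n - k) * c ≡ (+ 1 + n - (+ 1 + k)) * (c + d)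
  ring₂ = solve-∀

C-2 : ∀ n → + 2 * + (n C 2) ≡ + n * (+ n - + 1)
C-2 n = ≡.trans (C-absorb n 1) (≡.trans (cong (_*_ (+ n - + 1)) (≡.trans (sym (ZP.*-identityˡ (+ (n C 1)))) (C-absorb n 0))) (ring (+ n)))
  where
  ring : ∀ n → (n - + 1) * ((n - + 0) * + 1) ≡ n * (n - + 1)
  ring = solve-∀

C-3 : ∀ n → + 6 * + (n C 3) ≡ + n * (+ n - + 1) * (+ n - + 2)
C-3 n = begin
  + 6 * + (n C 3)  ≡⟨ ZP.*-assoc (+ 2) (+ 3) (+ (n C 3)) ⟩
  + 2 * (+ 3 * + (n C 3))  ≡⟨ cong (_*_ (+ 2)) (C-absorb n 2) ⟩
  + 2 * ((+ n - + 2) * + (n C 2))      ≡⟨ ring (+ n - + 2) (+ (n C 2)) ⟩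
  + 2 * + (n C 2) * (+ n - + 2)        ≡⟨ cong (_* (+ n - + 2)) (C-2 n) ⟩
  + n * (+ n - + 1) * (+ n - + 2)      ∎
  where
  open ≡-Reasoning
  ring : ∀ x c → + 2 * (x * c) ≡ + 2 * c * x
  ring = solve-∀

C-4 : ∀ n → + 24 * + (n C 4) ≡ + n * (+ n - + 1) * (+ n - + 2) * (+ n - + 3)
C-4 n = begin
  + 24 * + (n C 4)  ≡⟨ ZP.*-assoc (+ 6) (+ 4) (+ (n C 4)) ⟩
  + 6 * (+ 4 * + (n C 4))  ≡⟨ cong (_*_ (+ 6)) (C-absorb n 3) ⟩
  + 6 * ((+ n - + 3) * + (n C 3))      ≡⟨ ring (+ n - + 3) (+ (n C 3)) ⟩
  + 6 * + (n C 3) * (+ n - + 3)        ≡⟨ cong (_* (+ n - + 3)) (C-3 n) ⟩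
  _ ∎
  where
  open ≡-Reasoning
  ring : ∀ x c → + 6 * (x * c) ≡ + 6 * c * x
  ring = solve-∀

C-5 : ∀ n → + 120 * + (n C 5) ≡ + n * (+ n - + 1) * (+ n - + 2) * (+ n - + 3) * (+ n - + 4)
C-5 n = begin
  + 120 * + (n C 5)  ≡⟨ ZP.*-assoc (+ 24) (+ 5) (+ (n C 5)) ⟩
  + 24 * (+ 5 * + (n C 5))  ≡⟨ cong (_*_ (+ 24)) (C-absorb n 4) ⟩
  + 24 * ((+ n - + 4) * + (n C 4))     ≡⟨ ring (+ n - + 4) (+ (n C 4)) ⟩
  + 24 * + (n C 4) * (+ n - + 4)       ≡⟨ cong (_* (+ n - + 4)) (C-4 n) ⟩
  _ ∎
  where
  open ≡-Reasoning
  ring : ∀ x c → + 24 * (x * c) ≡ + 24 * c * x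
  ring = solve-∀

pos-^ : ∀ b n → + (b N.^ n) ≡ (+ b) ^ n
pos-^ b zero    = refl
pos-^ b (suc n) = ≡.trans (ZP.pos-* b (b N.^ n)) (cong (_*_ (+ b)) (pos-^ b n))

E≡prefixSum : ∀ n k → + E (suc n) k ≡ prefixSum [] k n
E≡prefixSum n k = begin
  + E (suc n) k  ≡⟨ length-filter (λ v → des (oneLine v) N.≡ᵇ k) (Sym (suc n)) ⟩
  ∑ (λ v → ind (des (oneLine v) N.≡ᵇ k)) (Sym (suc n))  ≡⟨ ∑-map (λ l → ind (des l N.≡ᵇ k)) oneLine (Sym (suc n)) ⟨
  ∑ (λ l → ind (des l N.≡ᵇ k)) (perms (suc n))  ≡⟨ ∑-cong (perms (suc n)) (λ l _ → cong (λ d → ind (d N.≡ᵇ k)) (des≡downs l)) ⟩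
  ∑ (count k ∘ word) (perms (suc n))  ≡⟨ ∑-perms≡wordSum n (count k) ⟩
  prefixSum [] k n  ∎
  where open ≡-Reasoning

b-3≡prefixSums : ∀ n → + b (suc n) 3 ≡ prefixSum [] 3 n - (prefixSum (D ∷ []) 2 n + (prefixSum (U ∷ D ∷ D ∷ []) 1 n
  + (prefixSum (U ∷ U ∷ D ∷ D ∷ D ∷ []) 0 n + prefixSum (U ∷ D ∷ U ∷ D ∷ D ∷ []) 0 n)))
b-3≡prefixSums n = begin
  + b (suc n) 3  ≡⟨ length-filter (good ∘ oneLine) (Sym (suc n)) ⟩
  ∑ (ind ∘ good ∘ oneLine) (Sym (suc n))  ≡⟨ ∑-map (ind ∘ good) oneLine (Sym (suc n)) ⟨
  ∑ (ind ∘ good) (perms (suc n))  ≡⟨ ∑-cong (perms (suc n)) (λ l l∈ → ≡.trans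
      (cong₂ (λ x d → ind (x ∧ (d N.≡ᵇ 3))) (ballotAux≡ballotWord 0 0 l (proj₂ (proj₂ (∈perms⇒IsPerm l∈)))) (des≡downs l)) (ballot-3 (word l))) ⟩
  ∑ (ballotCount ∘ word) (perms (suc n))  ≡⟨ ∑-perms≡wordSum n ballotCount ⟩
  wordSum n ballotCount  ≡⟨ wordSum-cong n (λ w _ → negate (count 3 w) _) ⟩
  wordSum n (λ w → - + 1 * (F₁ w + (F₂ w + (F₃ w + F₄ w))) + count 3 w)
    ≡⟨ wordSum-lin n (- + 1) (λ w → F₁ w + (F₂ w + (F₃ w + F₄ w))) (count 3) ⟩
  - + 1 * wordSum n (λ w → F₁ w + (F₂ w + (F₃ w + F₄ w))) + wordSum n (count 3)
    ≡⟨ negate (wordSum n (count 3)) _ ⟨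
  wordSum n (count 3) - wordSum n (λ w → F₁ w + (F₂ w + (F₃ w + F₄ w)))
    ≡⟨ cong (_-_ (wordSum n (count 3))) (≡.trans (wordSum-+ n F₁ (λ w → F₂ w + (F₃ w + F₄ w)))
        (cong (_+_ (wordSum n F₁)) (≡.trans (wordSum-+ n F₂ (λ w → F₃ w + F₄ w)) (cong (_+_ (wordSum n F₂)) (wordSum-+ n F₃ F₄))))) ⟩
  _ ∎
  where
  open ≡-Reasoning
  good : List ℕ → Bool
  good l = isBallot l ∧ (des l N.≡ᵇ 3)
  F₁ F₂ F₃ F₄ : Word → ℤ
  F₁ = prefixed (D ∷ []) (count 2)
  F₂ = prefixed (U ∷ D ∷ D ∷ []) (count 1)
  F₃ = prefixed (U ∷ U ∷ D ∷ D ∷ D ∷ []) (count 0)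
  F₄ = prefixed (U ∷ D ∷ U ∷ D ∷ D ∷ []) (count 0)
  negate : ∀ x y → x - y ≡ - + 1 * y + x
  negate = solve-∀

-- The common normal form of 120 times both counts and the formula at n = m + 4, with i, a, t, f
-- standing for m, 2^m, 3^m, 4^m.
closedForm : ℤ → ℤ → ℤ → ℤ → ℤ
closedForm i a t f = + 30720 * f - + 51840 * t - + 12960 * t * i + + 22080 * a + + 13040 * a * i + + 1440 * a * i * i - + 80 * a * i * i * i - + 960 - + 448 * i + + 260 * i * i - + 130 * i * i * i - + 140 * i * i * i * i - + 22 * i * i * i * i * i

120b-3 : ∀ m → + 120 * + b (4 N.+ m) 3 ≡ closedForm (+ m) ((+ 2) ^ m) ((+ 3) ^ m) ((+ 4) ^ m)
120b-3 m = begin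
  + 120 * + b (4 N.+ m) 3  ≡⟨ cong (_*_ (+ 120)) (b-3≡prefixSums (3 N.+ m)) ⟩
  + 120 * (e - (x₁ + (x₂ + (x₃ + x₄))))       ≡⟨ distribute e x₁ x₂ x₃ x₄ ⟩
  + 120 * e - (+ 120 * x₁ + (+ 120 * x₂ + (+ 120 * x₃ + + 120 * x₄)))
    ≡⟨ cong₂ _-_ (eulerian-value-3 (3 N.+ m)) (cong₂ _+_ (value-D-2 m) (cong₂ _+_ (value-UDD-1 m) (cong₂ _+_ (value-UUDDD-0 m) (value-UDUDD-0 m)))) ⟩
  _ ≡⟨ ring (+ m) ((+ 2) ^ m) ((+ 3) ^ m) ((+ 4) ^ m) ⟩
  _ ∎
  where
  open ≡-Reasoning
  e x₁ x₂ x₃ x₄ : ℤ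
  e  = prefixSum [] 3 (3 N.+ m)
  x₁ = prefixSum (D ∷ []) 2 (3 N.+ m)
  x₂ = prefixSum (U ∷ D ∷ D ∷ []) 1 (3 N.+ m)
  x₃ = prefixSum (U ∷ U ∷ D ∷ D ∷ D ∷ []) 0 (3 N.+ m)
  x₄ = prefixSum (U ∷ D ∷ U ∷ D ∷ D ∷ []) 0 (3 N.+ m)
  distribute : ∀ e x₁ x₂ x₃ x₄ → + 120 * (e - (x₁ + (x₂ + (x₃ + x₄)))) ≡ + 120 * e - (+ 120 * x₁ + (+ 120 * x₂ + (+ 120 * x₃ + + 120 * x₄)))
  distribute = solve-∀
  ring : ∀ i a t f → + 20 * (+ 24 * (+ 4 * (+ 4 * (+ 4 * f))) - + 18 * (+ 3 + i + + 2) * (+ 3 * (+ 3 * (+ 3 * t))) + + 6 * (+ 3 + i + + 1) * (+ 3 + i + + 2) * (+ 2 * (+ 2 * (+ 2 * a))) - (+ 3 + i) * (+ 3 + i + + 1) * (+ 3 + i + + 2))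
    - ((+ 3240 * t + + 3240 * t * i - + 3840 * a - + 4800 * a * i - + 960 * a * i * i + + 720 + + 1140 * i + + 480 * i * i + + 60 * i * i * i) + ((+ 960 * a + + 400 * a * i + + 480 * a * i * i + + 80 * a * i * i * i - + 960 - + 1100 * i - + 920 * i * i - + 340 * i * i * i - + 40 * i * i * i * i) + ((- (+ 86 * i) - + 45 * i * i + + 80 * i * i * i + + 45 * i * i * i * i + + 6 * i * i * i * i * i) + (- (+ 446 * i) - + 15 * i * i + + 310 * i * i * i + + 135 * i * i * i * i + + 16 * i * i * i * i * i))))
    ≡ + 30720 * f - + 51840 * t - + 12960 * t * i + + 22080 * a + + 13040 * a * i + + 1440 * a * i * i - + 80 * a * i * i * i - + 960 - + 448 * i + + 260 * i * i - + 130 * i * i * i - + 140 * i * i * i * i - + 22 * i * i * i * i * i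
  ring = solve-∀

120p-3 : ∀ m → + 120 * + p (4 N.+ m) 3 ≡ closedForm (+ m) ((+ 2) ^ m) ((+ 3) ^ m) ((+ 4) ^ m)
120p-3 m = begin
  + 120 * + p (4 N.+ m) 3         ≡⟨ cong (_*_ (+ 120)) (p≡P (4 N.+ m) 3) ⟩
  + 120 * P 3 (4 N.+ m)           ≡⟨ ZP.*-assoc (+ 20) (+ 6) (P 3 (4 N.+ m)) ⟩
  + 20 * (+ 6 * P 3 (4 N.+ m))    ≡⟨ cong (_*_ (+ 20)) (6P-3-value m) ⟩
  -- As 20 * 132 = 22 * 120, the binomial coefficient is split off with exactly the factor 120 that
  -- `C-5` expands.
  _ ≡⟨ isolate (+ m) ((+ 2) ^ m) ((+ 3) ^ m) ((+ 4) ^ m) (+ ((4 N.+ m) C 5)) ⟩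
  _ ≡⟨ cong (λ c → rest (+ m) ((+ 2) ^ m) ((+ 3) ^ m) ((+ 4) ^ m) - + 22 * c) (C-5 (4 N.+ m)) ⟩
  _ ≡⟨ ring (+ m) ((+ 2) ^ m) ((+ 3) ^ m) ((+ 4) ^ m) ⟩
  _ ∎
  where
  open ≡-Reasoning
  rest : ℤ → ℤ → ℤ → ℤ → ℤ
  rest i a t f = + 20 * (+ 6 * (+ 4 * (+ 4 * (+ 4 * (+ 4 * f)))) - + 24 * ((+ 4 + i) * (+ 3 * (+ 3 * (+ 3 * t)))) + + 27 * ((+ 4 + i) * ((+ 3 + i) * (+ 2 * (+ 2 * a)))) - + 8 * ((+ 4 + i) * ((+ 3 + i) * (+ 2 + i))) + + 4 * ((+ 4 + i) * ((+ 3 + i) * ((+ 2 + i) * (+ 1 + i)))) - + 2 * ((+ 4 + i) * ((+ 3 + i) * ((+ 2 + i) * (+ 2 * a)))) - + 6 * (+ 2 * (+ 2 * (+ 2 * (+ 2 * a)))) + + 12 * (+ 4 + i))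
  isolate : ∀ i a t f c → + 20 * (+ 6 * (+ 4 * (+ 4 * (+ 4 * (+ 4 * f)))) - + 24 * ((+ 4 + i) * (+ 3 * (+ 3 * (+ 3 * t)))) + + 27 * ((+ 4 + i) * ((+ 3 + i) * (+ 2 * (+ 2 * a))))
    - + 8 * ((+ 4 + i) * ((+ 3 + i) * (+ 2 + i))) - + 132 * c
    + + 4 * ((+ 4 + i) * ((+ 3 + i) * ((+ 2 + i) * (+ 1 + i)))) - + 2 * ((+ 4 + i) * ((+ 3 + i) * ((+ 2 + i) * (+ 2 * a))))
    - + 6 * (+ 2 * (+ 2 * (+ 2 * (+ 2 * a)))) + + 12 * (+ 4 + i))
    ≡ + 20 * (+ 6 * (+ 4 * (+ 4 * (+ 4 * (+ 4 * f)))) - + 24 * ((+ 4 + i) * (+ 3 * (+ 3 * (+ 3 * t)))) + + 27 * ((+ 4 + i) * ((+ 3 + i) * (+ 2 * (+ 2 * a)))) - + 8 * ((+ 4 + i) * ((+ 3 + i) * (+ 2 + i))) + + 4 * ((+ 4 + i) * ((+ 3 + i) * ((+ 2 + i) * (+ 1 + i)))) - + 2 * ((+ 4 + i) * ((+ 3 + i) * ((+ 2 + i) * (+ 2 * a)))) - + 6 * (+ 2 * (+ 2 * (+ 2 * (+ 2 * a)))) + + 12 * (+ 4 + i)) - + 22 * (+ 120 * c)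
  isolate = solve-∀
  ring : ∀ i a t f → + 20 * (+ 6 * (+ 4 * (+ 4 * (+ 4 * (+ 4 * f)))) - + 24 * ((+ 4 + i) * (+ 3 * (+ 3 * (+ 3 * t)))) + + 27 * ((+ 4 + i) * ((+ 3 + i) * (+ 2 * (+ 2 * a)))) - + 8 * ((+ 4 + i) * ((+ 3 + i) * (+ 2 + i))) + + 4 * ((+ 4 + i) * ((+ 3 + i) * ((+ 2 + i) * (+ 1 + i)))) - + 2 * ((+ 4 + i) * ((+ 3 + i) * ((+ 2 + i) * (+ 2 * a)))) - + 6 * (+ 2 * (+ 2 * (+ 2 * (+ 2 * a)))) + + 12 * (+ 4 + i))
    - + 22 * ((+ 4 + i) * (+ 4 + i - + 1) * (+ 4 + i - + 2) * (+ 4 + i - + 3) * (+ 4 + i - + 4))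
    ≡ + 30720 * f - + 51840 * t - + 12960 * t * i + + 22080 * a + + 13040 * a * i + + 1440 * a * i * i - + 80 * a * i * i * i - + 960 - + 448 * i + + 260 * i * i - + 130 * i * i * i - + 140 * i * i * i * i - + 22 * i * i * i * i * i
  ring = solve-∀

120-formula : ∀ m → let n = 4 N.+ m in
  + 120 * ((+ 4) * (+ E (3 N.+ m) 3) - ((+ (n C 3)) - (+ (n C 2)) + (+ 4)) * (+ (2 N.^ (2 N.+ m)))
    - (+ 22) * (+ (n C 5)) + (+ 16) * (+ (n C 4)) - (+ 4) * (+ (n C 3)) + (+ 2) * (+ n))
  ≡ closedForm (+ m) ((+ 2) ^ m) ((+ 3) ^ m) ((+ 4) ^ m)
120-formula m = begin
  + 120 * (+ 4 * e - (c₃ - c₂ + + 4) * w - + 22 * c₅ + + 16 * c₄ - + 4 * c₃ + + 2 * + n)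
    ≡⟨ distribute e c₂ c₃ c₄ c₅ w (+ n) ⟩
  + 4 * (+ 120 * e) - (+ 20 * (+ 6 * c₃) - + 60 * (+ 2 * c₂) + + 480) * w - + 22 * (+ 120 * c₅) + + 80 * (+ 24 * c₄) - + 80 * (+ 6 * c₃) + + 240 * + n
    ≡⟨ cong₂ (λ x y → + 4 * x - (+ 20 * (+ 6 * c₃) - + 60 * (+ 2 * c₂) + + 480) * y - + 22 * (+ 120 * c₅) + + 80 * (+ 24 * c₄) - + 80 * (+ 6 * c₃) + + 240 * + n)
        (≡.trans (cong (_*_ (+ 120)) (E≡prefixSum (2 N.+ m) 3)) (eulerian-value-3 (2 N.+ m))) (pos-^ 2 (2 N.+ m)) ⟩
  + 4 * e′ - (+ 20 * (+ 6 * c₃) - + 60 * (+ 2 * c₂) + + 480) * w′ - + 22 * (+ 120 * c₅) + + 80 * (+ 24 * c₄) - + 80 * (+ 6 * c₃) + + 240 * + n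
    ≡⟨ cong₂ (λ x y → + 4 * e′ - (+ 20 * x - + 60 * y + + 480) * w′ - + 22 * (+ 120 * c₅) + + 80 * (+ 24 * c₄) - + 80 * x + + 240 * + n) (C-3 n) (C-2 n) ⟩
  _ ≡⟨ cong₂ (λ x y → + 4 * e′ - (+ 20 * (+ n * (+ n - + 1) * (+ n - + 2)) - + 60 * (+ n * (+ n - + 1)) + + 480) * w′ - + 22 * x + + 80 * y
         - + 80 * (+ n * (+ n - + 1) * (+ n - + 2)) + + 240 * + n) (C-5 n) (C-4 n) ⟩
  _ ≡⟨ ring (+ m) ((+ 2) ^ m) ((+ 3) ^ m) ((+ 4) ^ m) ⟩
  _ ∎
  where
  open ≡-Reasoning
  n : ℕ
  n = 4 N.+ m
  e e′ w w′ c₂ c₃ c₄ c₅ : ℤ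
  e  = + E (3 N.+ m) 3
  e′ = + 20 * (+ 24 * (+ 4) ^ (2 N.+ m) - + 18 * (+ (2 N.+ m) + + 2) * (+ 3) ^ (2 N.+ m)
    + + 6 * (+ (2 N.+ m) + + 1) * (+ (2 N.+ m) + + 2) * (+ 2) ^ (2 N.+ m) - + (2 N.+ m) * (+ (2 N.+ m) + + 1) * (+ (2 N.+ m) + + 2))
  w  = + (2 N.^ (2 N.+ m))
  w′ = (+ 2) ^ (2 N.+ m)
  c₂ = + (n C 2)
  c₃ = + (n C 3)
  c₄ = + (n C 4)
  c₅ = + (n C 5)
  distribute : ∀ e c₂ c₃ c₄ c₅ w n → + 120 * (+ 4 * e - (c₃ - c₂ + + 4) * w - + 22 * c₅ + + 16 * c₄ - + 4 * c₃ + + 2 * n)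
    ≡ + 4 * (+ 120 * e) - (+ 20 * (+ 6 * c₃) - + 60 * (+ 2 * c₂) + + 480) * w - + 22 * (+ 120 * c₅) + + 80 * (+ 24 * c₄) - + 80 * (+ 6 * c₃) + + 240 * n
  distribute = solve-∀
  ring : ∀ i a t f → + 4 * (+ 20 * (+ 24 * (+ 4 * (+ 4 * f)) - + 18 * (+ 2 + i + + 2) * (+ 3 * (+ 3 * t)) + + 6 * (+ 2 + i + + 1) * (+ 2 + i + + 2) * (+ 2 * (+ 2 * a)) - (+ 2 + i) * (+ 2 + i + + 1) * (+ 2 + i + + 2)))
    - (+ 20 * ((+ 4 + i) * (+ 4 + i - + 1) * (+ 4 + i - + 2)) - + 60 * ((+ 4 + i) * (+ 4 + i - + 1)) + + 480) * (+ 2 * (+ 2 * a))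
    - + 22 * ((+ 4 + i) * (+ 4 + i - + 1) * (+ 4 + i - + 2) * (+ 4 + i - + 3) * (+ 4 + i - + 4))
    + + 80 * ((+ 4 + i) * (+ 4 + i - + 1) * (+ 4 + i - + 2) * (+ 4 + i - + 3))
    - + 80 * ((+ 4 + i) * (+ 4 + i - + 1) * (+ 4 + i - + 2)) + + 240 * (+ 4 + i)
    ≡ + 30720 * f - + 51840 * t - + 12960 * t * i + + 22080 * a + + 13040 * a * i + + 1440 * a * i * i - + 80 * a * i * i * i - + 960 - + 448 * i + + 260 * i * i - + 130 * i * i * i - + 140 * i * i * i * i - + 22 * i * i * i * i * i
  ring = solve-∀

theorem1p5 : (n : ℕ) → 4 ≤ n →
    (p n 3 ≡ b n 3) ×
    (+ b n 3 ≡ (+ 4) * (+ E (n ∸ 1) 3)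
    - ((+ (n C 3)) - (+ (n C 2)) + (+ 4)) * (+ (2 N.^ (n ∸ 2)))
    - (+ 22) * (+ (n C 5)) + (+ 16) * (+ (n C 4))
    - (+ 4) * (+ (n C 3)) + (+ 2) * (+ n))
theorem1p5 (suc (suc (suc (suc m)))) 4≤n =
  ZP.+-injective (ZP.*-cancelˡ-≡ (+ 120) _ _ (≡.trans (120p-3 m) (sym (120b-3 m)))) ,
  ZP.*-cancelˡ-≡ (+ 120) _ _ (≡.trans (120b-3 m) (sym (120-formula m)))
theorem1p5 (suc (suc (suc zero))) (N.s≤s (N.s≤s (N.s≤s ())))
theorem1p5 (suc (suc zero)) (N.s≤s (N.s≤s ()))
theorem1p5 (suc zero) (N.s≤s ())
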